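{- Let $\mathcal{P}=\{(P_{\alpha_1u_1},\pi_{\alpha_1v_1}),\dots,(P_{\alpha_{q+1}u_{q+1}},\pi_{\alpha_{q+1}v_{q+1}})\}$ be a set of $q+1$ (distinct) pairs, where $\alpha_i\in\mathcal{I}$ and $u_i,v_i\in\mathcal{U}$, and let $\mathcal{L}_{\mathcal{P}}$ be the set of all lines lying in $p(P_{\alpha_iu_i},\pi_{\alpha_iv_i})\setminus\{r_{U_1}\}$ for some $i\in\{1,\dots,q+1\}$. Then the set $$\Pi_{\mathcal{P}}=\{(\mathcal{S}_\ell\setminus\mathcal{R}_\ell)\cup\mathcal{R}_\ell^{o} : \ell\in\mathcal{L}_{\mathcal{P}}\}\cup\{\mathcal{D}_\eta\}$$ is a line-parallelism of $\Sigma_\eta$ if and only if $\mathcal{P}$ is a good set.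
   Context: Throughout, $q\ge 3$ is a prime power. Points of $\mathrm{PG}(3,q^2)$ have homogeneous coordinates $(x_1,x_2,x_3,x_4)$; $U_i$ is the point with $1$ in position $i$ and $0$ elsewhere; $t_1=\langle U_1,U_2\rangle$, $t_2=\langle U_3,U_4\rangle$, $r_{U_1}=\langle U_1,U_3\rangle$. Let $\Lambda\subset\mathbb{F}_{q^2}\setminus\{0\}$ be a fixed set of $q-1$ elements with pairwise distinct norms $\alpha^{q+1}$. For $\alpha\in\Lambda$, $\tau_\alpha:(x_1,x_2,x_3,x_4)\mapsto(x_3^q,x_4^q,\alpha^{q+1}x_1^q,\alpha^{q+1}x_2^q)$ is an involution whose set of fixed points is the Baer subgeometry $\Sigma_\alpha=\{(x,y,\alpha x^q,\alpha y^q): x,y\in\mathbb{F}_{q^2},(x,y)\neq(0,0)\}\simeq\mathrm{PG}(3,q)$. Let $\mathcal{U}=\{u\in\mathbb{F}_{q^2}:u^{q+1}=1\}$ and let $\eta$ be the unique element of $\mathcal{U}\cap\Lambda$. A set $A=\{a_1,\dots,a_t\}\subset\mathbb{F}_q\setminus\{0\}$ is fixed as follows. If $q$ is even, $t=(q-2)/2$ and $\{1\}\cup A\cup A^{ -1}=\mathbb{F}_q\setminus\{0\}$ is a partition. If $q$ is odd, $t=(q-3)/2$, $\{\pm1\}\cup A\cup A^{ -1}=\mathbb{F}_q\setminus\{0\}$ is a partition, and $-a\notin A$ for every $a\in A$. Here $A^{ -1}=\{a^{ -1}:a\in A\}$. Put $\mathcal{I}=\{\alpha\in\Lambda:\alpha^{q+1}\in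 A\}$ if $q$ is even and $\mathcal{I}=\{\alpha\in\Lambda:\alpha^{q+1}\in A\cup\{ -1\}\}$ if $q$ is odd. For $P\in t_1$ let $r_P=\langle P,P^{\tau_\eta}\rangle$. $\mathcal{D}_\eta=\{r_P\cap\Sigma_\eta:P\in t_1\}$ is a Desarguesian line-spread of $\Sigma_\eta$. In general, if $\ell$ is a line of $\mathrm{PG}(3,q^2)$ with $\ell,\ell^{\tau_\eta}$ skew, $\mathcal{S}_\ell=\{\langle P,P^{\tau_\eta}\rangle\cap\Sigma_\eta:P\in\ell\}$ is the Desarguesian line-spread of $\Sigma_\eta$ with transversals $\ell,\ell^{\tau_\eta}$. For $\alpha\in\mathcal{I}$, $u,v\in\mathcal{U}$: $P_{\alpha u}=(1,0,\alpha u,0)$ is a point of $r_{U_1}\cap\Sigma_\alpha$; $\pi_{\alpha v}$ is the plane $X_4=\alpha vX_2$ (it contains $r_{U_1}$ and meets $\Sigma_\alpha$ in a Baer subplane); $p(P_{\alpha u},\pi_{\alpha v})$ is the set of the $q+1$ lines of $\pi_{\alpha v}$ through $P_{\alpha u}$ meeting $\pi_{\alpha v}\cap\Sigma_\alpha$ in a Baer subline (one of them is $r_{U_1}$). For each line $\ell\ne r_{U_1}$ in such a $p(P_{\alpha u},\pi_{\alpha v})$, the lines $\ell,\ell^{\tau_\eta}$ are skew and $\mathcal{R}_\ell:=\mathcal{D}_\eta\cap\mathcal{S}_\ell$ is a regulus of $\Sigma_\eta$ containing $r_{U_1}\cap\Sigma_\eta$; $\mathcal{R}_\ell^{o}$ is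 its opposite regulus. A set $\mathcal{P}$ of $q+1$ pairs as in the claim is a good set if for any two of its members with $(\alpha_i,u_i,v_i)\ne(\alpha_j,u_j,v_j)$ both $u_iv_j-v_iu_j\neq0$ and $\alpha_iu_i(\alpha_jv_j)^q-(\alpha_iv_i)^q\alpha_ju_j\neq0$ hold. A line-spread of $\mathrm{PG}(3,q)$ is a set of lines partitioning the points; a line-parallelism is a set of pairwise disjoint line-spreads such that every line lies in exactly one of them. -}

module Defs where

open import Level using (0ℓ) renaming (suc to lsuc)
open import Algebra.Bundles using (CommutativeRing)
open import Algebra.Structures using (IsCommutativeRing)
import Algebra.Properties.Semiring.Exp as SemiringExp
import Data.Fin.Properties as Fin
open import Data.Empty using (⊥-elim)
open import Data.Fin.Base using (Fin)
open import Data.Nat.Base as ℕ using (ℕ; zero; suc)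
open import Data.Nat.Divisibility using () renaming (_∣_ to _∣ℕ_)
open import Data.Nat.DivMod using () renaming (_/_ to _/ℕ_)
open import Data.Nat.Primality using (Prime)
open import Data.Product.Base using (∃-syntax; ∃₂; _×_; _,_; proj₁; proj₂)
open import Data.Sum.Base using (_⊎_)
open import Data.Vec.Base using (Vec; []; _∷_; map; zipWith; head; tail)
open import Function.Base using (_∘_)
open import Function.Bundles using (_↔_)
open import Function.Definitions using (Injective)
open import Function.Properties.Inverse using (↔⇒↣)
open import Relation.Binary.PropositionalEquality
open import Relation.Nullary.Decidable using (Dec; yes; no; via-injection)
open import Relation.Nullary.Negation using (¬_)
open import Relation.Unary
  using (Pred; _∈_; _∉_; _⊆_; _≐_; _⊥_; _∪_; _∩_; _∖_; ｛_｝)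

IsPrimePower : ℕ → Set
IsPrimePower q = ∃₂ λ p k → Prime p × 1 ℕ.≤ k × q ≡ p ℕ.^ k

record FiniteField (n : ℕ) : Set₁ where
  infixl 6 _+_
  infixl 7 _*_
  infix  8 -_
  field
    Carrier           : Set
    _+_ _*_           : Carrier → Carrier → Carrier
    -_                : Carrier → Carrier
    0# 1#             : Carrier
    isCommutativeRing : IsCommutativeRing _≡_ _+_ _*_ -_ 0# 1#
    0≢1               : 0# ≢ 1#
    inverse           : ∀ x → x ≢ 0# → ∃[ y ] x * y ≡ 1#
    enumeration       : Carrier ↔ Fin n

  commutativeRing : CommutativeRing 0ℓ 0ℓ
  commutativeRing = record { isCommutativeRing = isCommutativeRing }

  open CommutativeRing commutativeRing public
    using (semiring; _-_; zeroʳ; *-assoc; *-comm; *-identityˡ)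
  open SemiringExp semiring public using (_^_)

  _≟_ : (x y : Carrier) → Dec (x ≡ y)
  _≟_ = via-injection (↔⇒↣ enumeration) Fin._≟_

  *-nonzero : ∀ {x y} → x ≢ 0# → y ≢ 0# → x * y ≢ 0#
  *-nonzero {x} {y} x≢0 y≢0 xy≡0 with inverse x x≢0
  ... | z , xz≡1 = y≢0 (begin
    y            ≡⟨ *-identityˡ y ⟨
    1# * y       ≡⟨ cong (_* y) (trans (sym xz≡1) (*-comm x z)) ⟩
    z * x * y    ≡⟨ *-assoc z x y ⟩
    z * (x * y)  ≡⟨ cong (z *_) xy≡0 ⟩
    z * 0#       ≡⟨ zeroʳ z ⟩
    0#           ∎)
    where open ≡-Reasoning

  ^-nonzero : ∀ {x} n → x ≢ 0# → x ^ n ≢ 0#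
  ^-nonzero zero    x≢0 1≡0 = 0≢1 (sym 1≡0)
  ^-nonzero (suc n) x≢0     = *-nonzero x≢0 (^-nonzero n x≢0)

  ^≡0⇒≡0 : ∀ x n → x ^ n ≡ 0# → x ≡ 0#
  ^≡0⇒≡0 x n xⁿ≡0 with x ≟ 0#
  ... | yes x≡0 = x≡0
  ... | no  x≢0 = ⊥-elim (^-nonzero n x≢0 xⁿ≡0)

  _⁻ˢ : ∀ {ℓ} → Pred Carrier ℓ → Pred Carrier ℓ
  (A ⁻ˢ) y = ∃[ x ] x ∈ A × x * y ≡ 1#

module ProjectiveSpace {n : ℕ} (𝔽 : FiniteField n) where
  open FiniteField 𝔽 renaming (Carrier to F)

  V : Set
  V = Vec F 4

  0ⱽ : V
  0ⱽ = 0# ∷ 0# ∷ 0# ∷ 0# ∷ []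

  infixl 6 _+ⱽ_
  infixr 7 _·_

  _+ⱽ_ : V → V → V
  _+ⱽ_ = zipWith _+_

  _·_ : F → V → V
  c · x = map (c *_) x

  record Point : Set where
    constructor point
    field
      coords  : V
      nonzero : coords ≢ 0ⱽ

  open Point public

  X₂ X₄ : Point → F
  X₂ P = head (tail (coords P))
  X₄ P = head (tail (tail (tail (coords P))))

  infix 4 _≈_
  _≈_ : Point → Point → Set
  P ≈ Q = ∃[ c ] c ≢ 0# × coords P ≡ c · coords Q

  -- Lines and planes are sets of points, compared with _≐_.
  PointSet : Set₁
  PointSet = Pred Point 0ℓ

  ⟨_,_⟩ : Point → Point → PointSet
  ⟨ P , Q ⟩ R = ∃₂ λ a b → coords R ≡ a · coords P +ⱽ b · coords Q

  IsLine : PointSet → Set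
  IsLine ℓ = ∃₂ λ P Q → ¬ P ≈ Q × ℓ ≐ ⟨ P , Q ⟩

  -- For a Baer subgeometry B, its lines (Baer sublines) are the intersections
  -- with B of the lines joining two distinct points of B.
  IsLineOf : PointSet → PointSet → Set
  IsLineOf B L = ∃₂ λ P Q → P ∈ B × Q ∈ B × ¬ P ≈ Q × L ≐ ⟨ P , Q ⟩ ∩ B

  Meet : PointSet → PointSet → Set
  Meet L M = ∃[ P ] P ∈ L × P ∈ M

  IsLineSpread : ∀ {ℓ} → PointSet → Pred PointSet ℓ → Set _
  IsLineSpread B S =
      (∀ L → L ∈ S → IsLineOf B L)
    × (∀ P → P ∈ B →
         ∃[ L ] L ∈ S × P ∈ L × (∀ M → M ∈ S → P ∈ M → M ≐ L))

  IsLineParallelism : ∀ {ℓ ℓ′} → PointSet → Pred (Pred PointSet ℓ) ℓ′ → Set _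
  IsLineParallelism B Π =
      (∀ S → S ∈ Π → IsLineSpread B S)
    × (∀ S T → S ∈ Π → T ∈ Π → ¬ S ≐ T → S ⊥ T)
    × (∀ L → IsLineOf B L →
         ∃[ S ] S ∈ Π × L ∈ S × (∀ T → T ∈ Π → L ∈ T → T ≐ S))

  -- Intended for a regulus R of B: the opposite regulus is its set of transversals.
  Opposite : ∀ {ℓ} → PointSet → Pred PointSet ℓ → Pred PointSet _
  Opposite B R L = IsLineOf B L × (∀ M → M ∈ R → Meet L M)

  Pencil : PointSet → Point → PointSet → Pred PointSet 0ℓ
  Pencil B P π ℓ =
    IsLine ℓ × ℓ ⊆ π × P ∈ ℓ × IsLineOf B (ℓ ∩ (π ∩ B))

  U₁ U₂ U₃ : Point
  U₁ = point (1# ∷ 0# ∷ 0# ∷ 0# ∷ []) (0≢1 ∘ sym ∘ cong head)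
  U₂ = point (0# ∷ 1# ∷ 0# ∷ 0# ∷ []) (0≢1 ∘ sym ∘ cong (head ∘ tail))
  U₃ = point (0# ∷ 0# ∷ 1# ∷ 0# ∷ []) (0≢1 ∘ sym ∘ cong (head ∘ tail ∘ tail))

  t₁ r[U₁] : PointSet
  t₁    = ⟨ U₁ , U₂ ⟩
  r[U₁] = ⟨ U₁ , U₃ ⟩

module BaerGeometry (q : ℕ) (𝔽 : FiniteField (q ℕ.^ 2)) where
  open FiniteField 𝔽 renaming (Carrier to F)
  open ProjectiveSpace 𝔽 public

  norm : F → F
  norm x = x ^ suc q

  -- 𝔽_q is the fixed field of x ↦ x^q.
  𝔽q* : Pred F 0ℓ
  𝔽q* x = x ^ q ≡ x × x ≢ 0#

  𝒰 : Pred F 0ℓ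
  𝒰 u = norm u ≡ 1#

  τⱽ : F → V → V
  τⱽ α (x₁ ∷ x₂ ∷ x₃ ∷ x₄ ∷ []) =
    x₃ ^ q ∷ x₄ ^ q ∷ norm α * x₁ ^ q ∷ norm α * x₂ ^ q ∷ []

  τⱽ-nonzero : ∀ {α} → α ≢ 0# → ∀ x → x ≢ 0ⱽ → τⱽ α x ≢ 0ⱽ
  τⱽ-nonzero {α} α≢0 (x₁ ∷ x₂ ∷ x₃ ∷ x₄ ∷ []) x≢0 eq = x≢0
    (cong₂ _∷_ (scaled x₁ (cong (head ∘ tail ∘ tail) eq))
    (cong₂ _∷_ (scaled x₂ (cong (head ∘ tail ∘ tail ∘ tail) eq))
    (cong₂ _∷_ (^≡0⇒≡0 x₃ q (cong head eq))
    (cong₂ _∷_ (^≡0⇒≡0 x₄ q (cong (head ∘ tail) eq)) refl))))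
    where
    scaled : ∀ x → norm α * x ^ q ≡ 0# → x ≡ 0#
    scaled x e with x ≟ 0#
    ... | yes x≡0 = x≡0
    ... | no  x≢0 =
      ⊥-elim (*-nonzero (^-nonzero (suc q) α≢0) (^-nonzero q x≢0) e)

  τ : (α : F) → α ≢ 0# → Point → Point
  τ α α≢0 P = point (τⱽ α (coords P)) (τⱽ-nonzero α≢0 (coords P) (nonzero P))

  Σ[_] : F → PointSet
  Σ[ α ] P = ∃₂ λ x y → ¬ (x ≡ 0# × y ≡ 0#) ×
    (∃[ c ] c ≢ 0# × coords P ≡ c · (x ∷ y ∷ α * x ^ q ∷ α * y ^ q ∷ []))

  IsPartitionOf𝔽q* : Pred F 0ℓ → Pred F 0ℓ → Set
  IsPartitionOf𝔽q* B A =
    B ∪ A ∪ A ⁻ˢ ≐ 𝔽q* × B ⊥ A × B ⊥ A ⁻ˢ × A ⊥ A ⁻ˢ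

  Range : ∀ {m} → (Fin m → F) → Pred F 0ℓ
  Range f y = ∃[ i ] f i ≡ y

  record Setting : Set where
    field
      Λ-elem         : Fin (q ℕ.∸ 1) → F
      Λ-nonzero      : ∀ i → Λ-elem i ≢ 0#
      norm-injective : Injective _≡_ _≡_ (norm ∘ Λ-elem)

    Λ : Pred F 0ℓ
    Λ = Range Λ-elem

    -- η is determined by these two conditions, as norms are distinct on Λ.
    field
      η   : F
      η∈𝒰 : η ∈ 𝒰
      η∈Λ : η ∈ Λ

      t           : ℕ
      a           : Fin t → F
      a-injective : Injective _≡_ _≡_ a

    A : Pred F 0ℓ
    A = Range a

    field
      A-even : 2 ∣ℕ q → t ≡ (q ℕ.∸ 2) /ℕ 2 × IsPartitionOf𝔽q* ｛ 1# ｝ A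
      A-odd  : ¬ 2 ∣ℕ q → t ≡ (q ℕ.∸ 3) /ℕ 2
                        × IsPartitionOf𝔽q* (｛ 1# ｝ ∪ ｛ - 1# ｝) A
                        × (∀ x → x ∈ A → - x ∉ A)

  module Construction (s : Setting) where
    open Setting s public

    ℐ : Pred F 0ℓ
    ℐ α = α ∈ Λ × (norm α ∈ A ⊎ (¬ 2 ∣ℕ q × norm α ≡ - 1#))

    η≢0 : η ≢ 0#
    η≢0 η≡0 = Λ-nonzero (proj₁ η∈Λ) (trans (proj₂ η∈Λ) η≡0)

    Ση : PointSet
    Ση = Σ[ η ]

    τη : Point → Point
    τη = τ η η≢0

    𝒮 : PointSet → Pred PointSet 0ℓ
    𝒮 ℓ L = ∃[ P ] P ∈ ℓ × L ≐ ⟨ P , τη P ⟩ ∩ Ση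

    𝒟η : Pred PointSet 0ℓ
    𝒟η = 𝒮 t₁

    ℛ : PointSet → Pred PointSet 0ℓ
    ℛ ℓ = 𝒟η ∩ 𝒮 ℓ

    -- P⟨ w ⟩ is the point (1,0,w,0) and π⟨ w ⟩ the plane X₄ = wX₂; they are
    -- used with w = αu and w = αv respectively.
    P⟨_⟩ : F → Point
    P⟨ w ⟩ = point (1# ∷ 0# ∷ w ∷ 0# ∷ []) (0≢1 ∘ sym ∘ cong head)

    π⟨_⟩ : F → PointSet
    π⟨ w ⟩ Q = X₄ Q ≡ w * X₂ Q

    p : F → F → F → Pred PointSet 0ℓ
    p α u v = Pencil Σ[ α ] P⟨ α * u ⟩ π⟨ α * v ⟩

    -- A set 𝒫 of q + 1 pairs (P_{αᵢuᵢ}, π_{αᵢvᵢ}), enumerated by i.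
    module _ (α u v : Fin (suc q) → F) where

      PairwiseDistinct : Set
      PairwiseDistinct = ∀ {i j} → i ≢ j →
        ¬ (P⟨ α i * u i ⟩ ≈ P⟨ α j * u j ⟩ × π⟨ α i * v i ⟩ ≐ π⟨ α j * v j ⟩)

      ℒ : Pred PointSet 0ℓ
      ℒ ℓ = (∃[ i ] ℓ ∈ p (α i) (u i) (v i)) × ¬ ℓ ≐ r[U₁]

      Π : Pred (Pred PointSet (lsuc 0ℓ)) (lsuc 0ℓ)
      Π S = (∃[ ℓ ] ℓ ∈ ℒ × S ≐ (𝒮 ℓ ∖ ℛ ℓ) ∪ Opposite Ση (ℛ ℓ)) ⊎ S ≐ 𝒟η

      IsGood : Set
      IsGood = ∀ i j → (α i , u i , v i) ≢ (α j , u j , v j) →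
          u i * v j - v i * u j ≢ 0#
        × α i * u i * (α j * v j) ^ q - (α i * v i) ^ q * (α j * u j) ≢ 0#

-- Write F for the field of order q² and identify Σ_η with the projective space of F² over 𝔽_q.
-- For a pair (α, u, v) put β = η(αu)^q and γ = η(αv)^q. The lines ℓ of the pencil other than
-- r_{U₁} correspond to the δ with βδ^q + γ^qδ = 0, and 𝒮_ℓ consists of y = 0 and the lines
-- x = ey + gy^q with g + γe = βe^q + βγg^q + δ. Those with g = 0 and y = 0 form ℛ_ℓ, and the
-- lines of the opposite regulus each meet y = 0 in one point. A line x = ey + gy^q with g ≠ 0 then
-- lies in a switched spread of the pair iff −η²g^{q−1} = α^{1−q}uv, and a line meeting y = 0 in one
-- point iff an invariant of norm one of that line equals u/v; in both cases δ is determined by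
-- the line. So Π_𝒫 is a parallelism iff the maps u/v and α^{1−q}uv from the q + 1 pairs to the
-- q + 1 elements of norm one are bijective, and 𝒫 is good iff they are injective. That either of
-- injectivity and surjectivity implies the other follows by counting roots of polynomials.

module Submission where

-- Both invariants exist because β and γ have the same norm N = α^{q+1}, which is neither 0 nor 1.
-- Adding γ^q times the equation g + γe = βe^q + βγg^q + δ to β times its conjugate cancels e by
-- equality of the norms, and δ by the condition of the pencil; what is left is (1 - N)(βg^q + γ^qg)
-- = 0, so g^{q-1} depends on the pair alone. Conversely, for such g and any e the δ prescribed by
-- the equation satisfies the condition of the pencil, so no line is lost. Spreads consist of lines
-- over 𝔽_q, but spans are taken over the field of order q². The two are reconciled by treating x,
-- y, x^q, y^q as four coordinates: every 𝔽_q-linear equation of a line becomes linear over the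
-- large field in them, and spans reduce to 2 × 2 determinants. Most steps are then identities in a
-- field with an involution, certified by naming the multiplier of each hypothesis.

open import Defs
open import Algebra.Bundles using (CommutativeRing)
import Algebra.Properties.CommutativeMonoid.Sum as CommutativeMonoidSum
import Algebra.Properties.CommutativeSemiring.Binomial as BinomialTheorem
import Algebra.Properties.CommutativeSemiring.Exp as CommutativeExp
import Algebra.Properties.Monoid.Mult as MonoidMult
import Algebra.Properties.Semiring.Exp as SemiringExp
import Algebra.Properties.Semiring.Mult as SemiringMult
open import Data.Bool.Base using (Bool; true; false; not; T; if_then_else_)
open import Data.Empty using (⊥; ⊥-elim)
open import Data.Fin.Base using (Fin; zero; suc; toℕ; fromℕ; inject₁; inject≤; punchIn; punchOut; _↑ˡ_; _↑ʳ_)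
open import Data.Fin.Permutation using (Permutation; permutation; _⟨$⟩ʳ_)
import Data.Fin.Properties as Fin
open import Data.Maybe.Base using (nothing)
open import Data.Nat.Base as ℕ using (ℕ; zero; suc; z≤n; s≤s; _!)
open import Data.Nat.Combinatorics using (_C_; nCn≡1)
open import Data.Nat.Combinatorics.Specification using ([n∸k]!k!∣n!; nCk≡n!/k![n-k]!)
open import Data.Nat.Divisibility as ℕ∣ using (divides; divides-refl) renaming (_∣_ to _∣ℕ_; _∣?_ to _∣ℕ?_)
open import Data.Nat.DivMod using (_%_; m/n*n≡m; m%n<n; m≡m%n+[m/n]*n) renaming (_/_ to _/ℕ_)
open import Data.Nat.Primality using (Prime; euclidsLemma)
import Data.Nat.Properties as ℕₚ
open import Data.Product.Base using (∃-syntax; ∃₂; _×_; _,_; proj₁; proj₂)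
open import Data.Sum.Base using (_⊎_; inj₁; inj₂)
open import Data.Vec.Base as Vec using (Vec; []; _∷_; _++_; head; lookup; tail)
open import Data.Vec.Functional using (removeAt; replicate)
open import Data.Vec.N-ary using (N-ary; _$ⁿ_)
import Data.Vec.Properties as Vec
open import Function.Base using (_∘_; id)
open import Function.Bundles using (Inverse; _⇔_; mk⇔)
open import Function.Definitions using (Injective)
open import Level using (0ℓ; Lift; lift; lower) renaming (suc to lsuc)
open import Relation.Binary.PropositionalEquality hiding ([_])
open import Relation.Nullary.Decidable using (Dec; yes; no; decidable-stable)
open import Relation.Nullary.Negation using (¬_; contradiction)
open import Relation.Unary using (Pred; _∈_; _≐_; _∩_; _∪_; _∖_)
open import Relation.Unary.Properties using (≐-refl; ≐-sym; ≐-trans)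
open import Tactic.RingSolver.Core.AlmostCommutativeRing
  using (AlmostCommutativeRing; fromCommutativeRing)
open import Tactic.RingSolver.Core.Polynomial.Parameters using (RawCoeff; Homomorphism)

-- Equations in a field with an involution

-- The pair (a , b) stands for the integer a − b; representatives need not be reduced.
Difference : Set
Difference = ℕ × ℕ

differenceCoeff : RawCoeff 0ℓ 0ℓ
differenceCoeff = record
  { rawRing = record
    { Carrier = Difference
    ; _≈_ = _≡_
    ; _+_ = λ (a , b) (c , d) → a ℕ.+ c , b ℕ.+ d
    ; _*_ = λ (a , b) (c , d) → a ℕ.* c ℕ.+ b ℕ.* d , a ℕ.* d ℕ.+ b ℕ.* c
    ; -_ = λ (a , b) → b , a
    ; 0# = 0 , 0
    ; 1# = 1 , 0
    }
  ; isZero = λ (a , b) → a ℕ.≡ᵇ b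
  }

import Tactic.RingSolver.Core.Polynomial.Base differenceCoeff as Poly

data Expr (n : ℕ) : Set where
  var             : Fin n → Expr n
  ⓪ ①             : Expr n
  _⊕_ _⊗_ _⊖_     : (x y : Expr n) → Expr n
  ⊝_ _‾           : Expr n → Expr n

infixl 6 _⊕_ _⊖_
infixl 7 _⊗_
infix  8 ⊝_
infix  9 _‾

infix 4 _≋_
infix 5 _∙_
infix 3 _⇐_
infixr 4 _&_

record Equation (n : ℕ) : Set where
  constructor _≋_
  field
    left right : Expr n

record Multiple (n : ℕ) : Set where
  constructor _∙_
  field
    factor   : Expr n
    equation : Equation n

data Combination (n : ℕ) : Set where
  none : Combination n
  _&_  : Multiple n → Combination n → Combination n

record Deduction (n : ℕ) : Set where
  constructor _⇐_
  field
    conclusion : Equation n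
    premises   : Combination n

total : ∀ {n} → Combination n → Expr n
total none = ⓪
total (c ∙ (x ≋ y) & ms) = c ⊗ (x ⊖ y) ⊕ total ms

-- Variable i stands for xᵢ and variable n + i for its conjugate.
poly : ∀ {n} → Bool → Expr n → Poly.Poly (n ℕ.+ n)
poly {n} false (var i) = Poly.ι (i ↑ˡ n)
poly {n} true  (var i) = Poly.ι (n ↑ʳ i)
poly b ⓪               = Poly.κ (0 , 0)
poly b ①               = Poly.κ (1 , 0)
poly b (x ⊕ y)         = poly b x Poly.⊞ poly b y
poly b (x ⊖ y)         = poly b x Poly.⊞ Poly.⊟ poly b y
poly b (x ⊗ y)         = poly b x Poly.⊠ poly b y
poly b (⊝ x)           = Poly.⊟ poly b x
poly b (x ‾)           = poly (not b) x

-- Vanishing polynomials normalise to a constant. Answering `false` on everything else is safe,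
-- since only the answer `true` is relied upon.
isZero : ∀ {n} → Poly.Poly n → Bool
isZero (Poly.Κ x Poly.⊐ _) = RawCoeff.isZero differenceCoeff x
isZero (Poly.⅀ _ Poly.⊐ _) = false

-- Only variables and integer coefficients are involved, so the test evaluates without knowledge of
-- the field and its success holds in every characteristic.
valid : ∀ {n} → Deduction n → Bool
valid (l ≋ r ⇐ ms) = isZero (poly false (l ⊖ r ⊖ total ms))

record IsInvolution {m : ℕ} (𝔽 : FiniteField m) (conj : FiniteField.Carrier 𝔽 → FiniteField.Carrier 𝔽) : Set where
  open FiniteField 𝔽
  field
    conj-+    : ∀ x y → conj (x + y) ≡ conj x + conj y
    conj-*    : ∀ x y → conj (x * y) ≡ conj x * conj y
    conj-conj : ∀ x → conj (conj x) ≡ x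

-- Makes the same solver serve for plain field identities, before x ↦ x^q is known to be additive.
identity-isInvolution : ∀ {m} (𝔽 : FiniteField m) → IsInvolution 𝔽 id
identity-isInvolution 𝔽 = record { conj-+ = λ _ _ → refl ; conj-* = λ _ _ → refl ; conj-conj = λ _ → refl }

-- Soundness of the solver.

module Involution {m : ℕ} (𝔽 : FiniteField m)
  {conj : FiniteField.Carrier 𝔽 → FiniteField.Carrier 𝔽}
  (isInvolution : IsInvolution 𝔽 conj)
  where

  open FiniteField 𝔽 renaming (Carrier to F)
  open IsInvolution isInvolution

  open CommutativeRing commutativeRing
    using (ring; +-identityˡ; +-identityʳ; -‿inverseʳ; -‿inverseˡ; +-assoc; +-comm; *-identityʳ; distribˡ; distribʳ;
           +-monoid; +-commutativeSemigroup; +-group)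
  open import Algebra.Properties.CommutativeSemigroup +-commutativeSemigroup using (interchange)
  open import Algebra.Properties.Group +-group using (∙-cancelˡ; inverseˡ-unique)
  open import Algebra.Properties.Ring ring using (-‿distribˡ-*; -‿distribʳ-*; -0#≈0#; -‿involutive; -‿+-comm)
  open import Algebra.Properties.Monoid.Mult +-monoid using (×-homo-+) renaming (_×_ to _×ᴺ_)
  open import Algebra.Properties.Semiring.Mult semiring using (×1-homo-*)

  conj-0 : conj 0# ≡ 0#
  conj-0 = ∙-cancelˡ (conj 0#) (conj 0#) 0# (begin
    conj 0# + conj 0#  ≡⟨ conj-+ 0# 0# ⟨
    conj (0# + 0#)     ≡⟨ cong conj (+-identityˡ 0#) ⟩
    conj 0#            ≡⟨ +-identityʳ _ ⟨
    conj 0# + 0#       ∎)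
    where open ≡-Reasoning

  conj-1 : conj 1# ≡ 1#
  conj-1 = begin
    conj 1#                  ≡⟨ *-identityʳ _ ⟨
    conj 1# * 1#             ≡⟨ cong (conj 1# *_) (conj-conj 1#) ⟨
    conj 1# * conj (conj 1#) ≡⟨ conj-* 1# (conj 1#) ⟨
    conj (1# * conj 1#)      ≡⟨ cong conj (*-identityˡ _) ⟩
    conj (conj 1#)           ≡⟨ conj-conj 1# ⟩
    1#                       ∎
    where open ≡-Reasoning

  conj-‿- : ∀ x → conj (- x) ≡ - conj x
  conj-‿- x = inverseˡ-unique (conj (- x)) (conj x) (begin
    conj (- x) + conj x  ≡⟨ conj-+ (- x) x ⟨
    conj (- x + x)       ≡⟨ cong conj (-‿inverseˡ x) ⟩
    conj 0#              ≡⟨ conj-0 ⟩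
    0#                   ∎)
    where open ≡-Reasoning

  almostRing : AlmostCommutativeRing 0ℓ 0ℓ
  almostRing = fromCommutativeRing commutativeRing (λ _ → nothing)

  private
    module D = RawCoeff differenceCoeff

    ⌊_⌋ : ℕ → F
    ⌊ a ⌋ = a ×ᴺ 1#

    value : Difference → F
    value (a , b) = ⌊ a ⌋ - ⌊ b ⌋

  value-+ : ∀ x y → value (x D.+ y) ≡ value x + value y
  value-+ (a , b) (c , d) = begin
    ⌊ a ℕ.+ c ⌋ - ⌊ b ℕ.+ d ⌋            ≡⟨ cong₂ (λ x y → x + - y) (×-homo-+ 1# a c) (×-homo-+ 1# b d) ⟩
    (⌊ a ⌋ + ⌊ c ⌋) - (⌊ b ⌋ + ⌊ d ⌋)    ≡⟨ cong (⌊ a ⌋ + ⌊ c ⌋ +_) (-‿+-comm ⌊ b ⌋ ⌊ d ⌋) ⟨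
    (⌊ a ⌋ + ⌊ c ⌋) + (- ⌊ b ⌋ - ⌊ d ⌋)  ≡⟨ interchange _ _ _ _ ⟩
    (⌊ a ⌋ - ⌊ b ⌋) + (⌊ c ⌋ - ⌊ d ⌋)    ∎
    where open ≡-Reasoning

  value-1 : value (1 , 0) ≡ 1#
  value-1 = trans (cong₂ _+_ (+-identityʳ 1#) -0#≈0#) (+-identityʳ 1#)

  value-neg : ∀ x → value (D.- x) ≡ - value x
  value-neg (a , b) = begin
    ⌊ b ⌋ - ⌊ a ⌋          ≡⟨ +-comm _ _ ⟩
    - ⌊ a ⌋ + ⌊ b ⌋        ≡⟨ cong (- ⌊ a ⌋ +_) (-‿involutive ⌊ b ⌋) ⟨
    - ⌊ a ⌋ + - (- ⌊ b ⌋)  ≡⟨ -‿+-comm _ _ ⟩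
    - (⌊ a ⌋ - ⌊ b ⌋)      ∎
    where open ≡-Reasoning

  value-* : ∀ x y → value (x D.* y) ≡ value x * value y
  value-* (a , b) (c , d) = begin
    value (a ℕ.* c ℕ.+ b ℕ.* d , a ℕ.* d ℕ.+ b ℕ.* c)
      ≡⟨ cong₂ (λ x y → x + - y) (products a c b d) (products a d b c) ⟩
    (A * C + B * D) - (A * D + B * C)
      ≡⟨ cong (A * C + B * D +_) (-‿+-comm _ _) ⟨
    (A * C + B * D) + (- (A * D) - B * C)
      ≡⟨ cong (A * C + B * D +_) (+-comm _ _) ⟩
    (A * C + B * D) + (- (B * C) - A * D)
      ≡⟨ interchange _ _ _ _ ⟩
    (A * C - B * C) + (B * D - A * D)
      ≡⟨ cong₂ _+_ (minus-* A B C) (trans (+-comm _ _) (minus-neg-* A B D)) ⟩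
    (A - B) * C + (A - B) * - D
      ≡⟨ distribˡ _ _ _ ⟨
    (A - B) * (C - D) ∎
    where
    open ≡-Reasoning
    A = ⌊ a ⌋ ; B = ⌊ b ⌋ ; C = ⌊ c ⌋ ; D = ⌊ d ⌋
    products : ∀ a c b d → ⌊ a ℕ.* c ℕ.+ b ℕ.* d ⌋ ≡ ⌊ a ⌋ * ⌊ c ⌋ + ⌊ b ⌋ * ⌊ d ⌋
    products a c b d = trans (×-homo-+ 1# (a ℕ.* c) (b ℕ.* d)) (cong₂ _+_ (×1-homo-* a c) (×1-homo-* b d))
    minus-* : ∀ x y z → x * z - y * z ≡ (x - y) * z
    minus-* x y z = trans (cong (x * z +_) (-‿distribˡ-* y z)) (sym (distribʳ z x (- y)))
    minus-neg-* : ∀ x y z → - (x * z) + y * z ≡ (x - y) * - z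
    minus-neg-* x y z = begin
      - (x * z) + y * z          ≡⟨ cong (- (x * z) +_) (-‿involutive (y * z)) ⟨
      - (x * z) + - (- (y * z))  ≡⟨ -‿+-comm _ _ ⟩
      - (x * z - y * z)          ≡⟨ cong -_ (minus-* x y z) ⟩
      - ((x - y) * z)            ≡⟨ -‿distribʳ-* _ _ ⟩
      (x - y) * - z              ∎

  homo : Homomorphism 0ℓ 0ℓ 0ℓ 0ℓ
  homo = record
    { from = differenceCoeff
    ; to = almostRing
    ; morphism = record
      { ⟦_⟧ = value
      ; +-homo = value-+
      ; *-homo = value-*
      ; -‿homo = value-neg
      ; 0-homo = -‿inverseʳ 0#
      ; 1-homo = value-1
      }
    ; Zero-C⟶Zero-R = value-zero
    }
    where
    value-zero : ∀ x → T (D.isZero x) → 0# ≡ value x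
    value-zero (a , b) a≡ᵇb rewrite ℕₚ.≡ᵇ⇒≡ a b a≡ᵇb = sym (-‿inverseʳ ⌊ b ⌋)

  open import Tactic.RingSolver.Core.Polynomial.Semantics homo using () renaming (⟦_⟧ to ⟦_⟧ₚ)
  open import Tactic.RingSolver.Core.Polynomial.Homomorphism homo

  ⟦_⟧ : ∀ {n} → Expr n → Vec F n → F
  ⟦ var i ⟧ ρ = lookup ρ i
  ⟦ ⓪ ⟧     ρ = 0#
  ⟦ ① ⟧     ρ = 1#
  ⟦ x ⊕ y ⟧ ρ = ⟦ x ⟧ ρ + ⟦ y ⟧ ρ
  ⟦ x ⊗ y ⟧ ρ = ⟦ x ⟧ ρ * ⟦ y ⟧ ρ
  ⟦ x ⊖ y ⟧ ρ = ⟦ x ⟧ ρ - ⟦ y ⟧ ρ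
  ⟦ ⊝ x ⟧   ρ = - ⟦ x ⟧ ρ
  ⟦ x ‾ ⟧   ρ = conj (⟦ x ⟧ ρ)

  conjIf : Bool → F → F
  conjIf b x = if b then conj x else x

  poly-correct : ∀ {n} b (e : Expr n) ρ → ⟦ poly b e ⟧ₚ (ρ ++ Vec.map conj ρ) ≡ conjIf b (⟦ e ⟧ ρ)
  poly-correct {n} false (var i) ρ = trans (ι-hom (i ↑ˡ n) _) (Vec.lookup-++ˡ ρ (Vec.map conj ρ) i)
  poly-correct {n} true  (var i) ρ =
    trans (ι-hom (n ↑ʳ i) _) (trans (Vec.lookup-++ʳ ρ (Vec.map conj ρ) i) (Vec.lookup-map i conj ρ))
  poly-correct false ⓪ ρ = trans (κ-hom (0 , 0) (ρ ++ Vec.map conj ρ)) (-‿inverseʳ 0#)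
  poly-correct true  ⓪ ρ = trans (poly-correct false ⓪ ρ) (sym conj-0)
  poly-correct false ① ρ = trans (κ-hom (1 , 0) (ρ ++ Vec.map conj ρ)) value-1
  poly-correct true  ① ρ = trans (poly-correct false ① ρ) (sym conj-1)
  poly-correct false (x ⊕ y) ρ =
    trans (⊞-hom (poly false x) _ _) (cong₂ _+_ (poly-correct false x ρ) (poly-correct false y ρ))
  poly-correct true  (x ⊕ y) ρ =
    trans (⊞-hom (poly true x) _ _)
      (trans (cong₂ _+_ (poly-correct true x ρ) (poly-correct true y ρ)) (sym (conj-+ _ _)))
  poly-correct false (x ⊗ y) ρ =
    trans (⊠-hom (poly false x) _ _) (cong₂ _*_ (poly-correct false x ρ) (poly-correct false y ρ))
  poly-correct true  (x ⊗ y) ρ =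
    trans (⊠-hom (poly true x) _ _)
      (trans (cong₂ _*_ (poly-correct true x ρ) (poly-correct true y ρ)) (sym (conj-* _ _)))
  poly-correct false (x ⊖ y) ρ = trans (⊞-hom (poly false x) _ _)
    (cong₂ _+_ (poly-correct false x ρ) (trans (⊟-hom (poly false y) _) (cong -_ (poly-correct false y ρ))))
  poly-correct true  (x ⊖ y) ρ = trans (⊞-hom (poly true x) _ _) (trans
    (cong₂ _+_ (poly-correct true x ρ)
      (trans (⊟-hom (poly true y) _) (trans (cong -_ (poly-correct true y ρ)) (sym (conj-‿- _)))))
    (sym (conj-+ _ _)))
  poly-correct false (⊝ x) ρ = trans (⊟-hom (poly false x) _) (cong -_ (poly-correct false x ρ))
  poly-correct true  (⊝ x) ρ = trans (⊟-hom (poly true x) _) (trans (cong -_ (poly-correct true x ρ)) (sym (conj-‿- _)))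
  poly-correct false (x ‾) ρ = poly-correct true x ρ
  poly-correct true  (x ‾) ρ = trans (poly-correct false x ρ) (sym (conj-conj _))

  isZero-correct : ∀ {n} (p : Poly.Poly n) ρ → T (isZero p) → ⟦ p ⟧ₚ ρ ≡ 0#
  isZero-correct (Poly.Κ x Poly.⊐ _) ρ z = sym (Homomorphism.Zero-C⟶Zero-R homo x z)

  Implies : ∀ {n} → Vec F n → Combination n → Set → Set
  Implies ρ none P = P
  Implies ρ (c ∙ (x ≋ y) & ms) P = ⟦ x ⟧ ρ ≡ ⟦ y ⟧ ρ → Implies ρ ms P

  implies : ∀ {n} (ρ : Vec F n) ms {P : Set} → (⟦ total ms ⟧ ρ ≡ 0# → P) → Implies ρ ms P
  implies ρ none k = k refl
  implies ρ (c ∙ (x ≋ y) & ms) k x≡y = implies ρ ms (λ s≡0 → k (begin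
    ⟦ c ⟧ ρ * (⟦ x ⟧ ρ - ⟦ y ⟧ ρ) + ⟦ total ms ⟧ ρ  ≡⟨ cong₂ (λ a b → ⟦ c ⟧ ρ * (a - ⟦ y ⟧ ρ) + b) x≡y s≡0 ⟩
    ⟦ c ⟧ ρ * (⟦ y ⟧ ρ - ⟦ y ⟧ ρ) + 0#            ≡⟨ +-identityʳ _ ⟩
    ⟦ c ⟧ ρ * (⟦ y ⟧ ρ - ⟦ y ⟧ ρ)                 ≡⟨ cong (⟦ c ⟧ ρ *_) (-‿inverseʳ _) ⟩
    ⟦ c ⟧ ρ * 0#                                  ≡⟨ zeroʳ _ ⟩
    0#                                            ∎))
    where open ≡-Reasoning

  Holds : ∀ {n} → Vec F n → Deduction n → Set
  Holds ρ (l ≋ r ⇐ ms) = Implies ρ ms (⟦ l ⟧ ρ ≡ ⟦ r ⟧ ρ)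

  deduction : ∀ {n} (ρ : Vec F n) d → {T (valid d)} → Holds ρ d
  deduction ρ (l ≋ r ⇐ ms) {ok} = implies ρ ms λ s≡0 → minus≡0 (begin
    ⟦ l ⟧ ρ - ⟦ r ⟧ ρ                ≡⟨ +-identityʳ _ ⟨
    ⟦ l ⟧ ρ - ⟦ r ⟧ ρ + 0#           ≡⟨ cong (⟦ l ⟧ ρ - ⟦ r ⟧ ρ +_) (trans (sym -0#≈0#) (cong -_ (sym s≡0))) ⟩
    ⟦ d ⟧ ρ                          ≡⟨ poly-correct false d ρ ⟨
    ⟦ poly false d ⟧ₚ (ρ ++ Vec.map conj ρ)  ≡⟨ isZero-correct (poly false d) (ρ ++ Vec.map conj ρ) ok ⟩
    0#                               ∎)
    where
    open ≡-Reasoning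
    d = l ⊖ r ⊖ total ms
    minus≡0 : ∀ {x y} → x - y ≡ 0# → x ≡ y
    minus≡0 {x} {y} e = begin
      x            ≡⟨ +-identityʳ x ⟨
      x + 0#       ≡⟨ cong (x +_) (-‿inverseˡ y) ⟨
      x + (- y + y)  ≡⟨ +-assoc x _ y ⟨
      x - y + y    ≡⟨ cong (_+ y) e ⟩
      0# + y       ≡⟨ +-identityˡ y ⟩
      y            ∎

  variables : ∀ {n} → Vec (Expr n) n
  variables = Vec.tabulate var

  -- An equation l ≋ r holds if l − r is, as a polynomial in the variables and their
  -- conjugates, the sum of c (x − y) over the premises c ∙ (x ≋ y).
  deduce : ∀ {n} (ρ : Vec F n) (d : N-ary n (Expr n) (Deduction n)) →
           {_ : T (valid (d $ⁿ variables))} → Holds ρ (d $ⁿ variables)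
  deduce ρ d {ok} = deduction ρ (d $ⁿ variables) {ok}

-- Finite fields

prime∣!⇒≤ : ∀ {p} → Prime p → ∀ n → p ∣ℕ n ! → p ℕ.≤ n
prime∣!⇒≤ pr zero    p∣1 = contradiction (subst Prime (ℕ∣.∣1⇒≡1 p∣1) pr) λ ()
prime∣!⇒≤ pr (suc n) p∣n! with euclidsLemma (suc n) (n !) pr p∣n!
... | inj₁ p∣1+n = ℕ∣.∣⇒≤ p∣1+n
... | inj₂ p∣n!  = ℕₚ.m≤n⇒m≤1+n (prime∣!⇒≤ pr n p∣n!)

-- `p` divides p! = (p C k) k! (p - k)!, but neither of the two factorials, as both are of numbers
-- below `p`.
prime∣binomial : ∀ {p} → Prime p → ∀ k → k ℕ.< p → 0 ℕ.< k → p ∣ℕ p C k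
prime∣binomial {suc p-1} pr k k<p 0<k with euclidsLemma (p C k) (k ! ℕ.* (p ℕ.∸ k) !) pr p∣C*!
  where
  p = suc p-1
  instance _ = k ℕₚ.!* (p ℕ.∸ k) !≢0
  p∣C*! : p ∣ℕ (p C k) ℕ.* (k ! ℕ.* (p ℕ.∸ k) !)
  p∣C*! = subst (p ∣ℕ_)
    (sym (trans (cong (ℕ._* (k ! ℕ.* (p ℕ.∸ k) !)) (nCk≡n!/k![n-k]! (ℕₚ.<⇒≤ k<p)))
                (m/n*n≡m (subst (_∣ℕ p !) (ℕₚ.*-comm ((p ℕ.∸ k) !) (k !)) ([n∸k]!k!∣n! (ℕₚ.<⇒≤ k<p))))))
    (ℕ∣.m∣m*n (p-1 !))
... | inj₁ p∣C = p∣C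
... | inj₂ p∣! with euclidsLemma (k !) _ pr p∣!
...   | inj₁ p∣k! = contradiction (prime∣!⇒≤ pr k p∣k!) (ℕₚ.<⇒≱ k<p)
...   | inj₂ p∣[p-k]! = contradiction (prime∣!⇒≤ pr _ p∣[p-k]!) (ℕₚ.<⇒≱ (ℕₚ.∸-monoʳ-< 0<k (ℕₚ.<⇒≤ k<p)))

-- The order of a finite field, the Frobenius map and roots of polynomials.

module FieldTheory {m : ℕ} (𝔽 : FiniteField m) where

  open FiniteField 𝔽 renaming (Carrier to F)
  open CommutativeRing commutativeRing
    using (*-identityʳ; +-identityʳ; +-identityˡ; -‿inverseʳ; zeroˡ; +-comm; +-assoc; +-monoid; +-group;
           +-commutativeMonoid; *-commutativeMonoid; commutativeSemiring)
  open import Algebra.Properties.Group +-group using (identityˡ-unique)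
  open SemiringExp semiring using (^-assocʳ)
  open MonoidMult +-monoid using (×-assocˡ) renaming (_×_ to _×ᴺ_)
  open SemiringMult semiring using (×1-homo-*; ×-assoc-*)

  open Involution 𝔽 (identity-isInvolution 𝔽) using (deduce)
  open Inverse enumeration using (to; from; strictlyInverseˡ; strictlyInverseʳ)

  from-injective : Injective _≡_ _≡_ from
  from-injective {i} {j} e = trans (sym (strictlyInverseˡ i)) (trans (cong to e) (strictlyInverseˡ j))

  *-cancelˡ-≡ : ∀ {c x y} → c ≢ 0# → c * x ≡ c * y → x ≡ y
  *-cancelˡ-≡ {c} {x} {y} c≢0 e with inverse c c≢0
  ... | d , cd≡1 = deduce (c ∷ d ∷ x ∷ y ∷ []) (λ c d x y →
    x ≋ y ⇐ d ∙ (c ⊗ x ≋ c ⊗ y) & y ⊖ x ∙ (c ⊗ d ≋ ①) & none) e cd≡1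

  minus≡0⇒≡ : ∀ {x y} → x - y ≡ 0# → x ≡ y
  minus≡0⇒≡ {x} {y} = deduce (x ∷ y ∷ []) (λ x y → x ≋ y ⇐ ① ∙ (x ⊖ y ≋ ⓪) & none)

  reindex : (f g : F → F) → (∀ x → f (g x) ≡ x) → (∀ x → g (f x) ≡ x) → Permutation m m
  reindex f g fg gf = permutation (to ∘ f ∘ from) (to ∘ g ∘ from) (conjugate f g fg) (conjugate g f gf)
    where
    conjugate : ∀ f g → (∀ x → f (g x) ≡ x) → ∀ i → to (f (from (to (g (from i))))) ≡ i
    conjugate f g fg i = trans (cong (to ∘ f) (strictlyInverseʳ _)) (trans (cong to (fg _)) (strictlyInverseˡ i))

  -- Translation by 1 permutes the field, so the sum s of all elements satisfies s = m·1 + s.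
  card×1≡0 : m ×ᴺ 1# ≡ 0#
  card×1≡0 = identityˡ-unique (m ×ᴺ 1#) (sum from) (begin
    m ×ᴺ 1# + sum from                      ≡⟨ cong (_+ sum from) (sum-replicate m) ⟨
    sum (replicate m 1#) + sum from         ≡⟨ ∑-distrib-+ (replicate m 1#) from ⟨
    sum (λ i → 1# + from i)                 ≡⟨ sum-cong-≗ (λ i → sym (strictlyInverseʳ (1# + from i))) ⟩
    sum (λ i → from (to (1# + from i)))     ≡⟨ sum-permute from translation ⟨
    sum from                                ∎)
    where
    open ≡-Reasoning
    open CommutativeMonoidSum +-commutativeMonoid
    cancel : ∀ a b → a + b ≡ 0# → ∀ x → a + (b + x) ≡ x
    cancel a b e x = trans (sym (+-assoc a b x)) (trans (cong (_+ x) e) (+-identityˡ x))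
    translation : Permutation m m
    translation = reindex (1# +_) (- 1# +_) (cancel 1# (- 1#) (-‿inverseʳ 1#))
                    (cancel (- 1#) 1# (trans (+-comm _ _) (-‿inverseʳ 1#)))

  -- Multiplication by x permutes the nonzero elements, so x^(m-1) fixes their product.
  x^card≡x : ∀ x → x ^ m ≡ x
  x^card≡x x with x ≟ 0#
  ... | yes refl = 0^n m (to 0#)
    where
    0^n : ∀ n → Fin n → 0# ^ n ≡ 0#
    0^n (suc n) _ = zeroˡ _
  ... | no x≢0 = begin
    x ^ m                         ≡⟨ x*product (scale ∘ from) (to 0#) scale₀ others ⟨
    x * product (scale ∘ from)    ≡⟨ cong (x *_) scales≡1 ⟩
    x * 1#                        ≡⟨ *-identityʳ x ⟩
    x                             ∎
    where
    open CommutativeMonoidSum *-commutativeMonoid renaming (sum to product)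
    open ≡-Reasoning

    -- Both take the value 1 at 0, so that a product over the nonzero elements can run over all of
    -- `Fin m`.
    unit scale : F → F
    unit y with y ≟ 0#
    ... | yes _ = 1#
    ... | no  _ = y
    scale y with y ≟ 0#
    ... | yes _ = 1#
    ... | no  _ = x

    unit≢0 : ∀ y → unit y ≢ 0#
    unit≢0 y with y ≟ 0#
    ... | yes _  = 0≢1 ∘ sym
    ... | no y≢0 = y≢0

    product≢0 : ∀ {n} (f : Fin n → F) → (∀ i → f i ≢ 0#) → product f ≢ 0#
    product≢0 {zero}  f f≢0 = 0≢1 ∘ sym
    product≢0 {suc n} f f≢0 = *-nonzero (f≢0 zero) (product≢0 (f ∘ suc) (f≢0 ∘ suc))

    unit-* : ∀ y → unit (x * y) ≡ scale y * unit y
    unit-* y with y ≟ 0# | (x * y) ≟ 0#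
    ... | yes _    | yes _    = sym (*-identityˡ 1#)
    ... | yes refl | no xy≢0  = contradiction (zeroʳ x) xy≢0
    ... | no y≢0   | yes xy≡0 = contradiction xy≡0 (*-nonzero x≢0 y≢0)
    ... | no _     | no _     = refl

    scale-0 : scale 0# ≡ 1#
    scale-0 with 0# ≟ 0#
    ... | yes _  = refl
    ... | no 0≢0 = contradiction refl 0≢0

    scale-≢0 : ∀ {y} → y ≢ 0# → scale y ≡ x
    scale-≢0 {y} y≢0 with y ≟ 0#
    ... | yes y≡0 = contradiction y≡0 y≢0
    ... | no _    = refl

    x⁻¹ = proj₁ (inverse x x≢0)

    multiplication : Permutation m m
    multiplication = reindex (x *_) (x⁻¹ *_)
      (λ y → trans (sym (*-assoc _ _ y)) (trans (cong (_* y) (proj₂ (inverse x x≢0))) (*-identityˡ y)))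
      (λ y → trans (sym (*-assoc _ _ y)) (trans (cong (_* y) (trans (*-comm _ _) (proj₂ (inverse x x≢0)))) (*-identityˡ y)))

    scales≡1 : product (scale ∘ from) ≡ 1#
    scales≡1 = *-cancelˡ-≡ (product≢0 (unit ∘ from) (unit≢0 ∘ from)) (begin
      product (unit ∘ from) * product (scale ∘ from)            ≡⟨ *-comm _ _ ⟩
      product (scale ∘ from) * product (unit ∘ from)            ≡⟨ ∑-distrib-+ (scale ∘ from) (unit ∘ from) ⟨
      product (λ i → scale (from i) * unit (from i))            ≡⟨ sum-cong-≗ (λ i → unit-* (from i)) ⟨
      product (λ i → unit (x * from i))                         ≡⟨ sum-cong-≗ (λ i → cong unit (strictlyInverseʳ (x * from i))) ⟨
      product (λ i → unit (from (multiplication ⟨$⟩ʳ i)))        ≡⟨ sum-permute (unit ∘ from) multiplication ⟨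
      product (unit ∘ from)                                     ≡⟨ *-identityʳ _ ⟨
      product (unit ∘ from) * 1#                                ∎)

    -- The one factor equal to 1, which comes from the element 0, is made up for by the extra `x`;
    -- hence the exponent `m` and not m - 1.
    x*product : ∀ {n} (f : Fin n → F) i → f i ≡ 1# → (∀ j → j ≢ i → f j ≡ x) → x * product f ≡ x ^ n
    x*product {suc n} f i fi≡1 fj≡x = begin
      x * product f                        ≡⟨ cong (x *_) (sum-remove {i = i} f) ⟩
      x * (f i * product (removeAt f i))   ≡⟨ cong (λ y → x * (y * product (removeAt f i))) fi≡1 ⟩
      x * (1# * product (removeAt f i))    ≡⟨ cong (x *_) (*-identityˡ _) ⟩
      x * product (removeAt f i)           ≡⟨ cong (x *_) (sum-cong-≗ λ j → fj≡x _ (Fin.punchInᵢ≢i i j)) ⟩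
      x * product (replicate n x)          ≡⟨ cong (x *_) (sum-replicate n) ⟩
      x * x ^ n                            ∎

    scale₀ : scale (from (to 0#)) ≡ 1#
    scale₀ = trans (cong scale (strictlyInverseʳ 0#)) scale-0

    others : ∀ i → i ≢ to 0# → scale (from i) ≡ x
    others i i≢ = scale-≢0 λ e → i≢ (trans (sym (strictlyInverseˡ i)) (cong to e))

  ×1≡0⇒×≡0 : ∀ n → n ×ᴺ 1# ≡ 0# → ∀ x → n ×ᴺ x ≡ 0#
  ×1≡0⇒×≡0 n e x = begin
    n ×ᴺ x         ≡⟨ cong (n ×ᴺ_) (*-identityˡ x) ⟨
    n ×ᴺ (1# * x)  ≡⟨ ×-assoc-* n 1# x ⟨
    n ×ᴺ 1# * x    ≡⟨ cong (_* x) e ⟩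
    0# * x         ≡⟨ zeroˡ x ⟩
    0#             ∎
    where open ≡-Reasoning

  ^-×1 : ∀ p k → (p ℕ.^ k) ×ᴺ 1# ≡ (p ×ᴺ 1#) ^ k
  ^-×1 p zero    = +-identityʳ 1#
  ^-×1 p (suc k) = trans (×1-homo-* p (p ℕ.^ k)) (cong (p ×ᴺ 1# *_) (^-×1 p k))

  ∣⇒×≡0 : ∀ {p n} → p ×ᴺ 1# ≡ 0# → p ∣ℕ n → ∀ x → n ×ᴺ x ≡ 0#
  ∣⇒×≡0 {p} p×1≡0 (divides-refl c) x = begin
    (c ℕ.* p) ×ᴺ x  ≡⟨ cong (_×ᴺ x) (ℕₚ.*-comm c p) ⟩
    (p ℕ.* c) ×ᴺ x  ≡⟨ ×-assocˡ x p c ⟨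
    p ×ᴺ (c ×ᴺ x)   ≡⟨ ×1≡0⇒×≡0 p p×1≡0 _ ⟩
    0#              ∎
    where open ≡-Reasoning

  frobenius-+ : ∀ {p} → Prime p → p ×ᴺ 1# ≡ 0# → ∀ x y → (x + y) ^ p ≡ x ^ p + y ^ p
  frobenius-+ {suc n} pr p×1≡0 x y = begin
    (x + y) ^ p                                      ≡⟨ theorem p x y ⟩
    term zero + sum (term ∘ suc)                     ≡⟨ cong (term zero +_) (sum-init-last (term ∘ suc)) ⟩
    term zero + (sum (term ∘ suc ∘ inject₁) + term (suc (fromℕ n)))
      ≡⟨ cong₂ (λ a b → a + (b + term (suc (fromℕ n)))) first middle ⟩
    y ^ p + (0# + term (suc (fromℕ n)))              ≡⟨ cong (y ^ p +_) (trans (+-identityˡ _) last-term) ⟩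
    y ^ p + x ^ p                                    ≡⟨ +-comm _ _ ⟩
    x ^ p + y ^ p                                    ∎
    where
    open ≡-Reasoning
    open CommutativeMonoidSum +-commutativeMonoid
    open BinomialTheorem commutativeSemiring using (theorem; binomialTerm)
    p = suc n
    term = binomialTerm x y p
    first : term zero ≡ y ^ p
    first = trans (+-identityʳ _) (*-identityˡ _)
    middle : sum (term ∘ suc ∘ inject₁) ≡ 0#
    middle = trans (sum-cong-≗ {n} {term ∘ suc ∘ inject₁} {replicate n 0#}
      λ i → ∣⇒×≡0 p×1≡0 (prime∣binomial pr (suc (toℕ (inject₁ i))) (s≤s (Fin.inject₁ℕ< i)) (s≤s z≤n)) _)
      (sum-replicate-zero n)
    last-term : term (suc (fromℕ n)) ≡ x ^ p
    last-term rewrite Fin.toℕ-fromℕ n | nCn≡1 (suc n) | ℕₚ.n∸n≡0 n =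
      trans (+-identityʳ _) (*-identityʳ _)

  frobenius^-+ : ∀ {p} → Prime p → p ×ᴺ 1# ≡ 0# → ∀ k x y → (x + y) ^ (p ℕ.^ k) ≡ x ^ (p ℕ.^ k) + y ^ (p ℕ.^ k)
  frobenius^-+ pr p×1≡0 zero    x y = trans (*-identityʳ _) (sym (cong₂ _+_ (*-identityʳ x) (*-identityʳ y)))
  frobenius^-+ {p} pr p×1≡0 (suc k) x y = begin
    (x + y) ^ (p ℕ.* pᵏ)          ≡⟨ ^-assocʳ (x + y) p pᵏ ⟨
    ((x + y) ^ p) ^ pᵏ            ≡⟨ cong (_^ pᵏ) (frobenius-+ pr p×1≡0 x y) ⟩
    (x ^ p + y ^ p) ^ pᵏ          ≡⟨ frobenius^-+ pr p×1≡0 k _ _ ⟩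
    (x ^ p) ^ pᵏ + (y ^ p) ^ pᵏ   ≡⟨ cong₂ _+_ (^-assocʳ x p pᵏ) (^-assocʳ y p pᵏ) ⟩
    x ^ (p ℕ.* pᵏ) + y ^ (p ℕ.* pᵏ)  ∎
    where
    open ≡-Reasoning
    pᵏ = p ℕ.^ k

  -- Polynomial functions in Horner form: monic of degree n, and of degree less than n.
  data Monic : ℕ → (F → F) → Set where
    one  : ∀ {f} → (∀ x → f x ≡ 1#) → Monic 0 f
    step : ∀ {n f g} c → Monic n g → (∀ x → f x ≡ x * g x + c) → Monic (suc n) f

  data Below : ℕ → (F → F) → Set where
    none : ∀ {f} → (∀ x → f x ≡ 0#) → Below 0 f
    step : ∀ {n f g} c → Below n g → (∀ x → f x ≡ x * g x + c) → Below (suc n) f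

  monic-cong : ∀ {n f g} → (∀ x → g x ≡ f x) → Monic n f → Monic n g
  monic-cong g≗f (one f≗1)      = one (λ x → trans (g≗f x) (f≗1 x))
  monic-cong g≗f (step c mh f≗) = step c mh (λ x → trans (g≗f x) (f≗ x))

  monic-+-below : ∀ {n f g} → Monic n f → Below n g → Monic n (λ x → f x + g x)
  monic-+-below (one f≗1) (none g≗0) = one (λ x → trans (cong₂ _+_ (f≗1 x) (g≗0 x)) (+-identityʳ 1#))
  monic-+-below (step {f = f} {f′} c mf f≗) (step {f = g} {g′} d bg g≗) =
    step (c + d) (monic-+-below mf bg) λ x → deduce
      (x ∷ c ∷ d ∷ f x ∷ g x ∷ f′ x ∷ g′ x ∷ []) (λ x c d f g f′ g′ →
      f ⊕ g ≋ x ⊗ (f′ ⊕ g′) ⊕ (c ⊕ d) ⇐ ① ∙ (f ≋ x ⊗ f′ ⊕ c) & ① ∙ (g ≋ x ⊗ g′ ⊕ d) & none) (f≗ x) (g≗ x)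

  below-suc : ∀ {n f} → Below n f → Below (suc n) f
  below-suc (none {f} f≗0) = step 0# (none {f = λ _ → 0#} (λ _ → refl)) λ x →
    deduce (x ∷ f x ∷ []) (λ x f → f ≋ x ⊗ ⓪ ⊕ ⓪ ⇐ ① ∙ (f ≋ ⓪) & none) (f≗0 x)
  below-suc (step c b f≗) = step c (below-suc b) f≗

  below-+ : ∀ m {n f} → Below n f → Below (m ℕ.+ n) f
  below-+ zero    b = b
  below-+ (suc m) b = below-suc (below-+ m b)

  scaled-monic : ∀ {n f} c → Monic n f → Below (suc n) (λ x → c * f x)
  scaled-monic {f = f} c (one f≗1) = step c (none {f = λ _ → 0#} (λ _ → refl)) λ x →
    deduce (x ∷ c ∷ f x ∷ []) (λ x c f → c ⊗ f ≋ x ⊗ ⓪ ⊕ c ⇐ c ∙ (f ≋ ①) & none) (f≗1 x)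
  scaled-monic {f = f} c (step {g = g} d mg f≗) = step (c * d) (scaled-monic c mg) λ x →
    deduce (x ∷ c ∷ d ∷ f x ∷ g x ∷ []) (λ x c d f g → c ⊗ f ≋ x ⊗ (c ⊗ g) ⊕ c ⊗ d ⇐ c ∙ (f ≋ x ⊗ g ⊕ d) & none) (f≗ x)

  monic-* : ∀ {m n f g} → Monic m f → Monic n g → Monic (m ℕ.+ n) (λ x → f x * g x)
  monic-* {f = f} {g} (one f≗1) mg = monic-cong (λ x → trans (cong (_* g x) (f≗1 x)) (*-identityˡ (g x))) mg
  monic-* {suc m} {n} {f} {g} (step {g = h} c mh f≗) mg =
    monic-cong (λ x → deduce (x ∷ c ∷ f x ∷ g x ∷ h x ∷ []) (λ x c f g h →
        f ⊗ g ≋ x ⊗ (h ⊗ g) ⊕ ⓪ ⊕ c ⊗ g ⇐ g ∙ (f ≋ x ⊗ h ⊕ c) & none) (f≗ x))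
      (monic-+-below (step 0# (monic-* mh mg) (λ _ → refl))
        (subst (λ k → Below k (λ x → c * g x)) (ℕₚ.+-suc m n) (below-+ m (scaled-monic c mg))))

  monic-^ : ∀ n → Monic n (_^ n)
  monic-^ zero    = one (λ _ → refl)
  monic-^ (suc n) = step 0# (monic-^ n) (λ x → sym (+-identityʳ _))

  constant-below : ∀ n c → Below (suc n) (λ _ → c)
  constant-below n c = subst (λ k → Below k (λ _ → c)) (ℕₚ.+-comm n 1)
    (below-+ n (step c (none {f = λ _ → 0#} (λ _ → refl)) (λ x → deduce (x ∷ c ∷ []) (λ x c → c ≋ x ⊗ ⓪ ⊕ c ⇐ none))))

  monic-product : ∀ {d} k (w : Fin k → F) → Monic (k ℕ.* suc d)
    (λ x → CommutativeMonoidSum.sum *-commutativeMonoid (λ i → x ^ suc d - w i))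
  monic-product zero    w = one (λ _ → refl)
  monic-product {d} (suc k) w =
    monic-* (monic-+-below (monic-^ (suc d)) (constant-below d (- w zero))) (monic-product k (w ∘ suc))

  -- Synthetic division, to which the Horner form lends itself: the quotient of x g(x) + c by x - r
  -- is x h(x) + g(r), where `h` is the quotient of `g`.
  factor : ∀ {n f} → Monic (suc n) f → ∀ r → ∃[ h ] Monic n h × (∀ x → f x ≡ (x - r) * h x + f r)
  factor {zero} {f} (step {g = g} c (one g≗1) f≗) r = (λ _ → 1#) , one (λ _ → refl) , λ x →
    deduce (x ∷ r ∷ c ∷ f x ∷ f r ∷ g x ∷ g r ∷ []) (λ x r c fx fr gx gr →
      fx ≋ (x ⊖ r) ⊗ ① ⊕ fr ⇐ ① ∙ (fx ≋ x ⊗ gx ⊕ c) & ⊝ ① ∙ (fr ≋ r ⊗ gr ⊕ c) & x ∙ (gx ≋ ①) & ⊝ r ∙ (gr ≋ ①) & none)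
      (f≗ x) (f≗ r) (g≗1 x) (g≗1 r)
  factor {suc n} {f} (step {g = g} c mg f≗) r =
    let h , mh , g≗ = factor mg r in (λ x → x * h x + g r) , step (g r) mh (λ _ → refl) , λ x →
      deduce (x ∷ r ∷ c ∷ f x ∷ f r ∷ g x ∷ g r ∷ h x ∷ []) (λ x r c fx fr gx gr hx →
        fx ≋ (x ⊖ r) ⊗ (x ⊗ hx ⊕ gr) ⊕ fr ⇐ ① ∙ (fx ≋ x ⊗ gx ⊕ c) & ⊝ ① ∙ (fr ≋ r ⊗ gr ⊕ c)
        & x ∙ (gx ≋ (x ⊖ r) ⊗ hx ⊕ gr) & none)
        (f≗ x) (f≗ r) (g≗ x)

  -- After the first root is split off, the others are roots of the quotient, because their
  -- differences from the first are nonzero.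
  roots≤degree : ∀ {n f} → Monic n f → (r : Fin (suc n) → F) → Injective _≡_ _≡_ r → ¬ (∀ i → f (r i) ≡ 0#)
  roots≤degree (one f≗1) r r-inj roots = 0≢1 (trans (sym (roots zero)) (f≗1 _))
  roots≤degree {suc n} {f} mf@(step _ _ _) r r-inj roots =
    let h , mh , f≗ = factor mf (r zero)
    in roots≤degree mh (r ∘ suc) (Fin.suc-injective ∘ r-inj) λ i →
         *-cancelˡ-≡ (difference≢0 i) (deduce (r (suc i) ∷ r zero ∷ f (r (suc i)) ∷ f (r zero) ∷ h (r (suc i)) ∷ [])
           (λ x r fx fr hx → (x ⊖ r) ⊗ hx ≋ (x ⊖ r) ⊗ ⓪ ⇐
             ⊝ ① ∙ (fx ≋ (x ⊖ r) ⊗ hx ⊕ fr) & ① ∙ (fx ≋ ⓪) & ⊝ ① ∙ (fr ≋ ⓪) & none) (f≗ _) (roots (suc i)) (roots zero))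
    where
    difference≢0 : ∀ i → r (suc i) - r zero ≢ 0#
    difference≢0 i e with () ← r-inj (minus≡0⇒≡ e)

  not-vanishing : ∀ {n f} → Monic n f → n ℕ.< m → ¬ (∀ x → f x ≡ 0#)
  not-vanishing mf n<m f≗0 = roots≤degree mf (λ i → from (inject≤ i n<m))
    (Fin.inject≤-injective n<m n<m _ _ ∘ from-injective) (λ i → f≗0 _)

-- Injectivity and surjectivity from counting roots.

module Pigeonhole {m : ℕ} (𝔽 : FiniteField m) where

  open FiniteField 𝔽 renaming (Carrier to F)
  open FieldTheory 𝔽
  open CommutativeRing commutativeRing using (*-commutativeMonoid; zeroˡ; -‿inverseʳ)
  open Inverse enumeration using (to; from; strictlyInverseʳ)
  open Involution 𝔽 (identity-isInvolution 𝔽) using (deduce)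
  open CommutativeMonoidSum *-commutativeMonoid using (sum-remove) renaming (sum to product)

  product-zero : ∀ {n} (f : Fin n → F) i → f i ≡ 0# → product f ≡ 0#
  product-zero {suc n} f i fi≡0 = begin
    product f                       ≡⟨ sum-remove {i = i} f ⟩
    f i * product (removeAt f i)    ≡⟨ cong (_* product (removeAt f i)) fi≡0 ⟩
    0# * product (removeAt f i)     ≡⟨ zeroˡ _ ⟩
    0#                              ∎
    where open ≡-Reasoning

  ≡⇒minus≡0 : ∀ {x y} → x ≡ y → x - y ≡ 0#
  ≡⇒minus≡0 {x} refl = -‿inverseʳ x

  -- A missing root `w` together with the values of `f` would be k + 2 distinct roots of x^(k+1) -
  -- 1.
  roots-of-unity-exhausted : ∀ {k} (f : Fin (suc k) → F) → Injective _≡_ _≡_ f →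
    (∀ i → f i ^ suc k ≡ 1#) → ∀ w → w ^ suc k ≡ 1# → ∃[ i ] f i ≡ w
  roots-of-unity-exhausted {k} f f-inj f∈μ w w∈μ with Fin.any? (λ i → f i ≟ w)
  ... | yes found = found
  ... | no missing = contradiction roots
      (roots≤degree (monic-+-below (monic-^ (suc k)) (constant-below k (- 1#))) f⁺ f⁺-injective)
    where
    f⁺ : Fin (suc (suc k)) → F
    f⁺ zero    = w
    f⁺ (suc i) = f i
    f⁺-injective : Injective _≡_ _≡_ f⁺
    f⁺-injective {zero}  {zero}  e = refl
    f⁺-injective {zero}  {suc j} e = contradiction (j , sym e) missing
    f⁺-injective {suc i} {zero}  e = contradiction (i , e) missing
    f⁺-injective {suc i} {suc j} e = cong suc (f-inj e)
    roots : ∀ i → f⁺ i ^ suc k - 1# ≡ 0#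
    roots zero    = ≡⇒minus≡0 w∈μ
    roots (suc i) = ≡⇒minus≡0 (f∈μ i)

  -- If f took a value twice, all x would be roots of x ∏ (x^(d+1) − w) over the other values w.
  power-values-injective : ∀ d {k} (f : Fin (suc k) → F) → suc (k ℕ.* suc d) ℕ.< m →
    (∀ x → x ≢ 0# → ∃[ i ] x ^ suc d ≡ f i) → Injective _≡_ _≡_ f
  power-values-injective d {k} f degree<m covered {i} {j} fi≡fj =
    decidable-stable (i Fin.≟ j) λ i≢j →
      not-vanishing (monic-* (monic-^ 1) (monic-product {d} k (f ∘ punchIn j))) degree<m (vanishes i≢j)
    where
    factors : F → Fin k → F
    factors x l = x ^ suc d - f (punchIn j l)
    -- A value with index `j` is also the value with index `i`, which survives the removal of `j`.
    hit : i ≢ j → ∀ x l → x ^ suc d ≡ f l → ∃[ l′ ] x ^ suc d ≡ f (punchIn j l′)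
    hit i≢j x l e with j Fin.≟ l
    ... | yes refl = punchOut (i≢j ∘ sym) , trans e (trans (sym fi≡fj) (cong f (sym (Fin.punchIn-punchOut _))))
    ... | no j≢l   = punchOut j≢l , trans e (cong f (sym (Fin.punchIn-punchOut _)))
    vanishes : i ≢ j → ∀ x → x ^ 1 * product (factors x) ≡ 0#
    vanishes i≢j x with x ≟ 0#
    ... | yes refl = trans (cong (_* product (factors 0#)) (zeroˡ _)) (zeroˡ _)
    ... | no x≢0 with covered x x≢0
    ...   | l , e with hit i≢j x l e
    ...     | l′ , e′ = trans (cong (x ^ 1 *_) (product-zero (factors x) l′ (≡⇒minus≡0 e′))) (zeroʳ _)

  -- x^(d+2) − x is monic of degree d + 2.
  frobenius-nontrivial : ∀ d → suc (suc d) ℕ.< m → ∃[ x ] x ^ suc (suc d) ≢ x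
  frobenius-nontrivial d d+2<m with Fin.all? (λ i → (from i ^ suc (suc d)) ≟ from i)
  ... | yes fixed = contradiction
      (λ x → ≡⇒minus≡0 (subst (λ y → y ^ suc (suc d) ≡ y) (strictlyInverseʳ x) (fixed (to x))))
      (not-vanishing (monic-+-below (monic-^ (suc (suc d))) (step 0# (constant-below d (- 1#)) linear)) d+2<m)
    where
    linear : ∀ x → - x ≡ x * - 1# + 0#
    linear x = deduce (x ∷ []) λ x → ⊝ x ≋ x ⊗ ⊝ ① ⊕ ⓪ ⇐ none
  ... | no moved = let i , ≢ = Fin.¬∀⟶∃¬ _ _ (λ i → (from i ^ suc (suc d)) ≟ from i) moved in from i , ≢

-- The involution x ↦ x^q of the field of order q².

module Conjugation (q : ℕ) (q-primePower : IsPrimePower q) (3≤q : 3 ℕ.≤ q) (𝔽 : FiniteField (q ℕ.^ 2)) where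

  open FiniteField 𝔽 renaming (Carrier to F)
  open FieldTheory 𝔽
  open Pigeonhole 𝔽
  open CommutativeRing commutativeRing using (*-identityʳ; +-monoid; +-identityʳ; commutativeSemiring)
  open CommutativeExp commutativeSemiring using (^-distrib-*)
  open SemiringExp semiring using (^-assocʳ)
  open MonoidMult +-monoid using (×-assocˡ) renaming (_×_ to _×ᴺ_)

  conj : F → F
  conj x = x ^ q

  private
    p k : ℕ
    p = proj₁ q-primePower
    k = proj₁ (proj₂ q-primePower)
    pr : Prime p
    pr = proj₁ (proj₂ (proj₂ q-primePower))
    1≤k : 1 ℕ.≤ k
    1≤k = proj₁ (proj₂ (proj₂ (proj₂ q-primePower)))
    q≡pᵏ : q ≡ p ℕ.^ k
    q≡pᵏ = proj₂ (proj₂ (proj₂ (proj₂ q-primePower)))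

    -- Exhibits the exponent q - 1 = d + 1 as a successor, the form needed for the power
    -- polynomials.
    q≡2+ : ∃[ d ] q ≡ suc (suc d)
    q≡2+ = lemma 3≤q
      where
      lemma : ∀ {q} → 3 ℕ.≤ q → ∃[ d ] q ≡ suc (suc d)
      lemma (s≤s (s≤s _)) = _ , refl

    -- The order q² = p^(2k) of the field annihilates 1, so (p·1)^(2k) = 0.
    p×1≡0 : p ×ᴺ 1# ≡ 0#
    p×1≡0 = ^≡0⇒≡0 (p ×ᴺ 1#) (k ℕ.* 2) (begin
      (p ×ᴺ 1#) ^ (k ℕ.* 2)    ≡⟨ ^-×1 p (k ℕ.* 2) ⟨
      (p ℕ.^ (k ℕ.* 2)) ×ᴺ 1#  ≡⟨ cong (_×ᴺ 1#) (trans (sym (ℕₚ.^-*-assoc p k 2)) (cong (ℕ._^ 2) (sym q≡pᵏ))) ⟩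
      (q ℕ.^ 2) ×ᴺ 1#          ≡⟨ card×1≡0 ⟩
      0#                       ∎)
      where open ≡-Reasoning

  isInvolution : IsInvolution 𝔽 conj
  isInvolution = record
    { conj-+    = λ x y → subst (λ r → (x + y) ^ r ≡ x ^ r + y ^ r) (sym q≡pᵏ) (frobenius^-+ pr p×1≡0 k x y)
    ; conj-*    = λ x y → ^-distrib-* x y q
    ; conj-conj = λ x → trans (^-assocʳ x q q) (trans (cong (λ r → x ^ (q ℕ.* r)) (sym (ℕₚ.*-identityʳ q))) (x^card≡x x))
    }

  open IsInvolution isInvolution public
  open Involution 𝔽 isInvolution public

  q×1≡0 : q ×ᴺ 1# ≡ 0#
  q×1≡0 = begin
    q ×ᴺ 1#          ≡⟨ cong (_×ᴺ 1#) q≡pᵏ ⟩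
    (p ℕ.^ k) ×ᴺ 1#  ≡⟨ ^-×1 p k ⟩
    (p ×ᴺ 1#) ^ k    ≡⟨ cong (_^ k) p×1≡0 ⟩
    0# ^ k           ≡⟨ 0^ 1≤k ⟩
    0#               ∎
    where
    open ≡-Reasoning
    0^ : ∀ {k} → 1 ℕ.≤ k → 0# ^ k ≡ 0#
    0^ (s≤s _) = CommutativeRing.zeroˡ commutativeRing _

  -- If 2 = 0 in the field, then q·1 = 1 for odd `q`, against q·1 = 0.
  -1≢1 : ¬ 2 ∣ℕ q → - 1# ≢ 1#
  -1≢1 q-odd -1≡1 = q-odd (lemma (q % 2) (m%n<n q 2) (m≡m%n+[m/n]*n q 2))
    where
    open ≡-Reasoning
    h = q /ℕ 2
    2×≡0 : ∀ x → 2 ×ᴺ x ≡ 0#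
    2×≡0 x = deduce (x ∷ []) (λ x → x ⊕ (x ⊕ ⓪) ≋ ⓪ ⇐ ⊝ x ∙ (⊝ ① ≋ ①) & none) -1≡1
    lemma : ∀ r → r ℕ.< 2 → q ≡ r ℕ.+ h ℕ.* 2 → 2 ∣ℕ q
    lemma 0 _ e = divides h e
    lemma 1 _ e = contradiction (begin
      0#                      ≡⟨ q×1≡0 ⟨
      q ×ᴺ 1#                 ≡⟨ cong (_×ᴺ 1#) (trans e (cong suc (ℕₚ.*-comm h 2))) ⟩
      1# + (2 ℕ.* h) ×ᴺ 1#    ≡⟨ cong (1# +_) (trans (sym (×-assocˡ 1# 2 h)) (2×≡0 _)) ⟩
      1# + 0#                 ≡⟨ +-identityʳ 1# ⟩
      1#                      ∎) 0≢1
    lemma (suc (suc _)) (s≤s (s≤s ())) _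

  private
    q<q² : q ℕ.< q ℕ.^ 2
    q<q² = subst (λ r → r ℕ.< r ℕ.^ 2) (sym (proj₂ q≡2+)) (lemma (proj₁ q≡2+))
      where
      lemma : ∀ d → suc (suc d) ℕ.< suc (suc d) ℕ.^ 2
      lemma d = ℕₚ.m<m*n (suc (suc d)) (suc (suc d) ℕ.* 1) (s≤s (s≤s z≤n))

    -- This is q (q - 1) + 1, the degree of x times `q` factors x^(q-1) - w; it falls short of q² by
    -- q - 1.
    degree<q² : suc (q ℕ.* suc (proj₁ q≡2+)) ℕ.< q ℕ.^ 2
    degree<q² = subst (λ r → suc (r ℕ.* suc (proj₁ q≡2+)) ℕ.< r ℕ.^ 2) (sym (proj₂ q≡2+)) (lemma (proj₁ q≡2+))
      where
      lemma : ∀ d → suc (suc (suc d) ℕ.* suc d) ℕ.< suc (suc d) ℕ.^ 2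
      lemma d = begin-strict
        suc (suc (suc d) ℕ.* suc d)  <⟨ ℕₚ.+-monoˡ-< (suc (suc d) ℕ.* suc d) {1} {suc (suc d)} (s≤s (s≤s z≤n)) ⟩
        suc (suc d) ℕ.+ suc (suc d) ℕ.* suc d  ≡⟨ ℕₚ.*-suc (suc (suc d)) (suc d) ⟨
        suc (suc d) ℕ.* suc (suc d)  ≡⟨ cong (suc (suc d) ℕ.*_) (ℕₚ.*-identityʳ (suc (suc d))) ⟨
        suc (suc d) ℕ.^ 2            ∎
        where open ℕₚ.≤-Reasoning

  abstract
    conj-nontrivial : ∃[ θ ] conj θ ≢ θ
    conj-nontrivial = subst (λ r → ∃[ x ] x ^ r ≢ x) (sym (proj₂ q≡2+))
      (frobenius-nontrivial (proj₁ q≡2+) (subst (ℕ._< q ℕ.^ 2) (proj₂ q≡2+) q<q²))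

  -- By definition x · x^q is x^(q+1), so the elements of norm 1 are the (q + 1)-th roots of unity.
  norm-one-surjective : (f : Fin (suc q) → F) → Injective _≡_ _≡_ f → (∀ i → f i * conj (f i) ≡ 1#) →
    ∀ w → w * conj w ≡ 1# → ∃[ i ] f i ≡ w
  norm-one-surjective = roots-of-unity-exhausted

  -- Cancelling `x` turns x^q = w x into x^(q-1) = w, so the q + 1 values of `f` cover all (q -
  -- 1)-th powers of nonzero elements.
  conj-quotients-injective : (f : Fin (suc q) → F) → (∀ x → x ≢ 0# → ∃[ i ] conj x ≡ f i * x) → Injective _≡_ _≡_ f
  conj-quotients-injective f covered = power-values-injective (proj₁ q≡2+) f degree<q² λ x x≢0 →
    proj₁ (covered x x≢0) , *-cancelˡ-≡ x≢0 (begin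
      x ^ suc (suc (proj₁ q≡2+))      ≡⟨ cong (x ^_) (proj₂ q≡2+) ⟨
      x ^ q                           ≡⟨ proj₂ (covered x x≢0) ⟩
      f (proj₁ (covered x x≢0)) * x   ≡⟨ *-comm _ x ⟩
      x * f (proj₁ (covered x x≢0))   ∎)
    where open ≡-Reasoning

-- The lines of Σ_η

module BaerLines (q : ℕ) (q-primePower : IsPrimePower q) (3≤q : 3 ℕ.≤ q) (𝔽 : FiniteField (q ℕ.^ 2))
  (η : FiniteField.Carrier 𝔽) (η∈𝒰 : BaerGeometry.𝒰 q 𝔽 η) where

  open FiniteField 𝔽 renaming (Carrier to F)
  open FieldTheory 𝔽
  open Conjugation q q-primePower 3≤q 𝔽 hiding (⟦_⟧)
  open BaerGeometry q 𝔽
  open CommutativeRing commutativeRing using (*-identityʳ; +-identityʳ; zeroˡ)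

  1≢0 : 1# ≢ 0#
  1≢0 = 0≢1 ∘ sym

  η≢0 : η ≢ 0#
  η≢0 η≡0 = 0≢1 (deduce (η ∷ []) (λ η → ⓪ ≋ ① ⇐ ① ∙ (η ⊗ η ‾ ≋ ①) & ⊝ (η ‾) ∙ (η ≋ ⓪) & none) η∈𝒰 η≡0)

  conj-≢0 : ∀ {x} → x ≢ 0# → conj x ≢ 0#
  conj-≢0 {x} x≢0 x̄≡0 = x≢0 (trans (sym (conj-conj x)) (trans (cong conj x̄≡0) conj-0))

  abstract
    cramer : ∀ {p q p′ q′} y y′ → p * q′ - p′ * q ≢ 0# →
      ∃₂ λ a b → y ≡ a * p + b * q × y′ ≡ a * p′ + b * q′
    cramer {p} {q} {p′} {q′} y y′ Δ≢0 with inverse _ Δ≢0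
    ... | d , Δd≡1 = d * (y * q′ - y′ * q) , d * (p * y′ - p′ * y)
      , deduce (p ∷ q ∷ p′ ∷ q′ ∷ y ∷ y′ ∷ d ∷ []) (λ p q p′ q′ y y′ d →
          y ≋ d ⊗ (y ⊗ q′ ⊖ y′ ⊗ q) ⊗ p ⊕ d ⊗ (p ⊗ y′ ⊖ p′ ⊗ y) ⊗ q
          ⇐ ⊝ y ∙ ((p ⊗ q′ ⊖ p′ ⊗ q) ⊗ d ≋ ①) & none) Δd≡1
      , deduce (p ∷ q ∷ p′ ∷ q′ ∷ y ∷ y′ ∷ d ∷ []) (λ p q p′ q′ y y′ d →
          y′ ≋ d ⊗ (y ⊗ q′ ⊖ y′ ⊗ q) ⊗ p′ ⊕ d ⊗ (p ⊗ y′ ⊖ p′ ⊗ y) ⊗ q′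
          ⇐ ⊝ y′ ∙ ((p ⊗ q′ ⊖ p′ ⊗ q) ⊗ d ≋ ①) & none) Δd≡1

  x₁ x₂ x₃ x₄ : V → F
  x₁ = head
  x₂ = head ∘ tail
  x₃ = head ∘ tail ∘ tail
  x₄ = head ∘ tail ∘ tail ∘ tail

  vec-≡ : ∀ {v w : V} → x₁ v ≡ x₁ w → x₂ v ≡ x₂ w → x₃ v ≡ x₃ w → x₄ v ≡ x₄ w → v ≡ w
  vec-≡ {_ ∷ _ ∷ _ ∷ _ ∷ []} {_ ∷ _ ∷ _ ∷ _ ∷ []} refl refl refl refl = refl

  Span : V → V → V → Set
  Span A B v = ∃₂ λ a b → v ≡ a · A +ⱽ b · B

  span-swap : ∀ {A B v} → Span A B v → Span B A v
  span-swap {_ ∷ _ ∷ _ ∷ _ ∷ []} {_ ∷ _ ∷ _ ∷ _ ∷ []} (a , b , refl) =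
    b , a , vec-≡ (swap _ _) (swap _ _) (swap _ _) (swap _ _)
    where
    swap = CommutativeRing.+-comm commutativeRing

  baer : F → F → V
  baer x y = x ∷ y ∷ η * x ^ q ∷ η * y ^ q ∷ []

  Ση : PointSet
  Ση = Σ[ η ]

  NonZeroPair : F → F → Set
  NonZeroPair x y = ¬ (x ≡ 0# × y ≡ 0#)

  baer-≢0 : ∀ {x y} → NonZeroPair x y → baer x y ≢ 0ⱽ
  baer-≢0 xy≢0 e = xy≢0 (cong x₁ e , cong x₂ e)

  baer-point : ∀ x y → NonZeroPair x y → Point
  baer-point x y xy≢0 = point (baer x y) (baer-≢0 xy≢0)

  1· : ∀ v → v ≡ 1# · v
  1· (_ ∷ _ ∷ _ ∷ _ ∷ []) = sym (vec-≡ (*-identityˡ _) (*-identityˡ _) (*-identityˡ _) (*-identityˡ _))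

  baer-point∈Ση : ∀ x y xy≢0 → baer-point x y xy≢0 ∈ Ση
  baer-point∈Ση x y xy≢0 = x , y , xy≢0 , 1# , 1≢0 , 1· _

  -- (x , y) ↦ baer x y identifies Σ_η with the projective space of F² over 𝔽_q. Its lines
  -- are of three kinds: y = 0, those skew to it and those meeting it in one point.
  data Code : Set where
    ∞ : Code
    G : (e g : F) → Code
    H : (ν a μ : F) → Code

  -- `H ν a μ` is the line through (κ , 0) and (a y , y), where κ^(q-1) = ν and y^(q-1) = μ. Here
  -- `a` is not unique: it may be changed by any k with k^q μ = ν k, which moves the second point
  -- along the line.
  On : Code → F → F → Set
  On ∞         x y = y ≡ 0#
  On (G e g)   x y = x ≡ e * y + g * conj y
  On (H ν a μ) x y = conj (x - a * y) ≡ ν * (x - a * y) × conj y ≡ μ * y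

  Locus : Code → PointSet
  Locus c P = ∃₂ λ x y → NonZeroPair x y × On c x y × ∃[ k ] k ≢ 0# × coords P ≡ k · baer x y

  -- The coefficients lie in the large field, so the last two equations are not the conjugates of
  -- the first two and have to be carried along.
  record Combines (k x y a p₁ p₂ b q₁ q₂ : F) : Set where
    constructor combines
    field
      first   : k * x ≡ a * p₁ + b * q₁
      second  : k * y ≡ a * p₂ + b * q₂
      first‾  : k * conj x ≡ a * conj p₁ + b * conj q₁
      second‾ : k * conj y ≡ a * conj p₂ + b * conj q₂

  components : ∀ {k x y a p₁ p₂ b q₁ q₂} → k · baer x y ≡ a · baer p₁ p₂ +ⱽ b · baer q₁ q₂ →
    Combines k x y a p₁ p₂ b q₁ q₂
  components {k} {x} {y} {a} {p₁} {p₂} {b} {q₁} {q₂} e =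
    combines (cong x₁ e) (cong x₂ e) (cancel-η x p₁ q₁ (cong x₃ e)) (cancel-η y p₂ q₂ (cong x₄ e))
    where
    cancel-η : ∀ x p r → k * (η * conj x) ≡ a * (η * conj p) + b * (η * conj r) → k * conj x ≡ a * conj p + b * conj r
    cancel-η x p r h = *-cancelˡ-≡ η≢0 (deduce (k ∷ η ∷ a ∷ b ∷ x ∷ p ∷ r ∷ []) (λ k η a b x p r →
      η ⊗ (k ⊗ x ‾) ≋ η ⊗ (a ⊗ p ‾ ⊕ b ⊗ r ‾) ⇐ ① ∙ (k ⊗ (η ⊗ x ‾) ≋ a ⊗ (η ⊗ p ‾) ⊕ b ⊗ (η ⊗ r ‾)) & none) h)

  -- Each condition `On c` is linear over the large field in x, y, x^q and y^q, hence stable under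
  -- combinations with coefficients outside 𝔽_q.
  on-span : ∀ c {k x y a p₁ p₂ b q₁ q₂} → k ≢ 0# → On c p₁ p₂ → On c q₁ q₂ →
    Combines k x y a p₁ p₂ b q₁ q₂ → On c x y
  on-span ∞ {k} {x} {y} {a} {p₁} {p₂} {b} {q₁} {q₂} k≢0 hp hq (combines _ e₂ _ _) =
    *-cancelˡ-≡ k≢0 (deduce (k ∷ y ∷ a ∷ p₂ ∷ b ∷ q₂ ∷ []) (λ k y a p₂ b q₂ →
      k ⊗ y ≋ k ⊗ ⓪ ⇐ ① ∙ (k ⊗ y ≋ a ⊗ p₂ ⊕ b ⊗ q₂) & a ∙ (p₂ ≋ ⓪) & b ∙ (q₂ ≋ ⓪) & none) e₂ hp hq)
  on-span (G e g) {k} {x} {y} {a} {p₁} {p₂} {b} {q₁} {q₂} k≢0 hp hq (combines e₁ e₂ _ e₄) =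
    *-cancelˡ-≡ k≢0 (deduce (k ∷ x ∷ y ∷ a ∷ p₁ ∷ p₂ ∷ b ∷ q₁ ∷ q₂ ∷ e ∷ g ∷ []) (λ k x y a p₁ p₂ b q₁ q₂ e g →
      k ⊗ x ≋ k ⊗ (e ⊗ y ⊕ g ⊗ y ‾) ⇐
        ① ∙ (k ⊗ x ≋ a ⊗ p₁ ⊕ b ⊗ q₁) & ⊝ e ∙ (k ⊗ y ≋ a ⊗ p₂ ⊕ b ⊗ q₂)
      & ⊝ g ∙ (k ⊗ y ‾ ≋ a ⊗ p₂ ‾ ⊕ b ⊗ q₂ ‾) & a ∙ (p₁ ≋ e ⊗ p₂ ⊕ g ⊗ p₂ ‾) & b ∙ (q₁ ≋ e ⊗ q₂ ⊕ g ⊗ q₂ ‾) & none)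
      e₁ e₂ e₄ hp hq)
  on-span (H ν c μ) {k} {x} {y} {a} {p₁} {p₂} {b} {q₁} {q₂} k≢0 (hp , hp′) (hq , hq′) (combines e₁ e₂ e₃ e₄) =
      *-cancelˡ-≡ k≢0 (deduce (k ∷ x ∷ y ∷ a ∷ p₁ ∷ p₂ ∷ b ∷ q₁ ∷ q₂ ∷ ν ∷ c ∷ []) (λ k x y a p₁ p₂ b q₁ q₂ ν c →
        k ⊗ (x ⊖ c ⊗ y) ‾ ≋ k ⊗ (ν ⊗ (x ⊖ c ⊗ y)) ⇐
          ⊝ ν ∙ (k ⊗ x ≋ a ⊗ p₁ ⊕ b ⊗ q₁) & ν ⊗ c ∙ (k ⊗ y ≋ a ⊗ p₂ ⊕ b ⊗ q₂)
        & ① ∙ (k ⊗ x ‾ ≋ a ⊗ p₁ ‾ ⊕ b ⊗ q₁ ‾) & ⊝ (c ‾) ∙ (k ⊗ y ‾ ≋ a ⊗ p₂ ‾ ⊕ b ⊗ q₂ ‾)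
        & a ∙ ((p₁ ⊖ c ⊗ p₂) ‾ ≋ ν ⊗ (p₁ ⊖ c ⊗ p₂)) & b ∙ ((q₁ ⊖ c ⊗ q₂) ‾ ≋ ν ⊗ (q₁ ⊖ c ⊗ q₂)) & none)
        e₁ e₂ e₃ e₄ hp hq)
    , *-cancelˡ-≡ k≢0 (deduce (k ∷ y ∷ a ∷ p₂ ∷ b ∷ q₂ ∷ μ ∷ []) (λ k y a p₂ b q₂ μ →
        k ⊗ y ‾ ≋ k ⊗ (μ ⊗ y) ⇐
          ⊝ μ ∙ (k ⊗ y ≋ a ⊗ p₂ ⊕ b ⊗ q₂) & ① ∙ (k ⊗ y ‾ ≋ a ⊗ p₂ ‾ ⊕ b ⊗ q₂ ‾)
        & a ∙ (p₂ ‾ ≋ μ ⊗ p₂) & b ∙ (q₂ ‾ ≋ μ ⊗ q₂) & none)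
        e₂ e₄ hp′ hq′)

  -- A line imposes two equations on x, y, x^q, y^q, and this is the minor in the two coordinates
  -- that remain free: x and x^q for `∞`, y and y^q for `G`, x and y for `H`.
  det : Code → (p₁ p₂ q₁ q₂ : F) → F
  det ∞         p₁ p₂ q₁ q₂ = p₁ * conj q₁ - conj p₁ * q₁
  det (G _ _)   p₁ p₂ q₁ q₂ = p₂ * conj q₂ - conj p₂ * q₂
  det (H _ _ _) p₁ p₂ q₁ q₂ = p₁ * q₂ - p₂ * q₁

  Coefficients : (x y p₁ p₂ q₁ q₂ : F) → Set
  Coefficients x y p₁ p₂ q₁ q₂ = ∃₂ λ a b → Combines 1# x y a p₁ p₂ b q₁ q₂

  1*-≡ : ∀ {x y} → x ≡ y → 1# * x ≡ y
  1*-≡ = trans (*-identityˡ _)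

  coefficients-∞ : ∀ {x y p₁ p₂ q₁ q₂} → p₁ * conj q₁ - conj p₁ * q₁ ≢ 0# →
    p₂ ≡ 0# → q₂ ≡ 0# → y ≡ 0# → Coefficients x y p₁ p₂ q₁ q₂
  coefficients-∞ {x} {y} {p₁} {p₂} {q₁} {q₂} Δ≢0 hp hq hy =
    let a , b , ex , ex̄ = cramer x (conj x) Δ≢0 in a , b , combines (1*-≡ ex) (second a b) (1*-≡ ex̄) (second‾ a b)
    where
    second : ∀ a b → 1# * y ≡ a * p₂ + b * q₂
    second a b = deduce (y ∷ p₂ ∷ q₂ ∷ a ∷ b ∷ []) (λ y p₂ q₂ a b → ① ⊗ y ≋ a ⊗ p₂ ⊕ b ⊗ q₂ ⇐
      ① ∙ (y ≋ ⓪) & ⊝ a ∙ (p₂ ≋ ⓪) & ⊝ b ∙ (q₂ ≋ ⓪) & none) hy hp hq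
    second‾ : ∀ a b → 1# * conj y ≡ a * conj p₂ + b * conj q₂
    second‾ a b = deduce (y ∷ p₂ ∷ q₂ ∷ a ∷ b ∷ []) (λ y p₂ q₂ a b → ① ⊗ y ‾ ≋ a ⊗ p₂ ‾ ⊕ b ⊗ q₂ ‾ ⇐
      ① ∙ (y ‾ ≋ ⓪ ‾) & ⊝ a ∙ (p₂ ‾ ≋ ⓪ ‾) & ⊝ b ∙ (q₂ ‾ ≋ ⓪ ‾) & none) (cong conj hy) (cong conj hp) (cong conj hq)

  coefficients-G : ∀ e g {x y p₁ p₂ q₁ q₂} → p₂ * conj q₂ - conj p₂ * q₂ ≢ 0# →
    On (G e g) p₁ p₂ → On (G e g) q₁ q₂ → On (G e g) x y → Coefficients x y p₁ p₂ q₁ q₂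
  coefficients-G e g {x} {y} {p₁} {p₂} {q₁} {q₂} Δ≢0 hp hq hx =
    let a , b , ey , eȳ = cramer y (conj y) Δ≢0 in a , b , combines (first a b ey eȳ) (1*-≡ ey) (first‾ a b ey eȳ) (1*-≡ eȳ)
    where
    first : ∀ a b → y ≡ a * p₂ + b * q₂ → conj y ≡ a * conj p₂ + b * conj q₂ → 1# * x ≡ a * p₁ + b * q₁
    first a b ey eȳ = deduce (x ∷ y ∷ a ∷ p₁ ∷ p₂ ∷ b ∷ q₁ ∷ q₂ ∷ e ∷ g ∷ []) (λ x y a p₁ p₂ b q₁ q₂ e g →
      ① ⊗ x ≋ a ⊗ p₁ ⊕ b ⊗ q₁ ⇐ ① ∙ (x ≋ e ⊗ y ⊕ g ⊗ y ‾) & e ∙ (y ≋ a ⊗ p₂ ⊕ b ⊗ q₂)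
      & g ∙ (y ‾ ≋ a ⊗ p₂ ‾ ⊕ b ⊗ q₂ ‾)
      & ⊝ a ∙ (p₁ ≋ e ⊗ p₂ ⊕ g ⊗ p₂ ‾) & ⊝ b ∙ (q₁ ≋ e ⊗ q₂ ⊕ g ⊗ q₂ ‾) & none) hx ey eȳ hp hq
    first‾ : ∀ a b → y ≡ a * p₂ + b * q₂ → conj y ≡ a * conj p₂ + b * conj q₂ → 1# * conj x ≡ a * conj p₁ + b * conj q₁
    first‾ a b ey eȳ = deduce (x ∷ y ∷ a ∷ p₁ ∷ p₂ ∷ b ∷ q₁ ∷ q₂ ∷ e ∷ g ∷ []) (λ x y a p₁ p₂ b q₁ q₂ e g →
      ① ⊗ x ‾ ≋ a ⊗ p₁ ‾ ⊕ b ⊗ q₁ ‾ ⇐ ① ∙ (x ‾ ≋ (e ⊗ y ⊕ g ⊗ y ‾) ‾) & g ‾ ∙ (y ≋ a ⊗ p₂ ⊕ b ⊗ q₂)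
      & e ‾ ∙ (y ‾ ≋ a ⊗ p₂ ‾ ⊕ b ⊗ q₂ ‾)
      & ⊝ a ∙ (p₁ ‾ ≋ (e ⊗ p₂ ⊕ g ⊗ p₂ ‾) ‾) & ⊝ b ∙ (q₁ ‾ ≋ (e ⊗ q₂ ⊕ g ⊗ q₂ ‾) ‾) & none)
      (cong conj hx) ey eȳ (cong conj hp) (cong conj hq)

  coefficients-H : ∀ ν c μ {x y p₁ p₂ q₁ q₂} → p₁ * q₂ - p₂ * q₁ ≢ 0# →
    On (H ν c μ) p₁ p₂ → On (H ν c μ) q₁ q₂ → On (H ν c μ) x y → Coefficients x y p₁ p₂ q₁ q₂
  coefficients-H ν c μ {x} {y} {p₁} {p₂} {q₁} {q₂} Δ≢0 (hp , hp′) (hq , hq′) (hx , hx′) =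
    let a , b , ex , ey = cramer x y Δ≢0 in a , b , combines (1*-≡ ex) (1*-≡ ey) (first‾ a b ex ey) (1*-≡ (second‾ a b ey))
    where
    second‾ : ∀ a b → y ≡ a * p₂ + b * q₂ → conj y ≡ a * conj p₂ + b * conj q₂
    second‾ a b ey = deduce (y ∷ a ∷ p₂ ∷ b ∷ q₂ ∷ μ ∷ []) (λ y a p₂ b q₂ μ →
      y ‾ ≋ a ⊗ p₂ ‾ ⊕ b ⊗ q₂ ‾ ⇐ ① ∙ (y ‾ ≋ μ ⊗ y) & μ ∙ (y ≋ a ⊗ p₂ ⊕ b ⊗ q₂)
      & ⊝ a ∙ (p₂ ‾ ≋ μ ⊗ p₂) & ⊝ b ∙ (q₂ ‾ ≋ μ ⊗ q₂) & none) hx′ ey hp′ hq′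
    first‾ : ∀ a b → x ≡ a * p₁ + b * q₁ → y ≡ a * p₂ + b * q₂ → 1# * conj x ≡ a * conj p₁ + b * conj q₁
    first‾ a b ex ey = deduce (x ∷ y ∷ a ∷ p₁ ∷ p₂ ∷ b ∷ q₁ ∷ q₂ ∷ ν ∷ c ∷ []) (λ x y a p₁ p₂ b q₁ q₂ ν c →
      ① ⊗ x ‾ ≋ a ⊗ p₁ ‾ ⊕ b ⊗ q₁ ‾ ⇐ ν ∙ (x ≋ a ⊗ p₁ ⊕ b ⊗ q₁) & ⊝ (ν ⊗ c) ∙ (y ≋ a ⊗ p₂ ⊕ b ⊗ q₂)
      & c ‾ ∙ (y ‾ ≋ a ⊗ p₂ ‾ ⊕ b ⊗ q₂ ‾)
      & ① ∙ ((x ⊖ c ⊗ y) ‾ ≋ ν ⊗ (x ⊖ c ⊗ y)) & ⊝ a ∙ ((p₁ ⊖ c ⊗ p₂) ‾ ≋ ν ⊗ (p₁ ⊖ c ⊗ p₂))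
      & ⊝ b ∙ ((q₁ ⊖ c ⊗ q₂) ‾ ≋ ν ⊗ (q₁ ⊖ c ⊗ q₂)) & none) ex ey (second‾ a b ey) hx hp hq

  coefficients : ∀ c {x y p₁ p₂ q₁ q₂} → det c p₁ p₂ q₁ q₂ ≢ 0# → On c p₁ p₂ → On c q₁ q₂ → On c x y →
    Coefficients x y p₁ p₂ q₁ q₂
  coefficients ∞         {x} = coefficients-∞ {x}
  coefficients (G e g)   = coefficients-G e g
  coefficients (H ν a μ) = coefficients-H ν a μ

  combines⇒span : ∀ {x y a p₁ p₂ b q₁ q₂} → Combines 1# x y a p₁ p₂ b q₁ q₂ →
    baer x y ≡ a · baer p₁ p₂ +ⱽ b · baer q₁ q₂
  combines⇒span {a = a} {b = b} (combines e₁ e₂ e₃ e₄) =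
    vec-≡ (trans (sym (*-identityˡ _)) e₁) (trans (sym (*-identityˡ _)) e₂) (times-η e₃) (times-η e₄)
    where
    times-η : ∀ {x p r} → 1# * x ≡ a * p + b * r → η * x ≡ a * (η * p) + b * (η * r)
    times-η {x} {p} {r} h = deduce (x ∷ p ∷ r ∷ a ∷ b ∷ η ∷ []) (λ x p r a b η →
      η ⊗ x ≋ a ⊗ (η ⊗ p) ⊕ b ⊗ (η ⊗ r) ⇐ η ∙ (① ⊗ x ≋ a ⊗ p ⊕ b ⊗ r) & none) h

  span-on : ∀ c {x y p₁ p₂ q₁ q₂} → det c p₁ p₂ q₁ q₂ ≢ 0# → On c p₁ p₂ → On c q₁ q₂ → On c x y →
    Span (baer p₁ p₂) (baer q₁ q₂) (baer x y)
  span-on c {x} {y} {p₁} {p₂} {q₁} {q₂} Δ≢0 hp hq hx =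
    let a , b , e = coefficients c {x} {y} {p₁} {p₂} {q₁} {q₂} Δ≢0 hp hq hx in a , b , combines⇒span e

  span-scaled : ∀ {k l A B v} → Span (k · A) (l · B) v → Span A B v
  span-scaled {k} {l} {a₁ ∷ a₂ ∷ a₃ ∷ a₄ ∷ []} {b₁ ∷ b₂ ∷ b₃ ∷ b₄ ∷ []} (s , t , refl) =
    s * k , t * l , vec-≡ (assoc a₁ b₁) (assoc a₂ b₂) (assoc a₃ b₃) (assoc a₄ b₄)
    where
    assoc : ∀ a b → s * (k * a) + t * (l * b) ≡ s * k * a + t * l * b
    assoc a b = cong₂ _+_ (sym (*-assoc s k a)) (sym (*-assoc t l b))

  span-unscaled : ∀ {k l A B v} → k ≢ 0# → l ≢ 0# → Span A B v → Span (k · A) (l · B) v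
  span-unscaled {k} {l} {a₁ ∷ a₂ ∷ a₃ ∷ a₄ ∷ []} {b₁ ∷ b₂ ∷ b₃ ∷ b₄ ∷ []} k≢0 l≢0 (s , t , refl)
    with inverse k k≢0 | inverse l l≢0
  ... | k⁻¹ , kk⁻¹≡1 | l⁻¹ , ll⁻¹≡1 = s * k⁻¹ , t * l⁻¹ , vec-≡ (lemma a₁ b₁) (lemma a₂ b₂) (lemma a₃ b₃) (lemma a₄ b₄)
    where
    lemma : ∀ a b → s * a + t * b ≡ s * k⁻¹ * (k * a) + t * l⁻¹ * (l * b)
    lemma a b = deduce (s ∷ t ∷ k ∷ l ∷ a ∷ b ∷ k⁻¹ ∷ l⁻¹ ∷ []) (λ s t k l a b k⁻¹ l⁻¹ →
      s ⊗ a ⊕ t ⊗ b ≋ s ⊗ k⁻¹ ⊗ (k ⊗ a) ⊕ t ⊗ l⁻¹ ⊗ (l ⊗ b) ⇐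
        ⊝ (s ⊗ a) ∙ (k ⊗ k⁻¹ ≋ ①) & ⊝ (t ⊗ b) ∙ (l ⊗ l⁻¹ ≋ ①) & none) kk⁻¹≡1 ll⁻¹≡1

  span-multiple : ∀ {A B v} k → Span A B v → Span A B (k · v)
  span-multiple {a₁ ∷ a₂ ∷ a₃ ∷ a₄ ∷ []} {b₁ ∷ b₂ ∷ b₃ ∷ b₄ ∷ []} k (s , t , refl) =
    k * s , k * t , vec-≡ (lemma a₁ b₁) (lemma a₂ b₂) (lemma a₃ b₃) (lemma a₄ b₄)
    where
    lemma : ∀ a b → k * (s * a + t * b) ≡ k * s * a + k * t * b
    lemma a b = trans (CommutativeRing.distribˡ commutativeRing k _ _) (cong₂ _+_ (sym (*-assoc k s a)) (sym (*-assoc k t b)))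

  join≐locus : ∀ c P Q →
    (∀ {k x y} → k ≢ 0# → Span (coords P) (coords Q) (k · baer x y) → On c x y) →
    (∀ {x y} → On c x y → Span (coords P) (coords Q) (baer x y)) →
    ⟨ P , Q ⟩ ∩ Ση ≐ Locus c
  join≐locus c P Q span⇒on on⇒span =
      (λ { {R} (R∈PQ , x , y , xy≢0 , k , k≢0 , e) → x , y , xy≢0 , span⇒on k≢0 (subst (Span _ _) e R∈PQ) , k , k≢0 , e })
    , (λ { {R} (x , y , xy≢0 , on , k , k≢0 , e) →
        subst (Span _ _) (sym e) (span-multiple k (on⇒span on)) , x , y , xy≢0 , k , k≢0 , e })

  baer-line≐locus : ∀ c {P Q k l p₁ p₂ q₁ q₂} → k ≢ 0# → l ≢ 0# →
    coords P ≡ k · baer p₁ p₂ → coords Q ≡ l · baer q₁ q₂ →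
    On c p₁ p₂ → On c q₁ q₂ → det c p₁ p₂ q₁ q₂ ≢ 0# → ⟨ P , Q ⟩ ∩ Ση ≐ Locus c
  baer-line≐locus c {P} {Q} {k} {l} {p₁} {p₂} {q₁} {q₂} k≢0 l≢0 eP eQ hp hq Δ≢0 = join≐locus c P Q
    (λ m≢0 span → let a , b , e = span-scaled (subst₂ (λ A B → Span A B _) eP eQ span)
                  in on-span c {_} {_} {_} {a} {p₁} {p₂} {b} {q₁} {q₂} m≢0 hp hq (components e))
    (λ on → subst₂ (λ A B → Span A B _) (sym eP) (sym eQ) (span-unscaled k≢0 l≢0 (span-on c {_} {_} {p₁} {p₂} {q₁} {q₂} Δ≢0 hp hq on)))

  -- The degenerate combination with second coefficient 0 lets `on-span` also compare two
  -- representatives of the same point.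
  proportional : ∀ {k x y l x′ y′} → k · baer x y ≡ l · baer x′ y′ → Combines k x y l x′ y′ 0# x′ y′
  proportional {k} {x} {y} {l} {x′} {y′} e = components (trans e (vec-≡ (plus x′) (plus y′) (plus _) (plus _)))
    where
    plus : ∀ a → l * a ≡ l * a + 0# * a
    plus a = sym (trans (cong (l * a +_) (zeroˡ a)) (+-identityʳ _))

  locus⇒on : ∀ c {P x y k} → k ≢ 0# → coords P ≡ k · baer x y → P ∈ Locus c → On c x y
  locus⇒on c k≢0 e (x′ , y′ , _ , on , l , l≢0 , e′) = on-span c k≢0 on on (proportional (trans (sym e) e′))

  baer-point∈locus⇒on : ∀ c {x y xy≢0} → baer-point x y xy≢0 ∈ Locus c → On c x y
  baer-point∈locus⇒on c {x} {y} {xy≢0} = locus⇒on c {baer-point x y xy≢0} 1≢0 (1· _)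

  baer-point∈locus : ∀ c {x y} xy≢0 → On c x y → baer-point x y xy≢0 ∈ Locus c
  baer-point∈locus c {x} {y} xy≢0 on = x , y , xy≢0 , on , 1# , 1≢0 , 1· _

  infix 4 _⊑_
  -- A record, so that both codes can be inferred from a proof. One inclusion already suffices to
  -- compare the parameters of two lines.
  record _⊑_ (c c′ : Code) : Set where
    constructor inclusion
    field
      include : ∀ P → P ∈ Locus c → P ∈ Locus c′

  ⊑⇒on : ∀ {c c′ x y} → c ⊑ c′ → NonZeroPair x y → On c x y → On c′ x y
  ⊑⇒on {c} {c′} {x} {y} (inclusion c⊑c′) xy≢0 on =
    baer-point∈locus⇒on c′ {xy≢0 = xy≢0} (c⊑c′ (baer-point x y xy≢0) (baer-point∈locus c {x} {y} xy≢0 on))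

  ≐⇒⊑ : ∀ {L : PointSet} c c′ → L ≐ Locus c → L ≐ Locus c′ → c ⊑ c′
  ≐⇒⊑ c c′ (_ , c⊆L) (L⊆c′ , _) = inclusion λ P P∈c → L⊆c′ {P} (c⊆L {P} P∈c)

  locus-≐⇒⊑ : ∀ c c′ → Locus c ≐ Locus c′ → c ⊑ c′
  locus-≐⇒⊑ c c′ = ≐⇒⊑ {Locus c} c c′ ≐-refl

  det≢0⇒distinct : ∀ c {P Q k l p₁ p₂ q₁ q₂} → k ≢ 0# →
    coords P ≡ k · baer p₁ p₂ → coords Q ≡ l · baer q₁ q₂ →
    det c p₁ p₂ q₁ q₂ ≢ 0# → ¬ P ≈ Q
  det≢0⇒distinct c {P} {Q} {k} {l} {p₁} {p₂} {q₁} {q₂} k≢0 eP eQ Δ≢0 (m , m≢0 , e) =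
    Δ≢0 (*-cancelˡ-≡ k≢0 (trans (det≡0 c) (sym (zeroʳ k))))
    where
    multiple : k · baer p₁ p₂ ≡ (m * l) · baer q₁ q₂
    multiple = trans (sym eP) (trans e (trans (cong (m ·_) eQ)
      (vec-≡ (sym (*-assoc m l _)) (sym (*-assoc m l _)) (sym (*-assoc m l _)) (sym (*-assoc m l _)))))
    pair : ∀ {x x′ y y′} → k * x ≡ m * l * y + 0# * y → k * x′ ≡ m * l * y′ + 0# * y′ → k * (x * y′ - x′ * y) ≡ 0#
    pair {x} {x′} {y} {y′} h h′ = deduce (k ∷ x ∷ x′ ∷ m ∷ l ∷ y ∷ y′ ∷ []) (λ k x x′ m l y y′ →
      k ⊗ (x ⊗ y′ ⊖ x′ ⊗ y) ≋ ⓪ ⇐ y′ ∙ (k ⊗ x ≋ m ⊗ l ⊗ y ⊕ ⓪ ⊗ y) & ⊝ y ∙ (k ⊗ x′ ≋ m ⊗ l ⊗ y′ ⊕ ⓪ ⊗ y′) & none) h h′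
    open Combines (proportional multiple)
    det≡0 : ∀ c → k * det c p₁ p₂ q₁ q₂ ≡ 0#
    det≡0 ∞         = pair first first‾
    det≡0 (G _ _)   = pair second second‾
    det≡0 (H _ _ _) = pair first second

  -- Together with 1 a basis over 𝔽_q; it provides second points on lines and an element of trace 1.
  θ : F
  θ = proj₁ conj-nontrivial

  θ-θ̄≢0 : θ - conj θ ≢ 0#
  θ-θ̄≢0 e = proj₂ conj-nontrivial (sym (minus≡0⇒≡ e))

  abstract
    -- Conjugation sends 1 + ν^q to 1 + ν = ν (1 + ν^q). This fails to be useful only for ν = -1,
    -- where θ - θ^q, which conjugation negates, is taken instead.
    hilbert90 : ∀ ν → ν ∈ 𝒰 → ∃[ κ ] κ ≢ 0# × conj κ ≡ ν * κ
    hilbert90 ν νν̄≡1 with (1# + conj ν) ≟ 0#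
    ... | no 1+ν̄≢0 = 1# + conj ν , 1+ν̄≢0 , deduce (ν ∷ []) (λ ν →
        (① ⊕ ν ‾) ‾ ≋ ν ⊗ (① ⊕ ν ‾) ⇐ ⊝ ① ∙ (ν ⊗ ν ‾ ≋ ①) & none) νν̄≡1
    ... | yes 1+ν̄≡0 = θ - conj θ , θ-θ̄≢0 , deduce (ν ∷ θ ∷ []) (λ ν θ →
        (θ ⊖ θ ‾) ‾ ≋ ν ⊗ (θ ⊖ θ ‾) ⇐ ⊝ (θ ⊖ θ ‾) ∙ ((① ⊕ ν ‾) ‾ ≋ ⓪ ‾) & none) (cong conj 1+ν̄≡0)

  -- The equations z^q = ν z and y^q = μ y have nonzero solutions only for `ν` and `μ` of norm 1.
  -- `1# ≡ 1#` stands for truth, as `0# ≡ 1#` does for falsity in the families of codes below.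
  IsLineCode : Code → Set
  IsLineCode ∞         = 1# ≡ 1#
  IsLineCode (G e g)   = 1# ≡ 1#
  IsLineCode (H ν a μ) = ν ∈ 𝒰 × μ ∈ 𝒰

  θ≢0 : θ ≢ 0#
  θ≢0 e = θ-θ̄≢0 (deduce (θ ∷ []) (λ θ → θ ⊖ θ ‾ ≋ ⓪ ⇐ ① ∙ (θ ≋ ⓪) & ⊝ ① ∙ (θ ‾ ≋ ⓪ ‾) & none) e (cong conj e))

  H-point₁ : ∀ {ν κ} a μ → conj κ ≡ ν * κ → On (H ν a μ) κ 0#
  H-point₁ {ν} {κ} a μ e =
      deduce (κ ∷ a ∷ ν ∷ []) (λ κ a ν → (κ ⊖ a ⊗ ⓪) ‾ ≋ ν ⊗ (κ ⊖ a ⊗ ⓪) ⇐ ① ∙ (κ ‾ ≋ ν ⊗ κ) & none) e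
    , deduce (μ ∷ []) (λ μ → ⓪ ‾ ≋ μ ⊗ ⓪ ⇐ none)

  H-point₂ : ∀ {μ y} ν a → conj y ≡ μ * y → On (H ν a μ) (a * y) y
  H-point₂ {μ} {y} ν a e =
    deduce (y ∷ a ∷ ν ∷ []) (λ y a ν → (a ⊗ y ⊖ a ⊗ y) ‾ ≋ ν ⊗ (a ⊗ y ⊖ a ⊗ y) ⇐ none) , e

  locus-isLine : ∀ c → IsLineCode c → IsLineOf Ση (Locus c)
  locus-isLine c ok with spanning c ok
    where
    θ-θ̄≡0 : 1# * conj θ - conj 1# * θ ≡ 0# → θ - conj θ ≡ 0#
    θ-θ̄≡0 = deduce (θ ∷ []) (λ θ → θ ⊖ θ ‾ ≋ ⓪ ⇐ ⊝ ① ∙ (① ⊗ θ ‾ ⊖ ① ‾ ⊗ θ ≋ ⓪) & none)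
    spanning : ∀ c → IsLineCode c → ∃₂ λ p₁ p₂ → ∃₂ λ q₁ q₂ → NonZeroPair p₁ p₂ × NonZeroPair q₁ q₂ ×
      On c p₁ p₂ × On c q₁ q₂ × det c p₁ p₂ q₁ q₂ ≢ 0#
    spanning ∞ _ = 1# , 0# , θ , 0# , 1≢0 ∘ proj₁ , θ≢0 ∘ proj₁ , refl , refl , θ-θ̄≢0 ∘ θ-θ̄≡0
    spanning (G e g) _ = e * 1# + g * conj 1# , 1# , e * θ + g * conj θ , θ
      , 1≢0 ∘ proj₂ , θ≢0 ∘ proj₂ , refl , refl , θ-θ̄≢0 ∘ θ-θ̄≡0
    spanning (H ν a μ) (ν∈𝒰 , μ∈𝒰) with hilbert90 ν ν∈𝒰 | hilbert90 μ μ∈𝒰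
    ... | κ , κ≢0 , κ̄≡νκ | y , y≢0 , ȳ≡μy = κ , 0# , a * y , y , κ≢0 ∘ proj₁ , y≢0 ∘ proj₂
      , H-point₁ a μ κ̄≡νκ , H-point₂ ν a ȳ≡μy
      , λ e → *-nonzero κ≢0 y≢0 (deduce (κ ∷ y ∷ a ∷ []) (λ κ y a → κ ⊗ y ≋ ⓪ ⇐ ① ∙ (κ ⊗ y ⊖ ⓪ ⊗ (a ⊗ y) ≋ ⓪) & none) e)
  ... | p₁ , p₂ , q₁ , q₂ , p≢0 , q≢0 , hp , hq , Δ≢0 =
    baer-point p₁ p₂ p≢0 , baer-point q₁ q₂ q≢0 , baer-point∈Ση p₁ p₂ p≢0 , baer-point∈Ση q₁ q₂ q≢0
    , det≢0⇒distinct c {baer-point p₁ p₂ p≢0} {baer-point q₁ q₂ q≢0} 1≢0 (1· _) (1· _) Δ≢0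
    , ≐-sym locus
    where
    locus = baer-line≐locus c {baer-point p₁ p₂ p≢0} {baer-point q₁ q₂ q≢0} 1≢0 1≢0 (1· _) (1· _) hp hq Δ≢0

  ·-assoc : ∀ k l v → (k * l) · v ≡ k · (l · v)
  ·-assoc k l (_ ∷ _ ∷ _ ∷ _ ∷ []) = vec-≡ (*-assoc k l _) (*-assoc k l _) (*-assoc k l _) (*-assoc k l _)

  ≈-sym : ∀ {P Q} → P ≈ Q → Q ≈ P
  ≈-sym {P} {Q} (c , c≢0 , e) with inverse c c≢0
  ... | d , cd≡1 = d , (λ { refl → 0≢1 (trans (sym (zeroʳ c)) cd≡1) }) , (begin
    coords Q              ≡⟨ 1· (coords Q) ⟩
    1# · coords Q         ≡⟨ cong (_· coords Q) (trans (*-comm d c) cd≡1) ⟨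
    (d * c) · coords Q    ≡⟨ ·-assoc d c (coords Q) ⟩
    d · (c · coords Q)    ≡⟨ cong (d ·_) e ⟨
    d · coords P          ∎)
    where open ≡-Reasoning

  proportional⇒≈ : ∀ {P Q k l p₁ p₂ q₁ q₂} t → k ≢ 0# → l ≢ 0# → NonZeroPair p₁ p₂ →
    coords P ≡ k · baer p₁ p₂ → coords Q ≡ l · baer q₁ q₂ →
    conj t ≡ t → p₁ ≡ t * q₁ → p₂ ≡ t * q₂ → P ≈ Q
  proportional⇒≈ {P} {Q} {k} {l} {p₁} {p₂} {q₁} {q₂} t k≢0 l≢0 p≢0 eP eQ t̄≡t e₁ e₂ with inverse l l≢0
  ... | l⁻¹ , ll⁻¹≡1 = k * t * l⁻¹ , *-nonzero (*-nonzero k≢0 t≢0) l⁻¹≢0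
    , trans eP (trans (vec-≡ (scale e₁) (scale e₂) (scale (scale-η e₁)) (scale (scale-η e₂))) (cong ((k * t * l⁻¹) ·_) (sym eQ)))
    where
    t≢0 : t ≢ 0#
    t≢0 refl = p≢0 (trans e₁ (zeroˡ _) , trans e₂ (zeroˡ _))
    l⁻¹≢0 : l⁻¹ ≢ 0#
    l⁻¹≢0 refl = 0≢1 (trans (sym (zeroʳ l)) ll⁻¹≡1)
    scale : ∀ {x y} → x ≡ t * y → k * x ≡ k * t * l⁻¹ * (l * y)
    scale {x} {y} e = deduce (k ∷ x ∷ t ∷ l⁻¹ ∷ l ∷ y ∷ []) (λ k x t l⁻¹ l y →
      k ⊗ x ≋ k ⊗ t ⊗ l⁻¹ ⊗ (l ⊗ y) ⇐ k ∙ (x ≋ t ⊗ y) & ⊝ (k ⊗ t ⊗ y) ∙ (l ⊗ l⁻¹ ≋ ①) & none) e ll⁻¹≡1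
    scale-η : ∀ {x y} → x ≡ t * y → η * conj x ≡ t * (η * conj y)
    scale-η {x} {y} e = deduce (η ∷ x ∷ t ∷ y ∷ []) (λ η x t y →
      η ⊗ x ‾ ≋ t ⊗ (η ⊗ y ‾) ⇐ η ∙ (x ‾ ≋ (t ⊗ y) ‾) & η ⊗ y ‾ ∙ (t ‾ ≋ t) & none) (cong conj e) t̄≡t

  quotient∈𝒰 : ∀ {x y} → x * y ≡ 1# → conj x * y ∈ 𝒰
  quotient∈𝒰 {x} {y} e = deduce (x ∷ y ∷ []) (λ x y →
    x ‾ ⊗ y ⊗ (x ‾ ⊗ y) ‾ ≋ ① ⇐ x ‾ ⊗ y ‾ ∙ (x ⊗ y ≋ ①) & ① ∙ ((x ⊗ y) ‾ ≋ ① ‾) & none) e (cong conj e)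

  conj-quotient : ∀ {x i} → x * i ≡ 1# → conj x ≡ conj x * i * x
  conj-quotient {x} {i} = deduce (x ∷ i ∷ []) (λ x i → x ‾ ≋ x ‾ ⊗ i ⊗ x ⇐ ⊝ (x ‾) ∙ (x ⊗ i ≋ ①) & none)

  -- The vanishing determinant expresses dependence of `p` and `r` over 𝔽_q.
  real-quotient : ∀ {p r i} → p * i ≡ 1# → p * conj r - conj p * r ≡ 0# → conj (r * i) ≡ r * i
  real-quotient {p} {r} {i} pi≡1 e = deduce (p ∷ r ∷ i ∷ []) (λ p r i → (r ⊗ i) ‾ ≋ r ⊗ i ⇐
    i ⊗ i ‾ ∙ (p ⊗ r ‾ ⊖ p ‾ ⊗ r ≋ ⓪) & ⊝ (r ‾ ⊗ i ‾) ∙ (p ⊗ i ≋ ①) & r ⊗ i ∙ ((p ⊗ i) ‾ ≋ ① ‾) & none)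
    e pi≡1 (cong conj pi≡1)

  -- Every line of Σ_η has a code.

  record BaerVector (P : Point) : Set where
    constructor baer-vector
    field
      {x y}   : F
      nonzero : NonZeroPair x y
      {scale} : F
      scale≢0 : scale ≢ 0#
      coords≡ : coords P ≡ scale · baer x y

  CodedLine : PointSet → Set
  CodedLine L = ∃[ c ] IsLineCode c × L ≐ Locus c

  join-real : ∀ {P Q} (bP : BaerVector P) (bQ : BaerVector Q) → ¬ Q ≈ P →
    let open BaerVector in y bP ≡ 0# → y bQ ≡ 0# → CodedLine (⟨ P , Q ⟩ ∩ Ση)
  join-real {P} {Q} (baer-vector {p₁} {p₂} p≢0 k≢0 eP) (baer-vector {q₁} {q₂} q≢0 l≢0 eQ) Q≉P p₂≡0 q₂≡0 =
    ∞ , refl , baer-line≐locus ∞ {P} {Q} k≢0 l≢0 eP eQ p₂≡0 q₂≡0 Δ≢0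
    where
    Δ≢0 : det ∞ p₁ p₂ q₁ q₂ ≢ 0#
    Δ≢0 Δ≡0 with inverse p₁ (λ p₁≡0 → p≢0 (p₁≡0 , p₂≡0))
    ... | i , p₁i≡1 = Q≉P (proportional⇒≈ {Q} {P} (q₁ * i) l≢0 k≢0 q≢0 eQ eP (real-quotient p₁i≡1 Δ≡0)
      (deduce (p₁ ∷ q₁ ∷ i ∷ []) (λ p₁ q₁ i → q₁ ≋ q₁ ⊗ i ⊗ p₁ ⇐ ⊝ q₁ ∙ (p₁ ⊗ i ≋ ①) & none) p₁i≡1)
      (deduce (p₂ ∷ q₂ ∷ q₁ ∷ i ∷ []) (λ p₂ q₂ q₁ i → q₂ ≋ q₁ ⊗ i ⊗ p₂ ⇐ ① ∙ (q₂ ≋ ⓪) & ⊝ (q₁ ⊗ i) ∙ (p₂ ≋ ⓪) & none) q₂≡0 p₂≡0))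

  -- The second coordinates are dependent over 𝔽_q, so they share the quotient μ = y^q / y.
  -- Subtracting from Q the multiple of P with the same second coordinate gives the point (κ , 0) on
  -- y = 0, which yields `ν`; the slope p₁ / p₂ of P serves as `a`.
  join-meeting : ∀ {P Q} (bP : BaerVector P) (bQ : BaerVector Q) → ¬ Q ≈ P →
    let open BaerVector in y bP ≢ 0# → y bP * conj (y bQ) - conj (y bP) * y bQ ≡ 0# → CodedLine (⟨ P , Q ⟩ ∩ Ση)
  join-meeting {P} {Q} (baer-vector {p₁} {p₂} p≢0 k≢0 eP) (baer-vector {q₁} {q₂} q≢0 l≢0 eQ) Q≉P p₂≢0 Δ≡0 =
    build (inverse p₂ p₂≢0)
    where
    build : ∃[ i ] p₂ * i ≡ 1# → CodedLine (⟨ P , Q ⟩ ∩ Ση)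
    build (i , p₂i≡1) = build′ (inverse κ κ≢0)
      where
      a μ κ : F
      a = p₁ * i
      μ = conj p₂ * i
      κ = q₁ - a * q₂
      κ≢0 : κ ≢ 0#
      κ≢0 κ≡0 = Q≉P (proportional⇒≈ {Q} {P} (q₂ * i) l≢0 k≢0 q≢0 eQ eP (real-quotient p₂i≡1 Δ≡0)
        (deduce (p₁ ∷ q₁ ∷ q₂ ∷ i ∷ []) (λ p₁ q₁ q₂ i → q₁ ≋ q₂ ⊗ i ⊗ p₁ ⇐ ① ∙ (q₁ ⊖ p₁ ⊗ i ⊗ q₂ ≋ ⓪) & none) κ≡0)
        (deduce (p₂ ∷ q₂ ∷ i ∷ []) (λ p₂ q₂ i → q₂ ≋ q₂ ⊗ i ⊗ p₂ ⇐ ⊝ q₂ ∙ (p₂ ⊗ i ≋ ①) & none) p₂i≡1))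
      build′ : ∃[ j ] κ * j ≡ 1# → CodedLine (⟨ P , Q ⟩ ∩ Ση)
      build′ (j , κj≡1) = H ν a μ , (quotient∈𝒰 κj≡1 , quotient∈𝒰 p₂i≡1)
        , baer-line≐locus (H ν a μ) {P} {Q} k≢0 l≢0 eP eQ (onP , onP′) (onQ , onQ′) detPQ≢0
        where
        ν : F
        ν = conj κ * j
        onP : conj (p₁ - a * p₂) ≡ ν * (p₁ - a * p₂)
        onP = deduce (p₁ ∷ p₂ ∷ i ∷ ν ∷ []) (λ p₁ p₂ i ν →
          (p₁ ⊖ p₁ ⊗ i ⊗ p₂) ‾ ≋ ν ⊗ (p₁ ⊖ p₁ ⊗ i ⊗ p₂) ⇐
            ⊝ (p₁ ‾) ∙ ((p₂ ⊗ i) ‾ ≋ ① ‾) & ν ⊗ p₁ ∙ (p₂ ⊗ i ≋ ①) & none) (cong conj p₂i≡1) p₂i≡1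
        onP′ : conj p₂ ≡ μ * p₂
        onP′ = conj-quotient p₂i≡1
        onQ : conj κ ≡ ν * κ
        onQ = conj-quotient κj≡1
        onQ′ : conj q₂ ≡ μ * q₂
        onQ′ = deduce (p₂ ∷ q₂ ∷ i ∷ []) (λ p₂ q₂ i → q₂ ‾ ≋ p₂ ‾ ⊗ i ⊗ q₂ ⇐
          ⊝ (q₂ ‾) ∙ (p₂ ⊗ i ≋ ①) & i ∙ (p₂ ⊗ q₂ ‾ ⊖ p₂ ‾ ⊗ q₂ ≋ ⓪) & none) p₂i≡1 Δ≡0
        detPQ≢0 : p₁ * q₂ - p₂ * q₁ ≢ 0#
        detPQ≢0 e = *-nonzero p₂≢0 κ≢0 (deduce (p₁ ∷ p₂ ∷ q₁ ∷ q₂ ∷ i ∷ []) (λ p₁ p₂ q₁ q₂ i →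
          p₂ ⊗ (q₁ ⊖ p₁ ⊗ i ⊗ q₂) ≋ ⓪ ⇐ ⊝ ① ∙ (p₁ ⊗ q₂ ⊖ p₂ ⊗ q₁ ≋ ⓪) & ⊝ (p₁ ⊗ q₂) ∙ (p₂ ⊗ i ≋ ①) & none) e p₂i≡1)

  -- Independent second coordinates make x an 𝔽_q-linear function of y, and such functions have the
  -- form e y + g y^q; the two points determine `e` and `g`.
  join-skew : ∀ {P Q} (bP : BaerVector P) (bQ : BaerVector Q) →
    let open BaerVector in y bP * conj (y bQ) - conj (y bP) * y bQ ≢ 0# → CodedLine (⟨ P , Q ⟩ ∩ Ση)
  join-skew {P} {Q} (baer-vector {p₁} {p₂} p≢0 k≢0 eP) (baer-vector {q₁} {q₂} q≢0 l≢0 eQ) Δ≢0 =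
    let e , g , e₁ , e₂ = cramer p₁ q₁ Δ′≢0
    in G e g , refl , baer-line≐locus (G e g) {P} {Q} k≢0 l≢0 eP eQ e₁ e₂ Δ≢0
    where
    Δ′≢0 : p₂ * conj q₂ - q₂ * conj p₂ ≢ 0#
    Δ′≢0 = Δ≢0 ∘ trans (cong (λ z → p₂ * conj q₂ - z) (*-comm (conj p₂) q₂))

  ≐-∩-join-swap : ∀ {P Q} → ⟨ Q , P ⟩ ∩ Ση ≐ ⟨ P , Q ⟩ ∩ Ση
  ≐-∩-join-swap = (λ { (s , b) → span-swap s , b }) , (λ { (s , b) → span-swap s , b })

  -- The determinant tested first vanishes exactly if the second coordinates are dependent over 𝔽_q,
  -- that is, if the line meets y = 0.
  classification : ∀ L → IsLineOf Ση L → CodedLine L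
  classification L (P , Q , (p₁ , p₂ , p≢0 , k , k≢0 , eP) , (q₁ , q₂ , q≢0 , l , l≢0 , eQ) , P≉Q , L≐PQ) =
    let c , ok , PQ≐c = join in c , ok , ≐-trans L≐PQ PQ≐c
    where
    bP = baer-vector p≢0 k≢0 eP
    bQ = baer-vector q≢0 l≢0 eQ
    join : CodedLine (⟨ P , Q ⟩ ∩ Ση)
    join with (p₂ * conj q₂ - conj p₂ * q₂) ≟ 0# | p₂ ≟ 0# | q₂ ≟ 0#
    ... | no Δ≢0  | _        | _        = join-skew {P} {Q} bP bQ Δ≢0
    ... | yes Δ≡0 | no p₂≢0  | _        = join-meeting {P} {Q} bP bQ (P≉Q ∘ ≈-sym {Q} {P}) p₂≢0 Δ≡0
    ... | yes _   | yes p₂≡0 | yes q₂≡0 = join-real {P} {Q} bP bQ (P≉Q ∘ ≈-sym {Q} {P}) p₂≡0 q₂≡0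
    ... | yes Δ≡0 | yes _    | no q₂≢0  =
      let c , ok , QP≐c = join-meeting {Q} {P} bQ bP P≉Q q₂≢0 (deduce (p₂ ∷ q₂ ∷ []) (λ p₂ q₂ →
                            q₂ ⊗ p₂ ‾ ⊖ q₂ ‾ ⊗ p₂ ≋ ⓪ ⇐ ⊝ ① ∙ (p₂ ⊗ q₂ ‾ ⊖ p₂ ‾ ⊗ q₂ ≋ ⓪) & none) Δ≡0)
      in c , ok , ≐-trans (≐-∩-join-swap {Q} {P}) QP≐c

  -- How far a line determines its code.

  ∞⋢G : ∀ {e g} → ¬ (∞ ⊑ G e g)
  ∞⋢G {e} {g} c⊑c′ = 1≢0 (deduce (e ∷ g ∷ []) (λ e g → ① ≋ ⓪ ⇐ ① ∙ (① ≋ e ⊗ ⓪ ⊕ g ⊗ ⓪ ‾) & none)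
    (⊑⇒on {∞} {G e g} c⊑c′ (1≢0 ∘ proj₁) refl))

  H⋢G : ∀ {ν a μ e g} → ν ∈ 𝒰 → ¬ (H ν a μ ⊑ G e g)
  H⋢G {ν} {a} {μ} {e} {g} ν∈𝒰 c⊑c′ =
    let κ , κ≢0 , κ̄≡νκ = hilbert90 ν ν∈𝒰
    in κ≢0 (deduce (κ ∷ e ∷ g ∷ []) (λ κ e g → κ ≋ ⓪ ⇐ ① ∙ (κ ≋ e ⊗ ⓪ ⊕ g ⊗ ⓪ ‾) & none)
         (⊑⇒on {H ν a μ} {G e g} c⊑c′ (κ≢0 ∘ proj₁) (H-point₁ a μ κ̄≡νκ)))

  H⋢∞ : ∀ {ν a μ} → μ ∈ 𝒰 → ¬ (H ν a μ ⊑ ∞)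
  H⋢∞ {ν} {a} {μ} μ∈𝒰 c⊑c′ =
    let y , y≢0 , ȳ≡μy = hilbert90 μ μ∈𝒰
    in y≢0 (⊑⇒on {H ν a μ} {∞} c⊑c′ (y≢0 ∘ proj₂) (H-point₂ ν a ȳ≡μy))

  -- The values at y = 1 and y = θ separate the coefficients of y and y^q.
  G-injective : ∀ {e g e′ g′} → G e g ⊑ G e′ g′ → e ≡ e′ × g ≡ g′
  G-injective {e} {g} {e′} {g′} c⊑c′ = e≡e′ , g≡g′
    where
    at : ∀ y → y ≢ 0# → e * y + g * conj y ≡ e′ * y + g′ * conj y
    at y y≢0 = ⊑⇒on {G e g} {G e′ g′} c⊑c′ (y≢0 ∘ proj₂) refl
    g≡g′ : g ≡ g′
    g≡g′ = *-cancelˡ-≡ θ-θ̄≢0 (deduce (e ∷ g ∷ e′ ∷ g′ ∷ θ ∷ []) (λ e g e′ g′ θ →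
      (θ ⊖ θ ‾) ⊗ g ≋ (θ ⊖ θ ‾) ⊗ g′ ⇐ θ ∙ (e ⊗ ① ⊕ g ⊗ ① ‾ ≋ e′ ⊗ ① ⊕ g′ ⊗ ① ‾)
      & ⊝ ① ∙ (e ⊗ θ ⊕ g ⊗ θ ‾ ≋ e′ ⊗ θ ⊕ g′ ⊗ θ ‾) & none) (at 1# 1≢0) (at θ θ≢0))
    e≡e′ : e ≡ e′
    e≡e′ = deduce (e ∷ g ∷ e′ ∷ g′ ∷ []) (λ e g e′ g′ →
      e ≋ e′ ⇐ ① ∙ (e ⊗ ① ⊕ g ⊗ ① ‾ ≋ e′ ⊗ ① ⊕ g′ ⊗ ① ‾) & ⊝ ① ∙ (g ≋ g′) & none) (at 1# 1≢0) g≡g′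

  H-injective : ∀ {ν a μ ν′ a′ μ′} → ν ∈ 𝒰 → μ ∈ 𝒰 → H ν a μ ⊑ H ν′ a′ μ′ →
    ν ≡ ν′ × μ ≡ μ′ × conj (a - a′) * μ ≡ ν * (a - a′)
  H-injective {ν} {a} {μ} {ν′} {a′} {μ′} ν∈𝒰 μ∈𝒰 c⊑c′ with hilbert90 ν ν∈𝒰 | hilbert90 μ μ∈𝒰
  ... | κ , κ≢0 , κ̄≡νκ | y , y≢0 , ȳ≡μy = ν≡ν′ , μ≡μ′ , *-cancelˡ-≡ y≢0
      (deduce (ν ∷ ν′ ∷ a ∷ a′ ∷ μ ∷ y ∷ []) (λ ν ν′ a a′ μ y →
        y ⊗ ((a ⊖ a′) ‾ ⊗ μ) ≋ y ⊗ (ν ⊗ (a ⊖ a′)) ⇐ ① ∙ ((a ⊗ y ⊖ a′ ⊗ y) ‾ ≋ ν′ ⊗ (a ⊗ y ⊖ a′ ⊗ y))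
        & ⊝ ((a ⊖ a′) ‾) ∙ (y ‾ ≋ μ ⊗ y) & ⊝ ((a ⊖ a′) ⊗ y) ∙ (ν ≋ ν′) & none) (proj₁ on₂) ȳ≡μy ν≡ν′)
    where
    on₁ : On (H ν′ a′ μ′) κ 0#
    on₁ = ⊑⇒on {H ν a μ} {H ν′ a′ μ′} c⊑c′ (κ≢0 ∘ proj₁) (H-point₁ a μ κ̄≡νκ)
    on₂ : On (H ν′ a′ μ′) (a * y) y
    on₂ = ⊑⇒on {H ν a μ} {H ν′ a′ μ′} c⊑c′ (y≢0 ∘ proj₂) (H-point₂ ν a ȳ≡μy)
    ν≡ν′ : ν ≡ ν′
    ν≡ν′ = *-cancelˡ-≡ κ≢0 (deduce (κ ∷ ν ∷ ν′ ∷ a′ ∷ []) (λ κ ν ν′ a′ → κ ⊗ ν ≋ κ ⊗ ν′ ⇐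
      ① ∙ ((κ ⊖ a′ ⊗ ⓪) ‾ ≋ ν′ ⊗ (κ ⊖ a′ ⊗ ⓪)) & ⊝ ① ∙ (κ ‾ ≋ ν ⊗ κ) & none) (proj₁ on₁) κ̄≡νκ)
    μ≡μ′ : μ ≡ μ′
    μ≡μ′ = *-cancelˡ-≡ y≢0 (deduce (y ∷ μ ∷ μ′ ∷ []) (λ y μ μ′ → y ⊗ μ ≋ y ⊗ μ′ ⇐
      ① ∙ (y ‾ ≋ μ′ ⊗ y) & ⊝ ① ∙ (y ‾ ≋ μ ⊗ y) & none) (proj₂ on₂) ȳ≡μy)

  -- On Σ_η the coordinate X₄ is η y^q, so x = e y + g y^q extends to X₁ = e X₂ + g η^q X₄. The two
  -- hypotheses say that P and its image satisfy this equation, and the determinant is their minor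
  -- in the second and fourth coordinates.
  join-τ≐G : ∀ {e g} P T → coords T ≡ τⱽ η (coords P) →
    let X₁ = x₁ (coords P); X₂ = x₂ (coords P); X₃ = x₃ (coords P); X₄ = x₄ (coords P) in
    X₂ * conj X₂ - X₄ * conj X₄ ≢ 0# →
    X₁ ≡ e * X₂ + g * (conj η * X₄) → conj X₃ ≡ e * conj X₄ + g * (conj η * conj X₂) →
    ⟨ P , T ⟩ ∩ Ση ≐ Locus (G e g)
  join-τ≐G {e} {g} P@(point (X₁ ∷ X₂ ∷ X₃ ∷ X₄ ∷ []) _) T eT Δ≢0 h₁ h₂ = join≐locus (G e g) P T
    (λ k≢0 span → span⇒on k≢0 (subst (λ B → Span (coords P) B _) eT span))
    (λ on → subst (λ B → Span (coords P) B _) (sym eT) (on⇒span on))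
    where
    span⇒on : ∀ {k x y} → k ≢ 0# → Span (coords P) (τⱽ η (coords P)) (k · baer x y) → On (G e g) x y
    span⇒on {k} {x} {y} k≢0 (a , b , eq) = *-cancelˡ-≡ k≢0 (deduce
      (k ∷ x ∷ y ∷ a ∷ b ∷ X₁ ∷ X₂ ∷ X₃ ∷ X₄ ∷ e ∷ g ∷ η ∷ []) (λ k x y a b X₁ X₂ X₃ X₄ e g η →
      k ⊗ x ≋ k ⊗ (e ⊗ y ⊕ g ⊗ y ‾) ⇐
        ① ∙ (k ⊗ x ≋ a ⊗ X₁ ⊕ b ⊗ X₃ ‾)
      & ⊝ e ∙ (k ⊗ y ≋ a ⊗ X₂ ⊕ b ⊗ X₄ ‾)
      & ⊝ (g ⊗ η ‾) ∙ (k ⊗ (η ⊗ y ‾) ≋ a ⊗ X₄ ⊕ b ⊗ (η ⊗ η ‾ ⊗ X₂ ‾))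
      & a ∙ (X₁ ≋ e ⊗ X₂ ⊕ g ⊗ (η ‾ ⊗ X₄))
      & b ∙ (X₃ ‾ ≋ e ⊗ X₄ ‾ ⊕ g ⊗ (η ‾ ⊗ X₂ ‾))
      & g ⊗ k ⊗ y ‾ ⊖ b ⊗ g ⊗ η ‾ ⊗ X₂ ‾ ∙ (η ⊗ η ‾ ≋ ①) & none)
      (cong x₁ eq) (cong x₂ eq) (cong x₄ eq) h₁ h₂ η∈𝒰)
    on⇒span : ∀ {x y} → On (G e g) x y → Span (coords P) (τⱽ η (coords P)) (baer x y)
    on⇒span {x} {y} hx =
      let a , b , c₁ , c₂ = cramer y (η * conj y) Δ≢0
      in a , b , vec-≡ (first a b c₁ c₂) c₁ (third a b c₁ c₂) (fourth a b c₂)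
      where
      first : ∀ a b → y ≡ a * X₂ + b * conj X₄ → η * conj y ≡ a * X₄ + b * conj X₂ → x ≡ a * X₁ + b * conj X₃
      first a b c₁ c₂ = deduce
        (x ∷ y ∷ a ∷ b ∷ X₁ ∷ X₂ ∷ X₃ ∷ X₄ ∷ e ∷ g ∷ η ∷ []) (λ x y a b X₁ X₂ X₃ X₄ e g η →
        x ≋ a ⊗ X₁ ⊕ b ⊗ X₃ ‾ ⇐
          ① ∙ (x ≋ e ⊗ y ⊕ g ⊗ y ‾)
        & e ∙ (y ≋ a ⊗ X₂ ⊕ b ⊗ X₄ ‾)
        & g ⊗ η ‾ ∙ (η ⊗ y ‾ ≋ a ⊗ X₄ ⊕ b ⊗ X₂ ‾)
        & ⊝ a ∙ (X₁ ≋ e ⊗ X₂ ⊕ g ⊗ (η ‾ ⊗ X₄))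
        & ⊝ b ∙ (X₃ ‾ ≋ e ⊗ X₄ ‾ ⊕ g ⊗ (η ‾ ⊗ X₂ ‾))
        & ⊝ (g ⊗ y ‾) ∙ (η ⊗ η ‾ ≋ ①) & none)
        hx c₁ c₂ h₁ h₂ η∈𝒰
      third : ∀ a b → y ≡ a * X₂ + b * conj X₄ → η * conj y ≡ a * X₄ + b * conj X₂ →
        η * conj x ≡ a * X₃ + b * (η * conj η * conj X₁)
      third a b c₁ c₂ = deduce
        (x ∷ y ∷ a ∷ b ∷ X₁ ∷ X₂ ∷ X₃ ∷ X₄ ∷ e ∷ g ∷ η ∷ []) (λ x y a b X₁ X₂ X₃ X₄ e g η →
        η ⊗ x ‾ ≋ a ⊗ X₃ ⊕ b ⊗ (η ⊗ η ‾ ⊗ X₁ ‾) ⇐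
          η ∙ (x ‾ ≋ (e ⊗ y ⊕ g ⊗ y ‾) ‾)
        & η ⊗ g ‾ ∙ (y ≋ a ⊗ X₂ ⊕ b ⊗ X₄ ‾)
        & e ‾ ∙ (η ⊗ y ‾ ≋ a ⊗ X₄ ⊕ b ⊗ X₂ ‾)
        & ⊝ b ∙ (X₁ ‾ ≋ (e ⊗ X₂ ⊕ g ⊗ (η ‾ ⊗ X₄)) ‾)
        & ⊝ a ∙ (X₃ ‾ ‾ ≋ (e ⊗ X₄ ‾ ⊕ g ⊗ (η ‾ ⊗ X₂ ‾)) ‾)
        & ⊝ (b ⊗ X₁ ‾) ∙ (η ⊗ η ‾ ≋ ①) & none)
        (cong conj hx) c₁ c₂ (cong conj h₁) (cong conj h₂) η∈𝒰
      fourth : ∀ a b → η * conj y ≡ a * X₄ + b * conj X₂ → η * conj y ≡ a * X₄ + b * (η * conj η * conj X₂)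
      fourth a b c₂ = deduce (y ∷ a ∷ b ∷ X₂ ∷ X₄ ∷ η ∷ []) (λ y a b X₂ X₄ η →
        η ⊗ y ‾ ≋ a ⊗ X₄ ⊕ b ⊗ (η ⊗ η ‾ ⊗ X₂ ‾) ⇐
          ① ∙ (η ⊗ y ‾ ≋ a ⊗ X₄ ⊕ b ⊗ X₂ ‾) & ⊝ (b ⊗ X₂ ‾) ∙ (η ⊗ η ‾ ≋ ①) & none) c₂ η∈𝒰

  join-τ≐∞ : ∀ P T → coords T ≡ τⱽ η (coords P) →
    let X₁ = x₁ (coords P); X₂ = x₂ (coords P); X₃ = x₃ (coords P); X₄ = x₄ (coords P) in
    X₁ * conj X₁ - X₃ * conj X₃ ≢ 0# → X₂ ≡ 0# → X₄ ≡ 0# → ⟨ P , T ⟩ ∩ Ση ≐ Locus ∞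
  join-τ≐∞ P@(point (X₁ ∷ X₂ ∷ X₃ ∷ X₄ ∷ []) _) T eT Δ≢0 h₂ h₄ = join≐locus ∞ P T
    (λ k≢0 span → span⇒on k≢0 (subst (λ B → Span (coords P) B _) eT span))
    (λ on → subst (λ B → Span (coords P) B _) (sym eT) (on⇒span on))
    where
    span⇒on : ∀ {k x y} → k ≢ 0# → Span (coords P) (τⱽ η (coords P)) (k · baer x y) → y ≡ 0#
    span⇒on {k} {x} {y} k≢0 (a , b , eq) = *-cancelˡ-≡ k≢0 (deduce (k ∷ y ∷ a ∷ b ∷ X₂ ∷ X₄ ∷ []) (λ k y a b X₂ X₄ →
      k ⊗ y ≋ k ⊗ ⓪ ⇐ ① ∙ (k ⊗ y ≋ a ⊗ X₂ ⊕ b ⊗ X₄ ‾) & a ∙ (X₂ ≋ ⓪) & b ∙ (X₄ ‾ ≋ ⓪ ‾) & none)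
      (cong x₂ eq) h₂ (cong conj h₄))
    on⇒span : ∀ {x y} → y ≡ 0# → Span (coords P) (τⱽ η (coords P)) (baer x y)
    on⇒span {x} {y} hy =
      let a , b , c₁ , c₂ = cramer x (η * conj x) Δ≢0
      in a , b , vec-≡ c₁ (second a b) (third a b c₂) (fourth a b)
      where
      second : ∀ a b → y ≡ a * X₂ + b * conj X₄
      second a b = deduce (y ∷ a ∷ b ∷ X₂ ∷ X₄ ∷ []) (λ y a b X₂ X₄ → y ≋ a ⊗ X₂ ⊕ b ⊗ X₄ ‾ ⇐
        ① ∙ (y ≋ ⓪) & ⊝ a ∙ (X₂ ≋ ⓪) & ⊝ b ∙ (X₄ ‾ ≋ ⓪ ‾) & none) hy h₂ (cong conj h₄)
      third : ∀ a b → η * conj x ≡ a * X₃ + b * conj X₁ → η * conj x ≡ a * X₃ + b * (η * conj η * conj X₁)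
      third a b c₂ = deduce (x ∷ a ∷ b ∷ X₁ ∷ X₃ ∷ η ∷ []) (λ x a b X₁ X₃ η →
        η ⊗ x ‾ ≋ a ⊗ X₃ ⊕ b ⊗ (η ⊗ η ‾ ⊗ X₁ ‾) ⇐
          ① ∙ (η ⊗ x ‾ ≋ a ⊗ X₃ ⊕ b ⊗ X₁ ‾) & ⊝ (b ⊗ X₁ ‾) ∙ (η ⊗ η ‾ ≋ ①) & none) c₂ η∈𝒰
      fourth : ∀ a b → η * conj y ≡ a * X₄ + b * (η * conj η * conj X₂)
      fourth a b = deduce (y ∷ a ∷ b ∷ X₂ ∷ X₄ ∷ η ∷ []) (λ y a b X₂ X₄ η →
        η ⊗ y ‾ ≋ a ⊗ X₄ ⊕ b ⊗ (η ⊗ η ‾ ⊗ X₂ ‾) ⇐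
          η ∙ (y ‾ ≋ ⓪ ‾) & ⊝ a ∙ (X₄ ≋ ⓪) & ⊝ (b ⊗ η ⊗ η ‾) ∙ (X₂ ‾ ≋ ⓪ ‾) & none) (cong conj hy) h₄ (cong conj h₂)

  Lines : (Code → Set) → Pred PointSet _
  Lines K L = ∃[ c ] K c × L ≐ Locus c

  SpreadCode : (β γ δ : F) → Code → Set
  SpreadCode β γ δ ∞         = 1# ≡ 1#
  SpreadCode β γ δ (G e g)   = g + γ * e ≡ β * conj e + β * γ * conj g + δ
  SpreadCode β γ δ (H _ _ _) = 0# ≡ 1#

  -- One family for `t₁`, where all coefficients are 0, and for the lines of the pencils.
  Incident : (w₁ w₂ w₃ : F) → PointSet
  Incident w₁ w₂ w₃ P =
    x₃ (coords P) ≡ w₁ * x₁ (coords P) + w₂ * x₂ (coords P) × x₄ (coords P) ≡ w₃ * x₂ (coords P)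

  -- The difference is X X^q (1 - N).
  norm-difference≢0 : ∀ {w N X Z} → w * conj w ≡ N → N ≢ 1# → X ≢ 0# → Z ≡ w * X → X * conj X - Z * conj Z ≢ 0#
  norm-difference≢0 {w} {N} {X} {Z} ww̄≡N N≢1 X≢0 Z≡wX Δ≡0 = N≢1 (*-cancelˡ-≡ (*-nonzero X≢0 (conj-≢0 X≢0))
    (deduce (w ∷ N ∷ X ∷ Z ∷ []) (λ w N X Z → X ⊗ X ‾ ⊗ N ≋ X ⊗ X ‾ ⊗ ① ⇐
      ⊝ ① ∙ (X ⊗ X ‾ ⊖ Z ⊗ Z ‾ ≋ ⓪) & ⊝ (Z ‾) ∙ (Z ≋ w ⊗ X) & ⊝ (w ⊗ X) ∙ (Z ‾ ≋ (w ⊗ X) ‾) & ⊝ (X ⊗ X ‾) ∙ (w ⊗ w ‾ ≋ N) & none)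
      Δ≡0 Z≡wX (cong conj Z≡wX) ww̄≡N))

  module _ {w₁ w₂ w₃ N : F} (w₁w̄₁≡N : w₁ * conj w₁ ≡ N) (w₃w̄₃≡N : w₃ * conj w₃ ≡ N) (N≢1 : N ≢ 1#) where

    private
      K : Code → Set
      K = SpreadCode (η * conj w₁) (η * conj w₃) (η * conj w₂)

    join-τ-code : ∀ P T → coords T ≡ τⱽ η (coords P) → P ∈ Incident w₁ w₂ w₃ → ⟨ P , T ⟩ ∩ Ση ∈ Lines K
    join-τ-code P@(point (X₁ ∷ X₂ ∷ X₃ ∷ X₄ ∷ []) P≢0) T eT (h₃ , h₄) with X₂ ≟ 0#
    ... | yes refl = ∞ , refl , join-τ≐∞ P T eT (norm-difference≢0 w₁w̄₁≡N N≢1 X₁≢0 X₃≡w₁X₁) refl X₄≡0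
      where
      X₃≡w₁X₁ : X₃ ≡ w₁ * X₁
      X₃≡w₁X₁ = trans h₃ (trans (cong (w₁ * X₁ +_) (zeroʳ w₂)) (+-identityʳ _))
      X₄≡0 : X₄ ≡ 0#
      X₄≡0 = trans h₄ (zeroʳ w₃)
      X₁≢0 : X₁ ≢ 0#
      X₁≢0 refl = P≢0 (vec-≡ refl refl (trans X₃≡w₁X₁ (zeroʳ w₁)) X₄≡0)
    ... | no X₂≢0 =
      -- That P and its image both satisfy X₁ = e X₂ + g η^q X₄ is a linear system for `e` and `g`.
      let e , g , h₁ , h₂ = cramer X₁ (conj X₃) Δ′≢0
      in G e g , condition e g h₁ h₂ , join-τ≐G P T eT Δ≢0 h₁ h₂
      where
      Δ≢0 : X₂ * conj X₂ - X₄ * conj X₄ ≢ 0#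
      Δ≢0 = norm-difference≢0 w₃w̄₃≡N N≢1 X₂≢0 h₄
      Δ′≢0 : X₂ * (conj η * conj X₂) - conj X₄ * (conj η * X₄) ≢ 0#
      Δ′≢0 Δ′≡0 = *-nonzero (conj-≢0 η≢0) Δ≢0 (deduce (X₂ ∷ X₄ ∷ η ∷ []) (λ X₂ X₄ η →
        η ‾ ⊗ (X₂ ⊗ X₂ ‾ ⊖ X₄ ⊗ X₄ ‾) ≋ ⓪ ⇐ ① ∙ (X₂ ⊗ (η ‾ ⊗ X₂ ‾) ⊖ X₄ ‾ ⊗ (η ‾ ⊗ X₄) ≋ ⓪) & none) Δ′≡0)
      condition : ∀ e g → X₁ ≡ e * X₂ + g * (conj η * X₄) → conj X₃ ≡ e * conj X₄ + g * (conj η * conj X₂) → K (G e g)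
      condition e g h₁ h₂ = *-cancelˡ-≡ (conj-≢0 X₂≢0) (deduce
        (X₁ ∷ X₂ ∷ X₃ ∷ X₄ ∷ e ∷ g ∷ η ∷ w₁ ∷ w₂ ∷ w₃ ∷ []) (λ X₁ X₂ X₃ X₄ e g η w₁ w₂ w₃ →
        let β = η ⊗ w₁ ‾; γ = η ⊗ w₃ ‾; δ = η ⊗ w₂ ‾ in
        X₂ ‾ ⊗ (g ⊕ γ ⊗ e) ≋ X₂ ‾ ⊗ (β ⊗ e ‾ ⊕ β ⊗ γ ⊗ g ‾ ⊕ δ) ⇐
          β ∙ (X₁ ‾ ≋ (e ⊗ X₂ ⊕ g ⊗ (η ‾ ⊗ X₄)) ‾)
        & ⊝ η ∙ (X₃ ‾ ≋ e ⊗ X₄ ‾ ⊕ g ⊗ (η ‾ ⊗ X₂ ‾))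
        & η ∙ (X₃ ‾ ≋ (w₁ ⊗ X₁ ⊕ w₂ ⊗ X₂) ‾)
        & β ⊗ g ‾ ⊗ η ⊖ e ⊗ η ∙ (X₄ ‾ ≋ (w₃ ⊗ X₂) ‾)
        & ⊝ (g ⊗ X₂ ‾) ∙ (η ⊗ η ‾ ≋ ①) & none)
        (cong conj h₁) h₂ (cong conj h₃) (cong conj h₄) η∈𝒰)

    code-join-τ : ∀ c → K c → ∃[ P ] P ∈ Incident w₁ w₂ w₃ × (∀ T → coords T ≡ τⱽ η (coords P) → ⟨ P , T ⟩ ∩ Ση ≐ Locus c)
    code-join-τ ∞ _ = P , incident , λ T eT →
        join-τ≐∞ P T eT (norm-difference≢0 w₁w̄₁≡N N≢1 1≢0 (sym (*-identityʳ w₁))) refl refl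
      where
      P : Point
      P = point (1# ∷ 0# ∷ w₁ ∷ 0# ∷ []) (1≢0 ∘ cong x₁)
      incident : P ∈ Incident w₁ w₂ w₃
      incident = sym (trans (cong₂ _+_ (*-identityʳ w₁) (zeroʳ w₂)) (+-identityʳ w₁)) , sym (zeroʳ w₃)
    code-join-τ (G e g) cond = P , (refl , sym (*-identityʳ w₃)) , λ T eT →
        join-τ≐G P T eT (norm-difference≢0 w₃w̄₃≡N N≢1 1≢0 (sym (*-identityʳ w₃))) refl h₂
      where
      -- With X₂ = 1 and X₄ = w₃ this puts the point on X₁ = e X₂ + g η^q X₄; `cond` then says the
      -- same of its image under τ_η.
      X₁ = e * 1# + g * (conj η * w₃)
      P : Point
      P = point (X₁ ∷ 1# ∷ w₁ * X₁ + w₂ * 1# ∷ w₃ ∷ []) (1≢0 ∘ cong x₂)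
      h₂ : conj (w₁ * X₁ + w₂ * 1#) ≡ e * conj w₃ + g * (conj η * conj 1#)
      h₂ = *-cancelˡ-≡ η≢0 (deduce (e ∷ g ∷ η ∷ w₁ ∷ w₂ ∷ w₃ ∷ []) (λ e g η w₁ w₂ w₃ →
        let β = η ⊗ w₁ ‾; γ = η ⊗ w₃ ‾; δ = η ⊗ w₂ ‾ in
        η ⊗ (w₁ ⊗ (e ⊗ ① ⊕ g ⊗ (η ‾ ⊗ w₃)) ⊕ w₂ ⊗ ①) ‾ ≋ η ⊗ (e ⊗ w₃ ‾ ⊕ g ⊗ (η ‾ ⊗ ① ‾)) ⇐
          ⊝ ① ∙ (g ⊕ γ ⊗ e ≋ β ⊗ e ‾ ⊕ β ⊗ γ ⊗ g ‾ ⊕ δ) & ⊝ g ∙ (η ⊗ η ‾ ≋ ①) & none) cond η∈𝒰)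
    code-join-τ (H _ _ _) 0≡1 = contradiction 0≡1 0≢1

  -- Switched spreads

  DesarguesianCode : Code → Set
  DesarguesianCode ∞         = 1# ≡ 1#
  DesarguesianCode (G e g)   = g ≡ 0#
  DesarguesianCode (H _ _ _) = 0# ≡ 1#

  -- The slopes of the regulus are the solutions of γ e = β e^q + δ, a coset of the k with β k^q = γ
  -- k. A transversal takes one of them as `a`, and ν β = μ γ makes its freedom in `a` exactly that
  -- group of k.
  SwitchedCode : (β γ δ : F) → Code → Set
  SwitchedCode β γ δ ∞         = 0# ≡ 1#
  SwitchedCode β γ δ (G e g)   = g ≢ 0# × SpreadCode β γ δ (G e g)
  SwitchedCode β γ δ (H ν a μ) = (ν ∈ 𝒰 × μ ∈ 𝒰) × ν * β ≡ μ * γ × γ * a ≡ β * conj a + δ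

  Common : Code → Code → Set
  Common c c′ = ∃₂ λ x y → NonZeroPair x y × On c x y × On c′ x y

  on-both : ∀ c c′ {R} → R ∈ Locus c → R ∈ Locus c′ → Common c c′
  on-both c c′ {R} (x , y , xy≢0 , on , k , k≢0 , e) R∈c′ = x , y , xy≢0 , on , locus⇒on c′ {R} k≢0 e R∈c′

  meeting-codes : ∀ {L M} c c′ → L ≐ Locus c → M ≐ Locus c′ → Meet L M → Common c c′
  meeting-codes c c′ (L⊆c , _) (M⊆c′ , _) (R , R∈L , R∈M) = on-both c c′ {R} (L⊆c {R} R∈L) (M⊆c′ {R} R∈M)

  codes-meet : ∀ {L M} c c′ {x y} → L ≐ Locus c → M ≐ Locus c′ → NonZeroPair x y → On c x y → On c′ x y → Meet L M
  codes-meet c c′ {x} {y} (_ , c⊆L) (_ , c′⊆M) xy≢0 on on′ =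
    P , c⊆L {P} (baer-point∈locus c xy≢0 on) , c′⊆M {P} (baer-point∈locus c′ xy≢0 on′)
    where
    P = baer-point x y xy≢0

  on⇔⇒≐ : ∀ c c′ → (∀ {x y} → On c x y → On c′ x y) → (∀ {x y} → On c′ x y → On c x y) → Locus c ≐ Locus c′
  on⇔⇒≐ c c′ to from = (λ { (x , y , xy≢0 , on , r) → x , y , xy≢0 , to on , r })
                      , (λ { (x , y , xy≢0 , on , r) → x , y , xy≢0 , from on , r })

  isLineOf-resp-≐ : ∀ {L M} → L ≐ M → IsLineOf Ση M → IsLineOf Ση L
  isLineOf-resp-≐ L≐M (P , Q , P∈ , Q∈ , P≉Q , M≐PQ) = P , Q , P∈ , Q∈ , P≉Q , ≐-trans L≐M M≐PQ

  lines-isLineSpread : ∀ {ℓ} {S : Pred PointSet ℓ} (K : Code → Set) → S ≐ Lines K → (∀ c → K c → IsLineCode c) →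
    (∀ x y → NonZeroPair x y → ∃[ c ] K c × On c x y × (∀ c′ → K c′ → On c′ x y → Locus c′ ≐ Locus c)) →
    IsLineSpread Ση S
  lines-isLineSpread {S = S} K (S⊆K , K⊆S) K-line cover = lines , points
    where
    lines : ∀ L → L ∈ S → IsLineOf Ση L
    lines L L∈S = let c , Kc , L≐c = S⊆K {L} L∈S in isLineOf-resp-≐ L≐c (locus-isLine c (K-line c Kc))
    points : ∀ P → P ∈ Ση → ∃[ L ] L ∈ S × P ∈ L × (∀ M → M ∈ S → P ∈ M → M ≐ L)
    points P (x , y , xy≢0 , k , k≢0 , e) =
      let c , Kc , on , unique = cover x y xy≢0
      in Locus c , K⊆S {Locus c} (c , Kc , ≐-refl) , (x , y , xy≢0 , on , k , k≢0 , e)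
       , λ M M∈S P∈M → let c′ , Kc′ , M≐c′ = S⊆K {M} M∈S
                       in ≐-trans M≐c′ (unique c′ Kc′ (locus⇒on c′ {P} k≢0 e (proj₁ M≐c′ {P} P∈M)))

  desarguesian-isLineSpread : ∀ {ℓ} {S : Pred PointSet ℓ} → S ≐ Lines DesarguesianCode → IsLineSpread Ση S
  desarguesian-isLineSpread S≐ = lines-isLineSpread DesarguesianCode S≐ isLine cover
    where
    isLine : ∀ c → DesarguesianCode c → IsLineCode c
    isLine ∞         _   = refl
    isLine (G _ _)   _   = refl
    isLine (H _ _ _) 0≡1 = contradiction 0≡1 0≢1
    cover : ∀ x y → NonZeroPair x y →
      ∃[ c ] DesarguesianCode c × On c x y × (∀ c′ → DesarguesianCode c′ → On c′ x y → Locus c′ ≐ Locus c)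
    cover x y xy≢0 with y ≟ 0#
    ... | yes refl = ∞ , refl , refl , unique
      where
      unique : ∀ c′ → DesarguesianCode c′ → On c′ x 0# → Locus c′ ≐ Locus ∞
      unique ∞         _    _  = ≐-refl
      unique (G e g)   _    on = contradiction
        (deduce (x ∷ e ∷ g ∷ []) (λ x e g → x ≋ ⓪ ⇐ ① ∙ (x ≋ e ⊗ ⓪ ⊕ g ⊗ ⓪ ‾) & none) on) (λ x≡0 → xy≢0 (x≡0 , refl))
      unique (H _ _ _) 0≡1  _  = contradiction 0≡1 0≢1
    ... | no y≢0 = build (inverse y y≢0)
      where
      build : ∃[ i ] y * i ≡ 1# →
        ∃[ c ] DesarguesianCode c × On c x y × (∀ c′ → DesarguesianCode c′ → On c′ x y → Locus c′ ≐ Locus c)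
      build (i , yi≡1) = G (x * i) 0# , refl
        , deduce (x ∷ y ∷ i ∷ []) (λ x y i → x ≋ x ⊗ i ⊗ y ⊕ ⓪ ⊗ y ‾ ⇐ ⊝ x ∙ (y ⊗ i ≋ ①) & none) yi≡1
        , unique
        where
        unique : ∀ c′ → DesarguesianCode c′ → On c′ x y → Locus c′ ≐ Locus (G (x * i) 0#)
        unique ∞         _    y≡0 = contradiction y≡0 y≢0
        unique (G e _)   refl on  = subst (λ e′ → Locus (G e 0#) ≐ Locus (G e′ 0#))
          (deduce (x ∷ y ∷ i ∷ e ∷ []) (λ x y i e → e ≋ x ⊗ i ⇐ ⊝ i ∙ (x ≋ e ⊗ y ⊕ ⓪ ⊗ y ‾) & ⊝ e ∙ (y ⊗ i ≋ ①) & none) on yi≡1)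
          ≐-refl
        unique (H _ _ _) 0≡1  _   = contradiction 0≡1 0≢1

  𝒰-≢0 : ∀ {μ} → μ ∈ 𝒰 → μ ≢ 0#
  𝒰-≢0 μ∈𝒰 refl = 0≢1 (trans (sym (zeroˡ _)) μ∈𝒰)

  𝒰-* : ∀ {μ ν} → μ ∈ 𝒰 → ν ∈ 𝒰 → μ * ν ∈ 𝒰
  𝒰-* {μ} {ν} hμ hν = deduce (μ ∷ ν ∷ []) (λ μ ν → μ ⊗ ν ⊗ (μ ⊗ ν) ‾ ≋ ① ⇐
    ν ⊗ ν ‾ ∙ (μ ⊗ μ ‾ ≋ ①) & ① ∙ (ν ⊗ ν ‾ ≋ ①) & none) hμ hν

  unit-ratio : ∀ {x y i N} → x * conj x ≡ N → y * conj y ≡ N → x * i ≡ 1# → y * i ∈ 𝒰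
  unit-ratio {x} {y} {i} {N} xx̄≡N yȳ≡N xi≡1 = deduce (x ∷ y ∷ i ∷ N ∷ []) (λ x y i N →
    y ⊗ i ⊗ (y ⊗ i) ‾ ≋ ① ⇐ i ⊗ i ‾ ∙ (y ⊗ y ‾ ≋ N) & ⊝ (i ⊗ i ‾) ∙ (x ⊗ x ‾ ≋ N)
    & x ‾ ⊗ i ‾ ∙ (x ⊗ i ≋ ①) & ① ∙ ((x ⊗ i) ‾ ≋ ① ‾) & none) yȳ≡N xx̄≡N xi≡1 (cong conj xi≡1)

  abstract
    -- σ = θ / (θ - θ^q), whose conjugate is -θ^q / (θ - θ^q).
    trace-one : ∃[ σ ] σ + conj σ ≡ 1#
    trace-one = θ * j , *-cancelˡ-≡ θ-θ̄≢0 (deduce (θ ∷ j ∷ []) (λ θ j →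
      let D = θ ⊖ θ ‾ in
      D ⊗ (θ ⊗ j ⊕ (θ ⊗ j) ‾) ≋ D ⊗ ① ⇐ θ ∙ (D ⊗ j ≋ ①) & ⊝ (θ ‾) ∙ ((D ⊗ j) ‾ ≋ ① ‾) & none) Dj≡1 (cong conj Dj≡1))
      where
      j : F
      j = proj₁ (inverse (θ - conj θ) θ-θ̄≢0)
      Dj≡1 : (θ - conj θ) * j ≡ 1#
      Dj≡1 = proj₂ (inverse (θ - conj θ) θ-θ̄≢0)

  -- What the spread of a pencil line provides: `N` is the norm of α, and `trace-zero` is the
  -- condition that singles out the pencil.
  record Admissible (β γ δ N : F) : Set where
    field
      ββ̄≡N : β * conj β ≡ N
      γγ̄≡N : γ * conj γ ≡ N
      N≢1  : N ≢ 1#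
      N≢0  : N ≢ 0#
      trace-zero : β * conj δ + conj γ * δ ≡ 0#

  module _ {β γ δ N : F} (admissible : Admissible β γ δ N) where
    open Admissible admissible

    private
      β≢0 : β ≢ 0#
      β≢0 refl = N≢0 (trans (sym ββ̄≡N) (zeroˡ _))
      γ≢0 : γ ≢ 0#
      γ≢0 refl = N≢0 (trans (sym γγ̄≡N) (zeroˡ _))
      β⁻¹ γ⁻¹ : F
      β⁻¹ = proj₁ (inverse β β≢0)
      γ⁻¹ = proj₁ (inverse γ γ≢0)
      ββ⁻¹≡1 : β * β⁻¹ ≡ 1#
      ββ⁻¹≡1 = proj₂ (inverse β β≢0)
      γγ⁻¹≡1 : γ * γ⁻¹ ≡ 1#
      γγ⁻¹≡1 = proj₂ (inverse γ γ≢0)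

    abstract
      -- For e = σ δ / γ the condition `trace-zero` turns β e^q into -σ^q δ, so γ e - β e^q = (σ +
      -- σ^q) δ = δ.
      slope-exists : ∃[ e ] γ * e ≡ β * conj e + δ
      slope-exists = γ⁻¹ * σ * δ , *-cancelˡ-≡ (conj-≢0 γ≢0) (deduce
        (β ∷ γ ∷ δ ∷ γ⁻¹ ∷ σ ∷ []) (λ β γ δ i σ →
        let s = i ⊗ σ ⊗ δ in
        γ ‾ ⊗ (γ ⊗ s) ≋ γ ‾ ⊗ (β ⊗ s ‾ ⊕ δ) ⇐
          γ ‾ ⊗ σ ⊗ δ ∙ (γ ⊗ i ≋ ①)
        & ⊝ (β ⊗ σ ‾ ⊗ δ ‾) ∙ ((γ ⊗ i) ‾ ≋ ① ‾)
        & γ ‾ ⊗ δ ∙ (σ ⊕ σ ‾ ≋ ①)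
        & ⊝ (σ ‾) ∙ (β ⊗ δ ‾ ⊕ γ ‾ ⊗ δ ≋ ⓪) & none)
        γγ⁻¹≡1 (cong conj γγ⁻¹≡1) (proj₂ trace-one) trace-zero)
        where
        σ : F
        σ = proj₁ trace-one

    slope : F
    slope = proj₁ slope-exists

    slope-spec : γ * slope ≡ β * conj slope + δ
    slope-spec = proj₂ slope-exists

    abstract
      -- Equal norms give γ / β norm 1, so Hilbert 90 applies. Adding `k` to `slope` produces a
      -- second slope of the regulus.
      direction : ∃[ k ] k ≢ 0# × β * conj k ≡ γ * k
      direction =
        let k , k≢0 , k̄≡ρk = hilbert90 (γ * β⁻¹) (unit-ratio ββ̄≡N γγ̄≡N ββ⁻¹≡1)
        in k , k≢0 , deduce (β ∷ γ ∷ β⁻¹ ∷ k ∷ []) (λ β γ i k → β ⊗ k ‾ ≋ γ ⊗ k ⇐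
             β ∙ (k ‾ ≋ γ ⊗ i ⊗ k) & γ ⊗ k ∙ (β ⊗ i ≋ ①) & none) k̄≡ρk ββ⁻¹≡1

    -- The regulus consists of y = 0 and the lines x = e y with γ e − β ē = δ.
    regulus-code : ∀ e → γ * e ≡ β * conj e + δ → SpreadCode β γ δ (G e 0#)
    regulus-code e h = deduce (β ∷ γ ∷ δ ∷ e ∷ []) (λ β γ δ e →
      ⓪ ⊕ γ ⊗ e ≋ β ⊗ e ‾ ⊕ β ⊗ γ ⊗ ⓪ ‾ ⊕ δ ⇐ ① ∙ (γ ⊗ e ≋ β ⊗ e ‾ ⊕ δ) & none) h

    regulus-code⁻¹ : ∀ {e e′ g′} → e ≡ e′ × 0# ≡ g′ → SpreadCode β γ δ (G e′ g′) → γ * e ≡ β * conj e + δ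
    regulus-code⁻¹ {e} (refl , refl) h = deduce (β ∷ γ ∷ δ ∷ e ∷ []) (λ β γ δ e → γ ⊗ e ≋ β ⊗ e ‾ ⊕ δ ⇐
      ① ∙ (⓪ ⊕ γ ⊗ e ≋ β ⊗ e ‾ ⊕ β ⊗ γ ⊗ ⓪ ‾ ⊕ δ) & none) h

    transversal-meets : ∀ {ν a μ e} → μ ∈ 𝒰 → ν * β ≡ μ * γ → γ * a ≡ β * conj a + δ →
      γ * e ≡ β * conj e + δ → Common (H ν a μ) (G e 0#)
    transversal-meets {ν} {a} {μ} {e} μ∈𝒰 νβ≡μγ ha he =
      let y , y≢0 , ȳ≡μy = hilbert90 μ μ∈𝒰
      in e * y , y , y≢0 ∘ proj₂
       , ( *-cancelˡ-≡ β≢0 (deduce (β ∷ γ ∷ δ ∷ ν ∷ a ∷ μ ∷ e ∷ y ∷ []) (λ β γ δ ν a μ e y →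
             β ⊗ (e ⊗ y ⊖ a ⊗ y) ‾ ≋ β ⊗ (ν ⊗ (e ⊗ y ⊖ a ⊗ y)) ⇐
               β ⊗ (e ⊖ a) ‾ ∙ (y ‾ ≋ μ ⊗ y)
             & ⊝ (μ ⊗ y) ∙ (γ ⊗ e ≋ β ⊗ e ‾ ⊕ δ) & μ ⊗ y ∙ (γ ⊗ a ≋ β ⊗ a ‾ ⊕ δ)
             & ⊝ ((e ⊖ a) ⊗ y) ∙ (ν ⊗ β ≋ μ ⊗ γ) & none) ȳ≡μy he ha νβ≡μγ)
         , ȳ≡μy )
       , deduce (e ∷ y ∷ []) (λ e y → e ⊗ y ≋ e ⊗ y ⊕ ⓪ ⊗ y ‾ ⇐ none)

    on-G-0 : ∀ e g {x y} → On (G e g) x y → y ≡ 0# → x ≡ 0#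
    on-G-0 e g {x} {y} on y≡0 = deduce (e ∷ g ∷ x ∷ y ∷ []) (λ e g x y → x ≋ ⓪ ⇐
      ① ∙ (x ≋ e ⊗ y ⊕ g ⊗ y ‾) & e ∙ (y ≋ ⓪) & g ∙ (y ‾ ≋ ⓪ ‾) & none) on y≡0 (cong conj y≡0)

    meets-regulus : ∀ {ν a μ e x y} → NonZeroPair x y → On (H ν a μ) x y → On (G e 0#) x y → conj (e - a) * μ ≡ ν * (e - a)
    meets-regulus {ν} {a} {μ} {e} {x} {y} xy≢0 (h , h′) on = *-cancelˡ-≡ y≢0 (deduce (ν ∷ a ∷ μ ∷ e ∷ x ∷ y ∷ []) (λ ν a μ e x y →
      y ⊗ ((e ⊖ a) ‾ ⊗ μ) ≋ y ⊗ (ν ⊗ (e ⊖ a)) ⇐ ① ∙ ((x ⊖ a ⊗ y) ‾ ≋ ν ⊗ (x ⊖ a ⊗ y)) & ⊝ ((e ⊖ a) ‾) ∙ (y ‾ ≋ μ ⊗ y)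
      & ν ∙ (x ≋ e ⊗ y ⊕ ⓪ ⊗ y ‾) & ⊝ ① ∙ (x ‾ ≋ (e ⊗ y ⊕ ⓪ ⊗ y ‾) ‾) & none) h h′ on (cong conj on))
      where
      y≢0 : y ≢ 0#
      y≢0 refl = xy≢0 (trans on (deduce (e ∷ []) (λ e → e ⊗ ⓪ ⊕ ⓪ ⊗ ⓪ ‾ ≋ ⓪ ⇐ none)) , refl)

    module _ {S D : Pred PointSet 0ℓ} (S≐ : S ≐ Lines (SpreadCode β γ δ)) (D≐ : D ≐ Lines DesarguesianCode) where

      regulus-∞ : Locus ∞ ∈ D ∩ S
      regulus-∞ = proj₂ D≐ {Locus ∞} (∞ , refl , ≐-refl) , proj₂ S≐ {Locus ∞} (∞ , refl , ≐-refl)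

      regulus-G : ∀ e → γ * e ≡ β * conj e + δ → Locus (G e 0#) ∈ D ∩ S
      regulus-G e h = proj₂ D≐ {Locus (G e 0#)} (G e 0# , refl , ≐-refl)
                    , proj₂ S≐ {Locus (G e 0#)} (G e 0# , regulus-code e h , ≐-refl)

      -- Meeting y = 0 excludes `G`, and meeting x = slope · y excludes `∞`. For `H`, the two slopes
      -- `slope` and `slope + k` already force both equations: their difference gives ν β = μ γ, and
      -- then either one gives the equation for `a`.
      opposite⇒code : ∀ {L} c → L ∈ Opposite Ση (D ∩ S) → IsLineCode c → L ≐ Locus c → SwitchedCode β γ δ c
      opposite⇒code {L} ∞ (_ , meets) _ L≐c =
        ⊥-elim (impossible (meeting-codes {L} {Locus (G slope 0#)} ∞ (G slope 0#) L≐c ≐-refl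
                             (meets (Locus (G slope 0#)) (regulus-G slope slope-spec))))
        where
        impossible : ¬ Common ∞ (G slope 0#)
        impossible (x , y , xy≢0 , y≡0 , on) = xy≢0 (on-G-0 slope 0# on y≡0 , y≡0)
      opposite⇒code {L} (G e g) (_ , meets) _ L≐c =
        ⊥-elim (impossible (meeting-codes {L} {Locus ∞} (G e g) ∞ L≐c ≐-refl (meets (Locus ∞) regulus-∞)))
        where
        impossible : ¬ Common (G e g) ∞
        impossible (x , y , xy≢0 , on , y≡0) = xy≢0 (on-G-0 e g on y≡0 , y≡0)
      opposite⇒code {L} (H ν a μ) (_ , meets) (ν∈𝒰 , μ∈𝒰) L≐c = (ν∈𝒰 , μ∈𝒰) , νβ≡μγ , ha
        where
        at : ∀ e → γ * e ≡ β * conj e + δ → conj (e - a) * μ ≡ ν * (e - a)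
        at e h = common (meeting-codes {L} {Locus (G e 0#)} (H ν a μ) (G e 0#) L≐c ≐-refl
                          (meets (Locus (G e 0#)) (regulus-G e h)))
          where
          common : Common (H ν a μ) (G e 0#) → conj (e - a) * μ ≡ ν * (e - a)
          common (x , y , xy≢0 , on , on′) = meets-regulus xy≢0 on on′
        k : F
        k = proj₁ direction
        βk̄≡γk : β * conj k ≡ γ * k
        βk̄≡γk = proj₂ (proj₂ direction)
        slope+k : γ * (slope + k) ≡ β * conj (slope + k) + δ
        slope+k = deduce (β ∷ γ ∷ δ ∷ slope ∷ k ∷ []) (λ β γ δ s k → γ ⊗ (s ⊕ k) ≋ β ⊗ (s ⊕ k) ‾ ⊕ δ ⇐
          ① ∙ (γ ⊗ s ≋ β ⊗ s ‾ ⊕ δ) & ⊝ ① ∙ (β ⊗ k ‾ ≋ γ ⊗ k) & none) slope-spec βk̄≡γk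
        νβ≡μγ : ν * β ≡ μ * γ
        νβ≡μγ = *-cancelˡ-≡ (proj₁ (proj₂ direction)) (deduce (β ∷ γ ∷ ν ∷ a ∷ μ ∷ slope ∷ k ∷ []) (λ β γ ν a μ s k →
          k ⊗ (ν ⊗ β) ≋ k ⊗ (μ ⊗ γ) ⇐ ⊝ β ∙ ((s ⊕ k ⊖ a) ‾ ⊗ μ ≋ ν ⊗ (s ⊕ k ⊖ a)) & β ∙ ((s ⊖ a) ‾ ⊗ μ ≋ ν ⊗ (s ⊖ a))
          & μ ∙ (β ⊗ k ‾ ≋ γ ⊗ k) & none) (at (slope + k) slope+k) (at slope slope-spec) βk̄≡γk)
        ha : γ * a ≡ β * conj a + δ
        ha = *-cancelˡ-≡ (𝒰-≢0 μ∈𝒰) (deduce (β ∷ γ ∷ δ ∷ ν ∷ a ∷ μ ∷ slope ∷ []) (λ β γ δ ν a μ s →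
          μ ⊗ (γ ⊗ a) ≋ μ ⊗ (β ⊗ a ‾ ⊕ δ) ⇐ β ∙ ((s ⊖ a) ‾ ⊗ μ ≋ ν ⊗ (s ⊖ a)) & s ⊖ a ∙ (ν ⊗ β ≋ μ ⊗ γ)
          & μ ∙ (γ ⊗ s ≋ β ⊗ s ‾ ⊕ δ) & none) (at slope slope-spec) νβ≡μγ slope-spec)

      unswitched⇒code : ∀ {L} c → ¬ L ∈ D ∩ S → L ∈ S → SpreadCode β γ δ c → L ≐ Locus c → SwitchedCode β γ δ c
      unswitched⇒code {L} ∞         L∉R L∈S _ L≐c = contradiction (proj₂ D≐ {L} (∞ , refl , L≐c) , L∈S) L∉R
      unswitched⇒code {L} (G e g)   L∉R L∈S h L≐c =
        (λ g≡0 → contradiction (proj₂ D≐ {L} (G e g , g≡0 , L≐c) , L∈S) L∉R) , h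
      unswitched⇒code     (H _ _ _) _   _   0≡1 _ = contradiction 0≡1 0≢1

      G-code∉D : ∀ {L e g} → g ≢ 0# → L ≐ Locus (G e g) → ¬ L ∈ D
      G-code∉D {L} {e} {g} g≢0 L≐c L∈D = clash (proj₁ D≐ {L} L∈D)
        where
        clash : L ∈ Lines DesarguesianCode → ⊥
        clash (∞       , _     , L≐∞) = ∞⋢G (≐⇒⊑ {L} ∞ (G e g) L≐∞ L≐c)
        clash (G e′ g′ , g′≡0  , L≐G) = g≢0 (trans (proj₂ (G-injective (≐⇒⊑ {L} (G e g) (G e′ g′) L≐c L≐G))) g′≡0)
        clash (H _ _ _ , 0≡1   , _)   = 0≢1 0≡1

      regulus-slope : ∀ {M e} → M ≐ Locus (G e 0#) → M ∈ S → γ * e ≡ β * conj e + δ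
      regulus-slope {M} {e} M≐G M∈S = slope-of (proj₁ S≐ {M} M∈S)
        where
        slope-of : M ∈ Lines (SpreadCode β γ δ) → γ * e ≡ β * conj e + δ
        slope-of (∞       , _   , M≐∞) = ⊥-elim (∞⋢G (≐⇒⊑ {M} ∞ (G e 0#) M≐∞ M≐G))
        slope-of (G e′ g′ , h   , M≐c) = regulus-code⁻¹ (G-injective (≐⇒⊑ {M} (G e 0#) (G e′ g′) M≐G M≐c)) h
        slope-of (H _ _ _ , 0≡1 , _)   = contradiction 0≡1 0≢1

      transversal∈opposite : ∀ {L ν a μ} → SwitchedCode β γ δ (H ν a μ) → L ≐ Locus (H ν a μ) → L ∈ Opposite Ση (D ∩ S)
      transversal∈opposite {L} {ν} {a} {μ} ((ν∈𝒰 , μ∈𝒰) , νβ≡μγ , ha) L≐c =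
          isLineOf-resp-≐ L≐c (locus-isLine (H ν a μ) (ν∈𝒰 , μ∈𝒰))
        , λ M (M∈D , M∈S) → meet M M∈S (proj₁ D≐ {M} M∈D)
        where
        meet : ∀ M → M ∈ S → M ∈ Lines DesarguesianCode → Meet L M
        meet M M∈S (∞ , _ , M≐∞) = common (hilbert90 ν ν∈𝒰)
          where
          common : (∃[ κ ] κ ≢ 0# × conj κ ≡ ν * κ) → Meet L M
          common (κ , κ≢0 , κ̄≡νκ) = codes-meet {L} {M} (H ν a μ) ∞ L≐c M≐∞ (κ≢0 ∘ proj₁) (H-point₁ a μ κ̄≡νκ) refl
        meet M M∈S (G e _ , refl , M≐G) = common (transversal-meets μ∈𝒰 νβ≡μγ ha (regulus-slope {M} M≐G M∈S))
          where
          common : Common (H ν a μ) (G e 0#) → Meet L M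
          common (x , y , xy≢0 , on , on′) = codes-meet {L} {M} (H ν a μ) (G e 0#) L≐c M≐G xy≢0 on on′
        meet M M∈S (H _ _ _ , 0≡1 , _) = contradiction 0≡1 0≢1

      switched≐lines : (S ∖ (D ∩ S)) ∪ Opposite Ση (D ∩ S) ≐ Lines (SwitchedCode β γ δ)
      switched≐lines = (λ {L} → to L) , (λ {L} → from L)
        where
        to : ∀ L → L ∈ (S ∖ (D ∩ S)) ∪ Opposite Ση (D ∩ S) → L ∈ Lines (SwitchedCode β γ δ)
        to L (inj₁ (L∈S , L∉R)) =
          let c , Kc , L≐c = proj₁ S≐ {L} L∈S in c , unswitched⇒code {L} c L∉R L∈S Kc L≐c , L≐c
        to L (inj₂ L∈Opp) =
          let c , c-line , L≐c = classification L (proj₁ L∈Opp) in c , opposite⇒code {L} c L∈Opp c-line L≐c , L≐c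
        from : ∀ L → L ∈ Lines (SwitchedCode β γ δ) → L ∈ (S ∖ (D ∩ S)) ∪ Opposite Ση (D ∩ S)
        from L (∞       , 0≡1       , _)   = contradiction 0≡1 0≢1
        from L (G e g   , (g≢0 , h) , L≐c) = inj₁ (proj₂ S≐ {L} (G e g , h , L≐c) , λ (L∈D , _) → G-code∉D {L} g≢0 L≐c L∈D)
        from L (H ν a μ , Kc        , L≐c) = inj₂ (transversal∈opposite {L} Kc L≐c)

    -- The two slopes differ by some k with β k^q = γ k. Since ν β = μ γ and y^q = μ y, the change k
    -- y satisfies z^q = ν z and leaves the condition intact.
    transversal-on : ∀ {ν a a′ μ x y} → ν * β ≡ μ * γ → γ * a ≡ β * conj a + δ → γ * a′ ≡ β * conj a′ + δ →
      On (H ν a μ) x y → On (H ν a′ μ) x y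
    transversal-on {ν} {a} {a′} {μ} {x} {y} νβ≡μγ ha ha′ (h , h′) =
      *-cancelˡ-≡ β≢0 (deduce (β ∷ γ ∷ δ ∷ ν ∷ a ∷ a′ ∷ μ ∷ x ∷ y ∷ []) (λ β γ δ ν a a′ μ x y →
        β ⊗ (x ⊖ a′ ⊗ y) ‾ ≋ β ⊗ (ν ⊗ (x ⊖ a′ ⊗ y)) ⇐
          β ∙ ((x ⊖ a ⊗ y) ‾ ≋ ν ⊗ (x ⊖ a ⊗ y))
        & β ⊗ (a ⊖ a′) ‾ ∙ (y ‾ ≋ μ ⊗ y)
        & ⊝ (μ ⊗ y) ∙ (γ ⊗ a ≋ β ⊗ a ‾ ⊕ δ) & μ ⊗ y ∙ (γ ⊗ a′ ≋ β ⊗ a′ ‾ ⊕ δ)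
        & ⊝ ((a ⊖ a′) ⊗ y) ∙ (ν ⊗ β ≋ μ ⊗ γ) & none) h h′ ha ha′ νβ≡μγ)
      , h′

    transversal-≐ : ∀ {ν a μ ν′ a′ μ′} → ν′ ≡ ν → μ′ ≡ μ →
      SwitchedCode β γ δ (H ν a μ) → SwitchedCode β γ δ (H ν′ a′ μ′) → Locus (H ν′ a′ μ′) ≐ Locus (H ν a μ)
    transversal-≐ {ν} {a} {μ} {_} {a′} refl refl (_ , νβ≡μγ , ha) (_ , _ , ha′) =
      on⇔⇒≐ (H ν a′ μ) (H ν a μ) (transversal-on νβ≡μγ ha′ ha) (transversal-on νβ≡μγ ha ha′)

    transversal-slope : ∀ {ν a μ e} → μ ∈ 𝒰 → ν * β ≡ μ * γ → γ * a ≡ β * conj a + δ →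
      conj (e - a) * μ ≡ ν * (e - a) → γ * e ≡ β * conj e + δ
    transversal-slope {ν} {a} {μ} {e} μ∈𝒰 νβ≡μγ ha h = *-cancelˡ-≡ (𝒰-≢0 μ∈𝒰)
      (deduce (β ∷ γ ∷ δ ∷ ν ∷ a ∷ μ ∷ e ∷ []) (λ β γ δ ν a μ e →
      μ ⊗ (γ ⊗ e) ≋ μ ⊗ (β ⊗ e ‾ ⊕ δ) ⇐ ⊝ β ∙ ((e ⊖ a) ‾ ⊗ μ ≋ ν ⊗ (e ⊖ a)) & ⊝ (e ⊖ a) ∙ (ν ⊗ β ≋ μ ⊗ γ)
      & μ ∙ (γ ⊗ a ≋ β ⊗ a ‾ ⊕ δ) & none) h νβ≡μγ ha)

    1-N≢0 : 1# - N ≢ 0#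
    1-N≢0 e = N≢1 (sym (minus≡0⇒≡ e))

    -- γ^q times the equation of the spread plus β times its conjugate: `e` and `δ` drop out, and
    -- the factor 1 - N that remains is invertible. The result involves only `g` and the pair.
    spread-trace : ∀ {e g} → SpreadCode β γ δ (G e g) → β * conj g ≡ - (conj γ * g)
    spread-trace {e} {g} h = *-cancelˡ-≡ 1-N≢0 (deduce (β ∷ γ ∷ δ ∷ N ∷ e ∷ g ∷ []) (λ β γ δ N e g →
      (① ⊖ N) ⊗ (β ⊗ g ‾) ≋ (① ⊖ N) ⊗ (⊝ (γ ‾ ⊗ g)) ⇐
        γ ‾ ∙ (g ⊕ γ ⊗ e ≋ β ⊗ e ‾ ⊕ β ⊗ γ ⊗ g ‾ ⊕ δ)
      & β ∙ ((g ⊕ γ ⊗ e) ‾ ≋ (β ⊗ e ‾ ⊕ β ⊗ γ ⊗ g ‾ ⊕ δ) ‾)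
      & ① ∙ (β ⊗ δ ‾ ⊕ γ ‾ ⊗ δ ≋ ⓪)
      & e ⊕ γ ‾ ⊗ g ∙ (β ⊗ β ‾ ≋ N)
      & β ⊗ g ‾ ⊖ e ∙ (γ ⊗ γ ‾ ≋ N) & none) h (cong conj h) trace-zero ββ̄≡N γγ̄≡N)

    -- On the line x = e′ y + g y^q with y^q = μ y, the slope x / y is e′ + g μ.
    defect : ∀ {e′ g μ e} → μ ∈ 𝒰 → SpreadCode β γ δ (G e′ g) → e ≡ e′ + g * μ →
      (1# - γ * μ) * conj (1# - γ * μ) * g ≡ - (γ * e - β * conj e - δ)
    defect {e′} {g} {μ} {e} μ∈𝒰 h he = deduce (β ∷ γ ∷ δ ∷ e′ ∷ g ∷ μ ∷ e ∷ []) (λ β γ δ e′ g μ e →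
      (① ⊖ γ ⊗ μ) ⊗ (① ⊖ γ ⊗ μ) ‾ ⊗ g ≋ ⊝ (γ ⊗ e ⊖ β ⊗ e ‾ ⊖ δ) ⇐
        ① ∙ (g ⊕ γ ⊗ e′ ≋ β ⊗ e′ ‾ ⊕ β ⊗ γ ⊗ g ‾ ⊕ δ)
      & γ ∙ (e ≋ e′ ⊕ g ⊗ μ) & ⊝ β ∙ (e ‾ ≋ (e′ ⊕ g ⊗ μ) ‾)
      & γ ⊖ μ ‾ ∙ (β ⊗ g ‾ ≋ ⊝ (γ ‾ ⊗ g))
      & γ ⊗ γ ‾ ⊗ g ∙ (μ ⊗ μ ‾ ≋ ①) & none) h he (cong conj he) (spread-trace h) μ∈𝒰

    -- γ μ has norm N, which is not 1.
    1-γμ≢0 : ∀ {μ} → μ ∈ 𝒰 → 1# - γ * μ ≢ 0#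
    1-γμ≢0 {μ} μ∈𝒰 e = N≢1 (deduce (γ ∷ N ∷ μ ∷ []) (λ γ N μ → N ≋ ① ⇐
      ⊝ ① ∙ (γ ⊗ γ ‾ ≋ N) & ⊝ (γ ⊗ γ ‾) ∙ (μ ⊗ μ ‾ ≋ ①) & ⊝ (γ ‾ ⊗ μ ‾) ∙ (① ⊖ γ ⊗ μ ≋ ⓪) & ⊝ ① ∙ ((① ⊖ γ ⊗ μ) ‾ ≋ ⓪ ‾) & none)
      γγ̄≡N μ∈𝒰 e (cong conj e))

    spread-code-from-defect : ∀ {e g μ} → μ ∈ 𝒰 →
      (1# - γ * μ) * conj (1# - γ * μ) * g ≡ - (γ * e - β * conj e - δ) → SpreadCode β γ δ (G (e - g * μ) g)
    spread-code-from-defect {e} {g} {μ} μ∈𝒰 h = deduce (β ∷ γ ∷ δ ∷ e ∷ g ∷ μ ∷ []) (λ β γ δ e g μ →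
      g ⊕ γ ⊗ (e ⊖ g ⊗ μ) ≋ β ⊗ (e ⊖ g ⊗ μ) ‾ ⊕ β ⊗ γ ⊗ g ‾ ⊕ δ ⇐
        ① ∙ ((① ⊖ γ ⊗ μ) ⊗ (① ⊖ γ ⊗ μ) ‾ ⊗ g ≋ ⊝ (γ ⊗ e ⊖ β ⊗ e ‾ ⊖ δ))
      & μ ‾ ⊖ γ ∙ (β ⊗ g ‾ ≋ ⊝ (γ ‾ ⊗ g))
      & ⊝ (γ ⊗ γ ‾ ⊗ g) ∙ (μ ⊗ μ ‾ ≋ ①) & none) h g-trace μ∈𝒰
      where
      n : F
      n = (1# - γ * μ) * conj (1# - γ * μ)
      n≢0 : n ≢ 0#
      n≢0 = *-nonzero (1-γμ≢0 μ∈𝒰) (conj-≢0 (1-γμ≢0 μ∈𝒰))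
      -- z = γ e - β e^q - δ satisfies β z^q = -γ^q z by equality of the norms and `trace-zero`, and
      -- dividing by `n`, which lies in 𝔽_q, passes this on to `g`.
      g-trace : β * conj g ≡ - (conj γ * g)
      g-trace = *-cancelˡ-≡ n≢0 (deduce (β ∷ γ ∷ δ ∷ N ∷ e ∷ g ∷ μ ∷ []) (λ β γ δ N e g μ →
        let n = (① ⊖ γ ⊗ μ) ⊗ (① ⊖ γ ⊗ μ) ‾; z = γ ⊗ e ⊖ β ⊗ e ‾ ⊖ δ in
        n ⊗ (β ⊗ g ‾) ≋ n ⊗ (⊝ (γ ‾ ⊗ g)) ⇐
          β ∙ ((n ⊗ g) ‾ ≋ (⊝ z) ‾) & γ ‾ ∙ (n ⊗ g ≋ ⊝ z)
        & e ∙ (β ⊗ β ‾ ≋ N) & ⊝ e ∙ (γ ⊗ γ ‾ ≋ N) & ① ∙ (β ⊗ δ ‾ ⊕ γ ‾ ⊗ δ ≋ ⓪) & none)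
        (cong conj h) h ββ̄≡N γγ̄≡N trace-zero)

    -- The lines of a switched spread partition the points.

    Covered : F → F → Set
    Covered x y = ∃[ c ] SwitchedCode β γ δ c × On c x y × (∀ c′ → SwitchedCode β γ δ c′ → On c′ x y → Locus c′ ≐ Locus c)

    -- The point fixes ν = x^q / x, and ν β = μ γ then fixes μ; all solutions of the slope equation
    -- give the same transversal, so `slope` will do.
    cover-∞ : ∀ {x} → x ≢ 0# → Covered x 0#
    cover-∞ {x} x≢0 = build (inverse x x≢0)
      where
      build : ∃[ i ] x * i ≡ 1# → Covered x 0#
      build (i , xi≡1) = H ν slope μ , K , H-point₁ slope μ x̄≡νx , unique
        where
        ν μ : F
        ν = conj x * i
        μ = ν * (β * γ⁻¹)
        x̄≡νx : conj x ≡ ν * x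
        x̄≡νx = conj-quotient xi≡1
        νβ≡μγ : ν * β ≡ μ * γ
        νβ≡μγ = deduce (ν ∷ β ∷ γ ∷ γ⁻¹ ∷ []) (λ ν β γ i → ν ⊗ β ≋ ν ⊗ (β ⊗ i) ⊗ γ ⇐ ⊝ (ν ⊗ β) ∙ (γ ⊗ i ≋ ①) & none) γγ⁻¹≡1
        K : SwitchedCode β γ δ (H ν slope μ)
        K = (quotient∈𝒰 xi≡1 , 𝒰-* (quotient∈𝒰 xi≡1) (unit-ratio γγ̄≡N ββ̄≡N γγ⁻¹≡1)) , νβ≡μγ , slope-spec
        unique : ∀ c′ → SwitchedCode β γ δ c′ → On c′ x 0# → Locus c′ ≐ Locus (H ν slope μ)
        unique ∞            0≡1 _  = contradiction 0≡1 0≢1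
        unique (G e g)      _   on = contradiction (on-G-0 e g on refl) x≢0
        unique (H ν′ a′ μ′) K′  on = transversal-≐ ν′≡ν (μ′≡μ K′ ν′≡ν) K K′
          where
          ν′≡ν : ν′ ≡ ν
          ν′≡ν = *-cancelˡ-≡ x≢0 (deduce (x ∷ a′ ∷ ν ∷ ν′ ∷ []) (λ x a ν ν′ → x ⊗ ν′ ≋ x ⊗ ν ⇐
            ⊝ ① ∙ ((x ⊖ a ⊗ ⓪) ‾ ≋ ν′ ⊗ (x ⊖ a ⊗ ⓪)) & ① ∙ (x ‾ ≋ ν ⊗ x) & none) (proj₁ on) x̄≡νx)
          μ′≡μ : ∀ {ν′ a′ μ′} → SwitchedCode β γ δ (H ν′ a′ μ′) → ν′ ≡ ν → μ′ ≡ μ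
          μ′≡μ {ν′} {_} {μ′} (_ , h , _) refl = *-cancelˡ-≡ γ≢0 (deduce (β ∷ γ ∷ ν ∷ μ ∷ μ′ ∷ []) (λ β γ ν μ μ′ →
            γ ⊗ μ′ ≋ γ ⊗ μ ⇐ ⊝ ① ∙ (ν ⊗ β ≋ μ′ ⊗ γ) & ① ∙ (ν ⊗ β ≋ μ ⊗ γ) & none) h νβ≡μγ)

    module _ {y : F} (y≢0 : y ≢ 0#) (e : F) {μ : F} (μ∈𝒰 : μ ∈ 𝒰) (ȳ≡μy : conj y ≡ μ * y) where

      private
        on-slope : On (G e 0#) (e * y) y
        on-slope = deduce (e ∷ y ∷ []) (λ e y → e ⊗ y ≋ e ⊗ y ⊕ ⓪ ⊗ y ‾ ⇐ none)
        xy≢0 : NonZeroPair (e * y) y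
        xy≢0 = y≢0 ∘ proj₂
        slope-of-G : ∀ {e′ g′} → On (G e′ g′) (e * y) y → e ≡ e′ + g′ * μ
        slope-of-G {e′} {g′} on = *-cancelˡ-≡ y≢0 (deduce (e ∷ y ∷ e′ ∷ g′ ∷ μ ∷ []) (λ e y e′ g′ μ →
          y ⊗ e ≋ y ⊗ (e′ ⊕ g′ ⊗ μ) ⇐ ① ∙ (e ⊗ y ≋ e′ ⊗ y ⊕ g′ ⊗ y ‾) & g′ ∙ (y ‾ ≋ μ ⊗ y) & none) on ȳ≡μy)
        slope-of-H : ∀ {ν a μ} → SwitchedCode β γ δ (H ν a μ) → On (H ν a μ) (e * y) y → γ * e ≡ β * conj e + δ
        slope-of-H ((_ , μ∈𝒰) , νβ≡μγ , ha) on = transversal-slope μ∈𝒰 νβ≡μγ ha (meets-regulus xy≢0 on on-slope)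

      -- At a slope of the regulus the right side of `defect` is 0, so no line with g ≠ 0 passes
      -- through the point; the transversal is fixed by μ and ν = μ γ / β.
      cover-regulus : γ * e ≡ β * conj e + δ → Covered (e * y) y
      cover-regulus he = H ν e μ , K , H-point₂ ν e ȳ≡μy , unique
        where
        ν : F
        ν = μ * (γ * β⁻¹)
        νβ≡μγ : ν * β ≡ μ * γ
        νβ≡μγ = deduce (μ ∷ β ∷ γ ∷ β⁻¹ ∷ []) (λ μ β γ i → μ ⊗ (γ ⊗ i) ⊗ β ≋ μ ⊗ γ ⇐ μ ⊗ γ ∙ (β ⊗ i ≋ ①) & none) ββ⁻¹≡1
        K : SwitchedCode β γ δ (H ν e μ)
        K = (𝒰-* μ∈𝒰 (unit-ratio ββ̄≡N γγ̄≡N ββ⁻¹≡1) , μ∈𝒰) , νβ≡μγ , he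
        unique : ∀ c′ → SwitchedCode β γ δ c′ → On c′ (e * y) y → Locus c′ ≐ Locus (H ν e μ)
        unique ∞            0≡1        _  = contradiction 0≡1 0≢1
        unique (G e′ g′)    (g′≢0 , h) on = contradiction g′≡0 g′≢0
          where
          n≢0 = *-nonzero (1-γμ≢0 μ∈𝒰) (conj-≢0 (1-γμ≢0 μ∈𝒰))
          g′≡0 : g′ ≡ 0#
          g′≡0 = *-cancelˡ-≡ n≢0 (deduce (β ∷ γ ∷ δ ∷ e ∷ g′ ∷ μ ∷ []) (λ β γ δ e g′ μ →
            let n = (① ⊖ γ ⊗ μ) ⊗ (① ⊖ γ ⊗ μ) ‾; z = γ ⊗ e ⊖ β ⊗ e ‾ ⊖ δ in
            n ⊗ g′ ≋ n ⊗ ⓪ ⇐ ① ∙ (n ⊗ g′ ≋ ⊝ z) & ⊝ ① ∙ (γ ⊗ e ≋ β ⊗ e ‾ ⊕ δ) & none)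
            (defect μ∈𝒰 h (slope-of-G on)) he)
        unique (H ν′ a′ μ′) K′         on = transversal-≐ (ν′≡ν K′ μ′≡μ) μ′≡μ K K′
          where
          μ′≡μ : μ′ ≡ μ
          μ′≡μ = *-cancelˡ-≡ y≢0 (deduce (y ∷ μ ∷ μ′ ∷ []) (λ y μ μ′ → y ⊗ μ′ ≋ y ⊗ μ ⇐
            ⊝ ① ∙ (y ‾ ≋ μ′ ⊗ y) & ① ∙ (y ‾ ≋ μ ⊗ y) & none) (proj₂ on) ȳ≡μy)
          ν′≡ν : ∀ {ν′ a′ μ′} → SwitchedCode β γ δ (H ν′ a′ μ′) → μ′ ≡ μ → ν′ ≡ ν
          ν′≡ν {ν′} (_ , h , _) refl = *-cancelˡ-≡ β≢0 (deduce (β ∷ γ ∷ ν ∷ ν′ ∷ μ ∷ []) (λ β γ ν ν′ μ →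
            β ⊗ ν′ ≋ β ⊗ ν ⇐ ① ∙ (ν′ ⊗ β ≋ μ ⊗ γ) & ⊝ ① ∙ (ν ⊗ β ≋ μ ⊗ γ) & none) h νβ≡μγ)

      -- Off y = 0, a transversal has only points with slopes of the regulus, so none passes here.
      -- `defect` forces g = -z / n, nonzero because z is, and with it e′ = e - g μ.
      cover-skew : γ * e ≢ β * conj e + δ → Covered (e * y) y
      cover-skew e∉ℛ = build (inverse n n≢0)
        where
        n z : F
        n = (1# - γ * μ) * conj (1# - γ * μ)
        z = γ * e - β * conj e - δ
        n≢0 : n ≢ 0#
        n≢0 = *-nonzero (1-γμ≢0 μ∈𝒰) (conj-≢0 (1-γμ≢0 μ∈𝒰))
        with-g : ∀ g → n * g ≡ - z → Covered (e * y) y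
        with-g g ng≡-z = G (e - g * μ) g , (g≢0 , spread-code-from-defect μ∈𝒰 ng≡-z) , on , unique
          where
          g≢0 : g ≢ 0#
          g≢0 g≡0 = e∉ℛ (deduce (β ∷ γ ∷ δ ∷ e ∷ n ∷ g ∷ []) (λ β γ δ e n g → γ ⊗ e ≋ β ⊗ e ‾ ⊕ δ ⇐
            ① ∙ (n ⊗ g ≋ ⊝ (γ ⊗ e ⊖ β ⊗ e ‾ ⊖ δ)) & ⊝ n ∙ (g ≋ ⓪) & none) ng≡-z g≡0)
          on : On (G (e - g * μ) g) (e * y) y
          on = deduce (e ∷ y ∷ g ∷ μ ∷ []) (λ e y g μ → e ⊗ y ≋ (e ⊖ g ⊗ μ) ⊗ y ⊕ g ⊗ y ‾ ⇐ ⊝ g ∙ (y ‾ ≋ μ ⊗ y) & none) ȳ≡μy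
          unique : ∀ c′ → SwitchedCode β γ δ c′ → On c′ (e * y) y → Locus c′ ≐ Locus (G (e - g * μ) g)
          unique ∞            0≡1     _   = contradiction 0≡1 0≢1
          unique (H ν′ a′ μ′) K′      on′ = contradiction (slope-of-H K′ on′) e∉ℛ
          unique (G e′ g′)    (_ , h) on′ = G-cong e′≡ g′≡g
            where
            G-cong : ∀ {e e′ g g′} → e ≡ e′ → g ≡ g′ → Locus (G e g) ≐ Locus (G e′ g′)
            G-cong refl refl = ≐-refl
            g′≡g : g′ ≡ g
            g′≡g = *-cancelˡ-≡ n≢0 (trans (defect μ∈𝒰 h (slope-of-G on′)) (sym ng≡-z))
            e′≡ : e′ ≡ e - g * μ
            e′≡ = deduce (e ∷ e′ ∷ g ∷ g′ ∷ μ ∷ []) (λ e e′ g g′ μ → e′ ≋ e ⊖ g ⊗ μ ⇐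
              ⊝ ① ∙ (e ≋ e′ ⊕ g′ ⊗ μ) & ⊝ μ ∙ (g′ ≋ g) & none) (slope-of-G on′) g′≡g
        build : ∃[ i ] n * i ≡ 1# → Covered (e * y) y
        build (i , ni≡1) = with-g (- (z * i))
          (deduce (n ∷ z ∷ i ∷ []) (λ n z i → n ⊗ ⊝ (z ⊗ i) ≋ ⊝ z ⇐ ⊝ z ∙ (n ⊗ i ≋ ①) & none) ni≡1)

    covered : ∀ x y → NonZeroPair x y → Covered x y
    covered x y xy≢0 with y ≟ 0#
    ... | yes refl = cover-∞ (λ x≡0 → xy≢0 (x≡0 , refl))
    ... | no y≢0   = affine (inverse y y≢0)
      where
      split : ∀ e μ → μ ∈ 𝒰 → conj y ≡ μ * y → Dec (γ * e ≡ β * conj e + δ) → Covered (e * y) y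
      split e μ μ∈𝒰 ȳ≡μy (yes he) = cover-regulus y≢0 e μ∈𝒰 ȳ≡μy he
      split e μ μ∈𝒰 ȳ≡μy (no e∉ℛ) = cover-skew y≢0 e μ∈𝒰 ȳ≡μy e∉ℛ
      affine : ∃[ i ] y * i ≡ 1# → Covered x y
      affine (i , yi≡1) = subst (λ x → Covered x y)
        (deduce (x ∷ y ∷ i ∷ []) (λ x y i → x ⊗ i ⊗ y ≋ x ⇐ x ∙ (y ⊗ i ≋ ①) & none) yi≡1)
        (split (x * i) (conj y * i) (quotient∈𝒰 yi≡1) (conj-quotient yi≡1)
          ((γ * (x * i)) ≟ (β * conj (x * i) + δ)))

    switched-isLineSpread : ∀ {ℓ} {S : Pred PointSet ℓ} → S ≐ Lines (SwitchedCode β γ δ) → IsLineSpread Ση S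
    switched-isLineSpread S≐ = lines-isLineSpread (SwitchedCode β γ δ) S≐ isLine covered
      where
      isLine : ∀ c → SwitchedCode β γ δ c → IsLineCode c
      isLine ∞         0≡1           = contradiction 0≡1 0≢1
      isLine (G _ _)   _             = refl
      isLine (H _ _ _) (units , _) = units

-- Pencils and parallelisms

module Switching (q : ℕ) (q-primePower : IsPrimePower q) (3≤q : 3 ℕ.≤ q) (𝔽 : FiniteField (q ℕ.^ 2))
  (s : BaerGeometry.Setting q 𝔽) where

  open FiniteField 𝔽 renaming (Carrier to F)
  open FieldTheory 𝔽
  open Conjugation q q-primePower 3≤q 𝔽 hiding (⟦_⟧)
  open BaerGeometry q 𝔽
  open CommutativeRing commutativeRing using (zeroˡ)
  open Construction s hiding (a; t; A)
  open BaerLines q q-primePower 3≤q 𝔽 η η∈𝒰 hiding (η≢0; Ση)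

  𝒮≐lines : ∀ {w₁ w₂ w₃ N} → w₁ * conj w₁ ≡ N → w₃ * conj w₃ ≡ N → N ≢ 1# → ∀ {ℓ} → ℓ ≐ Incident w₁ w₂ w₃ →
    𝒮 ℓ ≐ Lines (SpreadCode (η * conj w₁) (η * conj w₃) (η * conj w₂))
  𝒮≐lines {w₁} {w₂} {w₃} h₁ h₃ N≢1 {ℓ} (ℓ⊆I , I⊆ℓ) = (λ {L} → to L) , (λ {L} → from L)
    where
    K = SpreadCode (η * conj w₁) (η * conj w₃) (η * conj w₂)
    to : ∀ L → L ∈ 𝒮 ℓ → L ∈ Lines K
    to L (P , P∈ℓ , L≐PτP) =
      let c , Kc , PτP≐c = join-τ-code {w₁} {w₂} {w₃} h₁ h₃ N≢1 P (τη P) refl (ℓ⊆I {P} P∈ℓ) in c , Kc , ≐-trans L≐PτP PτP≐c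
    from : ∀ L → L ∈ Lines K → L ∈ 𝒮 ℓ
    from L (c , Kc , L≐c) =
      let P , P∈I , join = code-join-τ {w₁} {w₂} {w₃} h₁ h₃ N≢1 c Kc in P , I⊆ℓ {P} P∈I , ≐-trans L≐c (≐-sym (join (τη P) refl))

  t₁≐incident : t₁ ≐ Incident 0# 0# 0#
  t₁≐incident = (λ {P} → to P) , (λ {P} → from P)
    where
    to : ∀ P → P ∈ t₁ → P ∈ Incident 0# 0# 0#
    to P@(point (_ ∷ _ ∷ _ ∷ _ ∷ []) _) (a , b , refl) =
        deduce (a ∷ b ∷ []) (λ a b → a ⊗ ⓪ ⊕ b ⊗ ⓪ ≋ ⓪ ⊗ (a ⊗ ① ⊕ b ⊗ ⓪) ⊕ ⓪ ⊗ (a ⊗ ⓪ ⊕ b ⊗ ①) ⇐ none)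
      , deduce (a ∷ b ∷ []) (λ a b → a ⊗ ⓪ ⊕ b ⊗ ⓪ ≋ ⓪ ⊗ (a ⊗ ⓪ ⊕ b ⊗ ①) ⇐ none)
    from : ∀ P → P ∈ Incident 0# 0# 0# → P ∈ t₁
    from P@(point (a ∷ b ∷ c ∷ d ∷ []) _) (h , h′) = a , b , vec-≡
      (deduce (a ∷ b ∷ []) (λ a b → a ≋ a ⊗ ① ⊕ b ⊗ ⓪ ⇐ none))
      (deduce (a ∷ b ∷ []) (λ a b → b ≋ a ⊗ ⓪ ⊕ b ⊗ ① ⇐ none))
      (deduce (a ∷ b ∷ c ∷ []) (λ a b c → c ≋ a ⊗ ⓪ ⊕ b ⊗ ⓪ ⇐ ① ∙ (c ≋ ⓪ ⊗ a ⊕ ⓪ ⊗ b) & none) h)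
      (deduce (a ∷ b ∷ d ∷ []) (λ a b d → d ≋ a ⊗ ⓪ ⊕ b ⊗ ⓪ ⇐ ① ∙ (d ≋ ⓪ ⊗ b) & none) h′)

  lines-cong : ∀ {K K′ : Code → Set} → (∀ c → K c → K′ c) → (∀ c → K′ c → K c) → Lines K ≐ Lines K′
  lines-cong to from = (λ { (c , Kc , L≐c) → c , to c Kc , L≐c }) , (λ { (c , Kc , L≐c) → c , from c Kc , L≐c })

  -- For `t₁` all coefficients, and hence also N, are 0, and the equation of the spread reduces to g
  -- = 0.
  𝒟η≐lines : 𝒟η ≐ Lines DesarguesianCode
  𝒟η≐lines = ≐-trans (𝒮≐lines (zeroˡ _) (zeroˡ _) 0≢1 t₁≐incident) (lines-cong to from)
    where
    K = SpreadCode (η * conj 0#) (η * conj 0#) (η * conj 0#)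
    to : ∀ c → K c → DesarguesianCode c
    to ∞         _   = refl
    to (G e g)   h   = deduce (η ∷ e ∷ g ∷ []) (λ η e g → let z = η ⊗ ⓪ ‾ in
      g ≋ ⓪ ⇐ ① ∙ (g ⊕ z ⊗ e ≋ z ⊗ e ‾ ⊕ z ⊗ z ⊗ g ‾ ⊕ z) & none) h
    to (H _ _ _) 0≡1 = 0≡1
    from : ∀ c → DesarguesianCode c → K c
    from ∞         _   = refl
    from (G e g)   g≡0 = deduce (η ∷ e ∷ g ∷ []) (λ η e g → let z = η ⊗ ⓪ ‾ in
      g ⊕ z ⊗ e ≋ z ⊗ e ‾ ⊕ z ⊗ z ⊗ g ‾ ⊕ z ⇐ ① ∙ (g ≋ ⓪) & none) g≡0
    from (H _ _ _) 0≡1 = 0≡1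

  α≢0 : ∀ {α} → α ∈ ℐ → α ≢ 0#
  α≢0 ((i , refl) , _) = Λ-nonzero i

  -- In both parities the partition separates 1 from A, and the additional norm -1 occurs only for
  -- odd `q`.
  norm≢1 : ∀ {α} → α ∈ ℐ → norm α ≢ 1#
  norm≢1 (_ , inj₂ (q-odd , N≡-1)) N≡1 = -1≢1 q-odd (trans (sym N≡-1) N≡1)
  norm≢1 {α} (_ , inj₁ N∈A) N≡1 with 2 ∣ℕ? q
  ... | yes q-even = let _ , _ , 1⊥A , _ = A-even q-even in 1⊥A {norm α} (sym N≡1 , N∈A)
  ... | no q-odd   = let _ , (_ , 1⊥A , _) , _ = A-odd q-odd in 1⊥A {norm α} (inj₁ (sym N≡1) , N∈A)

  -- The lines of one pencil.

  Linear : (V → F) → Set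
  Linear φ = ∀ a b A B → φ (a · A +ⱽ b · B) ≡ a * φ A + b * φ B

  linear₁ : Linear x₁
  linear₁ a b (_ ∷ _ ∷ _ ∷ _ ∷ []) (_ ∷ _ ∷ _ ∷ _ ∷ []) = refl
  linear₂ : Linear x₂
  linear₂ a b (_ ∷ _ ∷ _ ∷ _ ∷ []) (_ ∷ _ ∷ _ ∷ _ ∷ []) = refl
  linear₃ : Linear x₃
  linear₃ a b (_ ∷ _ ∷ _ ∷ _ ∷ []) (_ ∷ _ ∷ _ ∷ _ ∷ []) = refl

  rebase : ∀ {a b c d A B} → a * d - b * c ≢ 0# →
    ∀ v → Span A B v → Span (a · A +ⱽ b · B) (c · A +ⱽ d · B) v
  rebase {a} {b} {c} {d} {A₁ ∷ A₂ ∷ A₃ ∷ A₄ ∷ []} {B₁ ∷ B₂ ∷ B₃ ∷ B₄ ∷ []} Δ≢0 v (s , t , v≡) =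
    go (cramer s t Δ≢0)
    where
    go : (∃₂ λ x y → s ≡ x * a + y * c × t ≡ x * b + y * d) → Span _ _ v
    go (x , y , hs , ht) = x , y , trans v≡ (vec-≡ (at A₁ B₁) (at A₂ B₂) (at A₃ B₃) (at A₄ B₄))
      where
      at : ∀ A B → s * A + t * B ≡ x * (a * A + b * B) + y * (c * A + d * B)
      at A B = deduce (s ∷ t ∷ x ∷ y ∷ a ∷ b ∷ c ∷ d ∷ A ∷ B ∷ []) (λ s t x y a b c d A B →
        s ⊗ A ⊕ t ⊗ B ≋ x ⊗ (a ⊗ A ⊕ b ⊗ B) ⊕ y ⊗ (c ⊗ A ⊕ d ⊗ B) ⇐
          A ∙ (s ≋ x ⊗ a ⊕ y ⊗ c) & B ∙ (t ≋ x ⊗ b ⊕ y ⊗ d) & none) hs ht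

  unbase : ∀ {a b c d A B} v → Span (a · A +ⱽ b · B) (c · A +ⱽ d · B) v → Span A B v
  unbase {a} {b} {c} {d} {A₁ ∷ A₂ ∷ A₃ ∷ A₄ ∷ []} {B₁ ∷ B₂ ∷ B₃ ∷ B₄ ∷ []} v (x , y , v≡) =
    x * a + y * c , x * b + y * d , trans v≡ (vec-≡ (at A₁ B₁) (at A₂ B₂) (at A₃ B₃) (at A₄ B₄))
    where
    at : ∀ A B → x * (a * A + b * B) + y * (c * A + d * B) ≡ (x * a + y * c) * A + (x * b + y * d) * B
    at A B = deduce (x ∷ y ∷ a ∷ b ∷ c ∷ d ∷ A ∷ B ∷ []) (λ x y a b c d A B →
      x ⊗ (a ⊗ A ⊕ b ⊗ B) ⊕ y ⊗ (c ⊗ A ⊕ d ⊗ B) ≋ (x ⊗ a ⊕ y ⊗ c) ⊗ A ⊕ (x ⊗ b ⊕ y ⊗ d) ⊗ B ⇐ none)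

  -- A nonzero 2 × 2 minor shows that R and S span the line through A and B.
  join-unique : ∀ {φ ψ A B R S} → Linear φ → Linear ψ → R ∈ ⟨ A , B ⟩ → S ∈ ⟨ A , B ⟩ →
    φ (coords R) * ψ (coords S) - ψ (coords R) * φ (coords S) ≢ 0# → ⟨ A , B ⟩ ≐ ⟨ R , S ⟩
  join-unique {φ} {ψ} {A} {B} {R} {S} φ-lin ψ-lin (a , b , R≡) (c , d , S≡) Δ≢0 =
      (λ {P} P∈AB → subst₂ (λ r s → Span r s (coords P)) (sym R≡) (sym S≡)
                      (rebase {a} {b} {c} {d} {coords A} {coords B} minor≢0 (coords P) P∈AB))
    , (λ {P} P∈RS → unbase {a} {b} {c} {d} {coords A} {coords B} (coords P) (subst₂ (λ r s → Span r s (coords P)) R≡ S≡ P∈RS))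
    where
    image : ∀ {χ r} x y → Linear χ → r ≡ x · coords A +ⱽ y · coords B → χ r ≡ x * χ (coords A) + y * χ (coords B)
    image {χ} x y χ-lin r≡ = trans (cong χ r≡) (χ-lin x y (coords A) (coords B))
    minor≢0 : a * d - b * c ≢ 0#
    minor≢0 e = Δ≢0 (deduce
      (a ∷ b ∷ c ∷ d ∷ φ (coords A) ∷ φ (coords B) ∷ ψ (coords A) ∷ ψ (coords B) ∷ φ (coords R) ∷ φ (coords S) ∷ ψ (coords R) ∷ ψ (coords S) ∷ [])
      (λ a b c d φA φB ψA ψB φR φS ψR ψS → φR ⊗ ψS ⊖ ψR ⊗ φS ≋ ⓪ ⇐
        ψS ∙ (φR ≋ a ⊗ φA ⊕ b ⊗ φB) & a ⊗ φA ⊕ b ⊗ φB ∙ (ψS ≋ c ⊗ ψA ⊕ d ⊗ ψB)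
      & ⊝ φS ∙ (ψR ≋ a ⊗ ψA ⊕ b ⊗ ψB) & ⊝ (a ⊗ ψA ⊕ b ⊗ ψB) ∙ (φS ≋ c ⊗ φA ⊕ d ⊗ φB)
      & φA ⊗ ψB ⊖ φB ⊗ ψA ∙ (a ⊗ d ⊖ b ⊗ c ≋ ⓪) & none)
      (image {φ} a b φ-lin R≡) (image {ψ} c d ψ-lin S≡) (image {ψ} a b ψ-lin R≡) (image {φ} c d φ-lin S≡) e)

  left∈join : ∀ A B → A ∈ ⟨ A , B ⟩
  left∈join (point (a₁ ∷ a₂ ∷ a₃ ∷ a₄ ∷ []) _) (point (b₁ ∷ b₂ ∷ b₃ ∷ b₄ ∷ []) _) =
    1# , 0# , vec-≡ (at a₁ b₁) (at a₂ b₂) (at a₃ b₃) (at a₄ b₄)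
    where
    at : ∀ a b → a ≡ 1# * a + 0# * b
    at a b = deduce (a ∷ b ∷ []) (λ a b → a ≋ ① ⊗ a ⊕ ⓪ ⊗ b ⇐ none)

  right∈join : ∀ A B → B ∈ ⟨ A , B ⟩
  right∈join A B = span-swap {coords B} {coords A} (left∈join B A)

  -- The pencil lines other than r[U₁] are the lines X₃ = αu X₁ + αm X₂, X₄ = αv X₂ with m + uv m^q = 0.
  Twisted : F → F → F → Set
  Twisted u v m = m + u * v * conj m ≡ 0#

  -- The coefficient of X₂ comes from R: there X₃ = αu X₁ + αm X₂ reads x^q = u x + m y.
  through-P : ∀ {α u v R} x y k → k ≢ 0# → conj y ≡ v * y → ∀ i → y * i ≡ 1# →
    coords R ≡ k · (x ∷ y ∷ α * conj x ∷ α * conj y ∷ []) →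
    ⟨ P⟨ α * u ⟩ , R ⟩ ≐ Incident (α * u) (α * ((conj x - u * x) * i)) (α * v)
  through-P {α} {u} {v} {R} x y k k≢0 ȳ≡vy i yi≡1 eR = (λ {Q} → to Q) , (λ {Q} → from Q (inverse k k≢0))
    where
    m : F
    m = (conj x - u * x) * i
    to : ∀ Q → Q ∈ ⟨ P⟨ α * u ⟩ , R ⟩ → Q ∈ Incident (α * u) (α * m) (α * v)
    to (point (_ ∷ _ ∷ _ ∷ _ ∷ []) _) (a , b , e) = lemma (trans e (cong (λ R → a · coords P⟨ α * u ⟩ +ⱽ b · R) eR))
      where
      lemma : ∀ {q₁ q₂ q₃ q₄} → q₁ ∷ q₂ ∷ q₃ ∷ q₄ ∷ [] ≡ a · coords P⟨ α * u ⟩ +ⱽ b · (k · (x ∷ y ∷ α * conj x ∷ α * conj y ∷ [])) →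
        q₃ ≡ α * u * q₁ + α * m * q₂ × q₄ ≡ α * v * q₂
      lemma refl =
          deduce (a ∷ b ∷ k ∷ x ∷ y ∷ α ∷ u ∷ i ∷ []) (λ a b k x y α u i →
            a ⊗ (α ⊗ u) ⊕ b ⊗ (k ⊗ (α ⊗ x ‾)) ≋
            α ⊗ u ⊗ (a ⊗ ① ⊕ b ⊗ (k ⊗ x)) ⊕ α ⊗ ((x ‾ ⊖ u ⊗ x) ⊗ i) ⊗ (a ⊗ ⓪ ⊕ b ⊗ (k ⊗ y)) ⇐
              ⊝ (α ⊗ b ⊗ k ⊗ (x ‾ ⊖ u ⊗ x)) ∙ (y ⊗ i ≋ ①) & none) yi≡1
        , deduce (a ∷ b ∷ k ∷ y ∷ α ∷ v ∷ []) (λ a b k y α v →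
            a ⊗ ⓪ ⊕ b ⊗ (k ⊗ (α ⊗ y ‾)) ≋ α ⊗ v ⊗ (a ⊗ ⓪ ⊕ b ⊗ (k ⊗ y)) ⇐
              b ⊗ k ⊗ α ∙ (y ‾ ≋ v ⊗ y) & none) ȳ≡vy
    from : ∀ Q → ∃[ l ] k * l ≡ 1# → Q ∈ Incident (α * u) (α * m) (α * v) → Q ∈ ⟨ P⟨ α * u ⟩ , R ⟩
    from (point (q₁ ∷ q₂ ∷ q₃ ∷ q₄ ∷ []) _) (l , kl≡1) (h , h′) = a , b , trans
      (vec-≡
        (deduce (q₁ ∷ q₂ ∷ k ∷ l ∷ x ∷ i ∷ []) (λ q₁ q₂ k l x i → let b = q₂ ⊗ i ⊗ l; a = q₁ ⊖ b ⊗ (k ⊗ x) in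
          q₁ ≋ a ⊗ ① ⊕ b ⊗ (k ⊗ x) ⇐ none))
        (deduce (q₁ ∷ q₂ ∷ k ∷ l ∷ x ∷ y ∷ i ∷ []) (λ q₁ q₂ k l x y i → let b = q₂ ⊗ i ⊗ l; a = q₁ ⊖ b ⊗ (k ⊗ x) in
          q₂ ≋ a ⊗ ⓪ ⊕ b ⊗ (k ⊗ y) ⇐ ⊝ (q₂ ⊗ i ⊗ y) ∙ (k ⊗ l ≋ ①) & ⊝ q₂ ∙ (y ⊗ i ≋ ①) & none) kl≡1 yi≡1)
        (deduce (q₁ ∷ q₂ ∷ q₃ ∷ k ∷ l ∷ x ∷ i ∷ α ∷ u ∷ []) (λ q₁ q₂ q₃ k l x i α u → let b = q₂ ⊗ i ⊗ l; a = q₁ ⊖ b ⊗ (k ⊗ x) in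
          q₃ ≋ a ⊗ (α ⊗ u) ⊕ b ⊗ (k ⊗ (α ⊗ x ‾)) ⇐
            ① ∙ (q₃ ≋ α ⊗ u ⊗ q₁ ⊕ α ⊗ ((x ‾ ⊖ u ⊗ x) ⊗ i) ⊗ q₂)
          & ⊝ (α ⊗ (x ‾ ⊖ u ⊗ x) ⊗ i ⊗ q₂) ∙ (k ⊗ l ≋ ①) & none) h kl≡1)
        (deduce (q₁ ∷ q₂ ∷ q₄ ∷ k ∷ l ∷ x ∷ y ∷ i ∷ α ∷ v ∷ []) (λ q₁ q₂ q₄ k l x y i α v → let b = q₂ ⊗ i ⊗ l; a = q₁ ⊖ b ⊗ (k ⊗ x) in
          q₄ ≋ a ⊗ ⓪ ⊕ b ⊗ (k ⊗ (α ⊗ y ‾)) ⇐ ① ∙ (q₄ ≋ α ⊗ v ⊗ q₂)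
          & ⊝ (b ⊗ k ⊗ α) ∙ (y ‾ ≋ v ⊗ y)
          & ⊝ (α ⊗ v ⊗ q₂ ⊗ y ⊗ i) ∙ (k ⊗ l ≋ ①) & ⊝ (α ⊗ v ⊗ q₂) ∙ (y ⊗ i ≋ ①) & none) h′ ȳ≡vy kl≡1 yi≡1))
      (cong (λ R → a · coords P⟨ α * u ⟩ +ⱽ b · R) (sym eR))
      where
      b a : F
      b = q₂ * i * l
      a = q₁ - b * (k * x)

  -- Conjugating m = (x^q - u x) / y with y^q = v y and u^q = 1 / u gives m^q = -m / (u v).
  twisted-quotient : ∀ {u v x y i} → u ∈ 𝒰 → conj y ≡ v * y → y * i ≡ 1# → Twisted u v ((conj x - u * x) * i)
  twisted-quotient {u} {v} {x} {y} {i} u∈𝒰 ȳ≡vy yi≡1 = *-cancelˡ-≡ (conj-≢0 y≢0) (deduce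
    (u ∷ v ∷ x ∷ y ∷ i ∷ []) (λ u v x y i → let m = (x ‾ ⊖ u ⊗ x) ⊗ i in
    y ‾ ⊗ (m ⊕ u ⊗ v ⊗ m ‾) ≋ y ‾ ⊗ ⓪ ⇐
      m ∙ (y ‾ ≋ v ⊗ y) & v ⊗ (x ‾ ⊖ u ⊗ x) ∙ (y ⊗ i ≋ ①)
    & u ⊗ v ⊗ (x ‾ ⊖ u ⊗ x) ‾ ∙ ((y ⊗ i) ‾ ≋ ① ‾)
    & ⊝ (v ⊗ x ‾) ∙ (u ⊗ u ‾ ≋ ①) & none) ȳ≡vy yi≡1 (cong conj yi≡1) u∈𝒰)
    where
    y≢0 : y ≢ 0#
    y≢0 refl = 0≢1 (trans (sym (zeroˡ i)) yi≡1)

  module _ {α u v : F} (α∈ℐ : α ∈ ℐ) (u∈𝒰 : u ∈ 𝒰) (v∈𝒰 : v ∈ 𝒰) where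

    TwistedLine : PointSet → Set
    TwistedLine ℓ = ∃[ m ] Twisted u v m × ℓ ≐ Incident (α * u) (α * m) (α * v)

    twisted-line : ∀ {ℓ} R x y k → IsLine ℓ → P⟨ α * u ⟩ ∈ ℓ → R ∈ ℓ → R ∈ π⟨ α * v ⟩ → k ≢ 0# → y ≢ 0# →
      coords R ≡ k · (x ∷ y ∷ α * conj x ∷ α * conj y ∷ []) → TwistedLine ℓ
    twisted-line {ℓ} R x y k (A , B , _ , ℓ≐AB) P∈ℓ R∈ℓ R∈π k≢0 y≢0 eR = go (inverse y y≢0)
      where
      ȳ≡vy : conj y ≡ v * y
      ȳ≡vy = *-cancelˡ-≡ (*-nonzero k≢0 (α≢0 α∈ℐ)) (deduce (α ∷ v ∷ y ∷ k ∷ []) (λ α v y k →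
        k ⊗ α ⊗ y ‾ ≋ k ⊗ α ⊗ (v ⊗ y) ⇐ ① ∙ (k ⊗ (α ⊗ y ‾) ≋ α ⊗ v ⊗ (k ⊗ y)) & none)
        (trans (sym (cong x₄ eR)) (trans R∈π (cong (α * v *_) (cong x₂ eR)))))
      minor≢0 : 1# * x₂ (coords R) - 0# * x₁ (coords R) ≢ 0#
      minor≢0 e = *-nonzero k≢0 y≢0 (deduce (x₁ (coords R) ∷ x₂ (coords R) ∷ k ∷ y ∷ []) (λ r₁ r₂ k y →
        k ⊗ y ≋ ⓪ ⇐ ① ∙ (① ⊗ r₂ ⊖ ⓪ ⊗ r₁ ≋ ⓪) & ⊝ ① ∙ (r₂ ≋ k ⊗ y) & none) e (cong x₂ eR))
      go : ∃[ i ] y * i ≡ 1# → TwistedLine ℓ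
      go (i , yi≡1) = (conj x - u * x) * i , twisted-quotient u∈𝒰 ȳ≡vy yi≡1
        , ≐-trans ℓ≐AB (≐-trans
            (join-unique {x₁} {x₂} {A} {B} {P⟨ α * u ⟩} {R} linear₁ linear₂ (proj₁ ℓ≐AB {P⟨ α * u ⟩} P∈ℓ) (proj₁ ℓ≐AB {R} R∈ℓ) minor≢0)
            (through-P {α} {u} {v} {R} x y k k≢0 ȳ≡vy i yi≡1 eR))

    real-line : ∀ {ℓ} R S x k x′ k′ → IsLine ℓ → R ∈ ℓ → S ∈ ℓ → ¬ R ≈ S → k ≢ 0# → x ≢ 0# → k′ ≢ 0# → x′ ≢ 0# →
      coords R ≡ k · (x ∷ 0# ∷ α * conj x ∷ α * conj 0# ∷ []) →
      coords S ≡ k′ · (x′ ∷ 0# ∷ α * conj x′ ∷ α * conj 0# ∷ []) → ℓ ≐ r[U₁]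
    real-line {ℓ} R S x k x′ k′ (A , B , _ , ℓ≐AB) R∈ℓ S∈ℓ R≉S k≢0 x≢0 k′≢0 x′≢0 eR eS =
      ≐-trans ℓ≐AB (≐-trans
        (join-unique {x₁} {x₃} {A} {B} {R} {S} linear₁ linear₃ (proj₁ ℓ≐AB {R} R∈ℓ) (proj₁ ℓ≐AB {S} S∈ℓ) minor≢0)
        (≐-sym (join-unique {x₁} {x₃} {U₁} {U₃} {R} {S} linear₁ linear₃ (on-r R x k eR) (on-r S x′ k′ eS) minor≢0)))
      where
      on-r : ∀ R x k → coords R ≡ k · (x ∷ 0# ∷ α * conj x ∷ α * conj 0# ∷ []) → R ∈ r[U₁]
      on-r R x k eR = k * x , k * (α * conj x) , trans eR (vec-≡
        (deduce (k ∷ x ∷ α ∷ []) (λ k x α → k ⊗ x ≋ k ⊗ x ⊗ ① ⊕ k ⊗ (α ⊗ x ‾) ⊗ ⓪ ⇐ none))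
        (deduce (k ∷ x ∷ α ∷ []) (λ k x α → k ⊗ ⓪ ≋ k ⊗ x ⊗ ⓪ ⊕ k ⊗ (α ⊗ x ‾) ⊗ ⓪ ⇐ none))
        (deduce (k ∷ x ∷ α ∷ []) (λ k x α → k ⊗ (α ⊗ x ‾) ≋ k ⊗ x ⊗ ⓪ ⊕ k ⊗ (α ⊗ x ‾) ⊗ ① ⇐ none))
        (deduce (k ∷ x ∷ α ∷ []) (λ k x α → k ⊗ (α ⊗ ⓪ ‾) ≋ k ⊗ x ⊗ ⓪ ⊕ k ⊗ (α ⊗ x ‾) ⊗ ⓪ ⇐ none)))
      Δ≢0 : x * conj x′ - conj x * x′ ≢ 0#
      Δ≢0 Δ≡0 = go (inverse (k′ * x′) (*-nonzero k′≢0 x′≢0))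
        where
        go : ∃[ i ] k′ * x′ * i ≡ 1# → ⊥
        go (i , k′x′i≡1) = R≉S (k * x * i , *-nonzero (*-nonzero k≢0 x≢0) i≢0 , trans eR (trans (vec-≡
            (deduce (k ∷ x ∷ k′ ∷ x′ ∷ i ∷ []) (λ k x k′ x′ i → k ⊗ x ≋ k ⊗ x ⊗ i ⊗ (k′ ⊗ x′) ⇐
              ⊝ (k ⊗ x) ∙ (k′ ⊗ x′ ⊗ i ≋ ①) & none) k′x′i≡1)
            (deduce (k ∷ x ∷ k′ ∷ i ∷ []) (λ k x k′ i → k ⊗ ⓪ ≋ k ⊗ x ⊗ i ⊗ (k′ ⊗ ⓪) ⇐ none))
            (deduce (k ∷ x ∷ k′ ∷ x′ ∷ i ∷ α ∷ []) (λ k x k′ x′ i α → k ⊗ (α ⊗ x ‾) ≋ k ⊗ x ⊗ i ⊗ (k′ ⊗ (α ⊗ x′ ‾)) ⇐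
              ⊝ (k ⊗ α ⊗ x ‾) ∙ (k′ ⊗ x′ ⊗ i ≋ ①) & ⊝ (k ⊗ α ⊗ k′ ⊗ i) ∙ (x ⊗ x′ ‾ ⊖ x ‾ ⊗ x′ ≋ ⓪) & none) k′x′i≡1 Δ≡0)
            (deduce (k ∷ x ∷ k′ ∷ i ∷ α ∷ []) (λ k x k′ i α → k ⊗ (α ⊗ ⓪ ‾) ≋ k ⊗ x ⊗ i ⊗ (k′ ⊗ (α ⊗ ⓪ ‾)) ⇐ none)))
            (cong ((k * x * i) ·_) (sym eS))))
          where
          i≢0 : i ≢ 0#
          i≢0 refl = 0≢1 (trans (sym (zeroʳ _)) k′x′i≡1)
      minor≢0 : x₁ (coords R) * x₃ (coords S) - x₃ (coords R) * x₁ (coords S) ≢ 0#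
      minor≢0 e = *-nonzero (*-nonzero k≢0 k′≢0) (*-nonzero (α≢0 α∈ℐ) Δ≢0) (deduce
        (x₁ (coords R) ∷ x₃ (coords R) ∷ x₁ (coords S) ∷ x₃ (coords S) ∷ k ∷ x ∷ k′ ∷ x′ ∷ α ∷ []) (λ r₁ r₃ s₁ s₃ k x k′ x′ α →
        k ⊗ k′ ⊗ (α ⊗ (x ⊗ x′ ‾ ⊖ x ‾ ⊗ x′)) ≋ ⓪ ⇐ ① ∙ (r₁ ⊗ s₃ ⊖ r₃ ⊗ s₁ ≋ ⓪)
        & ⊝ s₃ ∙ (r₁ ≋ k ⊗ x) & ⊝ (k ⊗ x) ∙ (s₃ ≋ k′ ⊗ (α ⊗ x′ ‾))
        & s₁ ∙ (r₃ ≋ k ⊗ (α ⊗ x ‾)) & k ⊗ (α ⊗ x ‾) ∙ (s₁ ≋ k′ ⊗ x′) & none)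
        e (cong x₁ eR) (cong x₃ eS) (cong x₃ eR) (cong x₁ eS))

    -- Two points of the Baer subline with y = 0 would span r_{U₁}; so one of them has y ≠ 0, and
    -- its join with P is a twisted line.
    pencil⇒twisted : ∀ ℓ → ℓ ∈ p α u v → ¬ ℓ ≐ r[U₁] → TwistedLine ℓ
    pencil⇒twisted ℓ (ℓ-line , ℓ⊆π , P∈ℓ , R , S , R∈Σ , S∈Σ , R≉S , _ , RS⊆ℓ) ℓ≢r = go R∈Σ S∈Σ
      where
      R∈ℓ : R ∈ ℓ
      R∈ℓ = proj₁ (RS⊆ℓ {R} (left∈join R S , R∈Σ))
      S∈ℓ : S ∈ ℓ
      S∈ℓ = proj₁ (RS⊆ℓ {S} (right∈join R S , S∈Σ))
      go : R ∈ Σ[ α ] → S ∈ Σ[ α ] → TwistedLine ℓ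
      go (x , y , xy≢0 , k , k≢0 , eR) (x′ , y′ , xy′≢0 , k′ , k′≢0 , eS) = split (y ≟ 0#) (y′ ≟ 0#)
        where
        split : Dec (y ≡ 0#) → Dec (y′ ≡ 0#) → TwistedLine ℓ
        split (no y≢0)   _          = twisted-line {ℓ} R x y k ℓ-line P∈ℓ R∈ℓ (ℓ⊆π {R} R∈ℓ) k≢0 y≢0 eR
        split (yes _)    (no y′≢0)  = twisted-line {ℓ} S x′ y′ k′ ℓ-line P∈ℓ S∈ℓ (ℓ⊆π {S} S∈ℓ) k′≢0 y′≢0 eS
        split (yes refl) (yes refl) = contradiction
          (real-line {ℓ} R S x k x′ k′ ℓ-line R∈ℓ S∈ℓ R≉S k≢0 (λ x≡0 → xy≢0 (x≡0 , refl)) k′≢0 (λ x≡0 → xy′≢0 (x≡0 , refl)) eR eS)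
          ℓ≢r

    module _ {m : F} (m-twisted : Twisted u v m) where

      private
        ℓₘ : PointSet
        ℓₘ = Incident (α * u) (α * m) (α * v)
        Q : Point
        Q = point (0# ∷ 1# ∷ α * m ∷ α * v ∷ []) (1≢0 ∘ cong x₂)
        σ : F
        σ = proj₁ trace-one

        Pₘ∈ℓ : P⟨ α * u ⟩ ∈ ℓₘ
        Pₘ∈ℓ = deduce (α ∷ u ∷ m ∷ []) (λ α u m → α ⊗ u ≋ α ⊗ u ⊗ ① ⊕ α ⊗ m ⊗ ⓪ ⇐ none)
             , deduce (α ∷ v ∷ []) (λ α v → ⓪ ≋ α ⊗ v ⊗ ⓪ ⇐ none)

        Q∈ℓ : Q ∈ ℓₘ
        Q∈ℓ = deduce (α ∷ u ∷ m ∷ []) (λ α u m → α ⊗ m ≋ α ⊗ u ⊗ ⓪ ⊕ α ⊗ m ⊗ ① ⇐ none)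
            , deduce (α ∷ v ∷ []) (λ α v → α ⊗ v ≋ α ⊗ v ⊗ ① ⇐ none)

        ℓₘ≐join : ℓₘ ≐ ⟨ P⟨ α * u ⟩ , Q ⟩
        ℓₘ≐join = (λ {R} → to R) , (λ {R} → from R)
          where
          to : ∀ R → R ∈ ℓₘ → R ∈ ⟨ P⟨ α * u ⟩ , Q ⟩
          to (point (r₁ ∷ r₂ ∷ r₃ ∷ r₄ ∷ []) _) (h , h′) = r₁ , r₂ , vec-≡
            (deduce (r₁ ∷ r₂ ∷ []) (λ r₁ r₂ → r₁ ≋ r₁ ⊗ ① ⊕ r₂ ⊗ ⓪ ⇐ none))
            (deduce (r₁ ∷ r₂ ∷ []) (λ r₁ r₂ → r₂ ≋ r₁ ⊗ ⓪ ⊕ r₂ ⊗ ① ⇐ none))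
            (deduce (r₁ ∷ r₂ ∷ r₃ ∷ α ∷ u ∷ m ∷ []) (λ r₁ r₂ r₃ α u m → r₃ ≋ r₁ ⊗ (α ⊗ u) ⊕ r₂ ⊗ (α ⊗ m) ⇐
              ① ∙ (r₃ ≋ α ⊗ u ⊗ r₁ ⊕ α ⊗ m ⊗ r₂) & none) h)
            (deduce (r₁ ∷ r₂ ∷ r₄ ∷ α ∷ v ∷ []) (λ r₁ r₂ r₄ α v → r₄ ≋ r₁ ⊗ ⓪ ⊕ r₂ ⊗ (α ⊗ v) ⇐
              ① ∙ (r₄ ≋ α ⊗ v ⊗ r₂) & none) h′)
          from : ∀ R → R ∈ ⟨ P⟨ α * u ⟩ , Q ⟩ → R ∈ ℓₘ
          from (point (_ ∷ _ ∷ _ ∷ _ ∷ []) _) (a , b , refl) =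
              deduce (a ∷ b ∷ α ∷ u ∷ m ∷ []) (λ a b α u m →
                a ⊗ (α ⊗ u) ⊕ b ⊗ (α ⊗ m) ≋ α ⊗ u ⊗ (a ⊗ ① ⊕ b ⊗ ⓪) ⊕ α ⊗ m ⊗ (a ⊗ ⓪ ⊕ b ⊗ ①) ⇐ none)
            , deduce (a ∷ b ∷ α ∷ v ∷ []) (λ a b α v → a ⊗ ⓪ ⊕ b ⊗ (α ⊗ v) ≋ α ⊗ v ⊗ (a ⊗ ⓪ ⊕ b ⊗ ①) ⇐ none)

        ℓₘ-isLine : IsLine ℓₘ
        ℓₘ-isLine = P⟨ α * u ⟩ , Q , (λ (c , _ , e) → 1≢0 (trans (cong x₁ e) (zeroʳ c))) , ℓₘ≐join

        baer-subline : (∃[ x ] x ≢ 0# × conj x ≡ u * x) → (∃[ y ] y ≢ 0# × conj y ≡ v * y) →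
          IsLineOf Σ[ α ] (ℓₘ ∩ (π⟨ α * v ⟩ ∩ Σ[ α ]))
        baer-subline (x₀ , x₀≢0 , x̄₀≡ux₀) (y₀ , y₀≢0 , ȳ₀≡vy₀) =
            R , S , (x₀ , 0# , x₀≢0 ∘ proj₁ , 1# , 1≢0 , 1· _) , (x , y₀ , y₀≢0 ∘ proj₂ , 1# , 1≢0 , 1· _)
          , (λ (c , c≢0 , e) → *-nonzero c≢0 y₀≢0 (sym (cong x₂ e)))
          , (λ {T} (T∈ℓ , _ , T∈Σ) → proj₁ ℓₘ≐RS {T} T∈ℓ , T∈Σ)
          , (λ {T} (T∈RS , T∈Σ) → let T∈ℓ = proj₂ ℓₘ≐RS {T} T∈RS in T∈ℓ , proj₂ T∈ℓ , T∈Σ)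
          where
          x : F
          -- The twist of `m` gives w = m y₀ the property w^q = -w / u, so x^q = σ^q w and u x = -σ
          -- w; they differ by (σ + σ^q) w = w.
          x = - (conj u * σ * (m * y₀))
          x̄≡ux+my₀ : conj x ≡ u * x + m * y₀
          x̄≡ux+my₀ = deduce (u ∷ v ∷ σ ∷ m ∷ y₀ ∷ []) (λ u v σ m y →
            let x = ⊝ (u ‾ ⊗ σ ⊗ (m ⊗ y)) in
            x ‾ ≋ u ⊗ x ⊕ m ⊗ y ⇐
              ⊝ (u ⊗ σ ‾ ⊗ m ‾) ∙ (y ‾ ≋ v ⊗ y) & ⊝ (σ ‾ ⊗ y) ∙ (m ⊕ u ⊗ v ⊗ m ‾ ≋ ⓪)
            & m ⊗ y ∙ (σ ⊕ σ ‾ ≋ ①) & σ ⊗ m ⊗ y ∙ (u ⊗ u ‾ ≋ ①) & none)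
            ȳ₀≡vy₀ m-twisted (proj₂ trace-one) u∈𝒰
          R S : Point
          R = point (x₀ ∷ 0# ∷ α * conj x₀ ∷ α * conj 0# ∷ []) (x₀≢0 ∘ cong x₁)
          S = point (x ∷ y₀ ∷ α * conj x ∷ α * conj y₀ ∷ []) (y₀≢0 ∘ cong x₂)
          R∈ℓ : R ∈ ℓₘ
          R∈ℓ = deduce (α ∷ u ∷ m ∷ x₀ ∷ []) (λ α u m x → α ⊗ x ‾ ≋ α ⊗ u ⊗ x ⊕ α ⊗ m ⊗ ⓪ ⇐ α ∙ (x ‾ ≋ u ⊗ x) & none) x̄₀≡ux₀
              , deduce (α ∷ v ∷ []) (λ α v → α ⊗ ⓪ ‾ ≋ α ⊗ v ⊗ ⓪ ⇐ none)
          S∈ℓ : S ∈ ℓₘ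
          S∈ℓ = deduce (α ∷ u ∷ m ∷ x ∷ y₀ ∷ []) (λ α u m x y → α ⊗ x ‾ ≋ α ⊗ u ⊗ x ⊕ α ⊗ m ⊗ y ⇐
                  α ∙ (x ‾ ≋ u ⊗ x ⊕ m ⊗ y) & none) x̄≡ux+my₀
              , deduce (α ∷ v ∷ y₀ ∷ []) (λ α v y → α ⊗ y ‾ ≋ α ⊗ v ⊗ y ⇐ α ∙ (y ‾ ≋ v ⊗ y) & none) ȳ₀≡vy₀
          minor≢0 : x₀ * y₀ - 0# * x ≢ 0#
          minor≢0 e = *-nonzero x₀≢0 y₀≢0 (deduce (x₀ ∷ y₀ ∷ x ∷ []) (λ x₀ y₀ x → x₀ ⊗ y₀ ≋ ⓪ ⇐ ① ∙ (x₀ ⊗ y₀ ⊖ ⓪ ⊗ x ≋ ⓪) & none) e)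
          ℓₘ≐RS : ℓₘ ≐ ⟨ R , S ⟩
          ℓₘ≐RS = ≐-trans ℓₘ≐join (join-unique {x₁} {x₂} {P⟨ α * u ⟩} {Q} {R} {S} linear₁ linear₂
            (proj₁ ℓₘ≐join {R} R∈ℓ) (proj₁ ℓₘ≐join {S} S∈ℓ) minor≢0)

      twisted⇒pencil : ℓₘ ∈ p α u v
      twisted⇒pencil = ℓₘ-isLine , (λ {R} (_ , h′) → h′) , Pₘ∈ℓ , baer-subline (hilbert90 u u∈𝒰) (hilbert90 v v∈𝒰)

      twisted≢r : ¬ ℓₘ ≐ r[U₁]
      twisted≢r (ℓ⊆r , _) = off-r (ℓ⊆r {Q} Q∈ℓ)
        where
        off-r : ¬ Q ∈ r[U₁]
        off-r (a , b , e) = 1≢0 (trans (cong x₂ e) (deduce (a ∷ b ∷ []) (λ a b → a ⊗ ⓪ ⊕ b ⊗ ⓪ ≋ ⓪ ⇐ none)))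

    β γ : F
    β = η * conj (α * u)
    γ = η * conj (α * v)

    admissible : ∀ {δ} → β * conj δ + conj γ * δ ≡ 0# → Admissible β γ δ (norm α)
    admissible h = record
      { ββ̄≡N = scaled-norm u∈𝒰
      ; γγ̄≡N = scaled-norm v∈𝒰
      ; N≢1  = norm≢1 α∈ℐ
      ; N≢0  = *-nonzero (α≢0 α∈ℐ) (conj-≢0 (α≢0 α∈ℐ))
      ; trace-zero = h
      }
      where
      scaled-norm : ∀ {u} → u ∈ 𝒰 → η * conj (α * u) * conj (η * conj (α * u)) ≡ α * conj α
      scaled-norm {u} u∈𝒰 = deduce (η ∷ α ∷ u ∷ []) (λ η α u → η ⊗ (α ⊗ u) ‾ ⊗ (η ⊗ (α ⊗ u) ‾) ‾ ≋ α ⊗ α ‾ ⇐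
        α ⊗ α ‾ ⊗ u ⊗ u ‾ ∙ (η ⊗ η ‾ ≋ ①) & α ⊗ α ‾ ∙ (u ⊗ u ‾ ≋ ①) & none) η∈𝒰 u∈𝒰

    switch : PointSet → Pred PointSet _
    switch ℓ = (𝒮 ℓ ∖ ℛ ℓ) ∪ Opposite Ση (ℛ ℓ)

    unit-norm : ∀ {u} → u ∈ 𝒰 → α * u * conj (α * u) ≡ norm α
    unit-norm {u} u∈𝒰 = deduce (α ∷ u ∷ []) (λ α u → α ⊗ u ⊗ (α ⊗ u) ‾ ≋ α ⊗ α ‾ ⇐ α ⊗ α ‾ ∙ (u ⊗ u ‾ ≋ ①) & none) u∈𝒰

    switch≐lines : ∀ {ℓ m} → ℓ ≐ Incident (α * u) (α * m) (α * v) →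
      β * conj (η * conj (α * m)) + conj γ * (η * conj (α * m)) ≡ 0# →
      switch ℓ ≐ Lines (SwitchedCode β γ (η * conj (α * m)))
    switch≐lines {ℓ} {m} ℓ≐I trace = switched≐lines (admissible trace)
      (𝒮≐lines {α * u} {α * m} {α * v} (unit-norm u∈𝒰) (unit-norm v∈𝒰) (norm≢1 α∈ℐ) {ℓ} ℓ≐I) 𝒟η≐lines

    twisted⇒trace : ∀ {m} → Twisted u v m → β * conj (η * conj (α * m)) + conj γ * (η * conj (α * m)) ≡ 0#
    twisted⇒trace {m} h = deduce (η ∷ α ∷ u ∷ v ∷ m ∷ []) (λ η α u v m →
      let β = η ⊗ (α ⊗ u) ‾; γ = η ⊗ (α ⊗ v) ‾; δ = η ⊗ (α ⊗ m) ‾ in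
      β ⊗ δ ‾ ⊕ γ ‾ ⊗ δ ≋ ⓪ ⇐
        u ‾ ⊗ η ⊗ η ‾ ⊗ α ⊗ α ‾ ∙ (m ⊕ u ⊗ v ⊗ m ‾ ≋ ⓪)
      & ⊝ (η ⊗ η ‾ ⊗ α ⊗ α ‾ ⊗ v ⊗ m ‾) ∙ (u ⊗ u ‾ ≋ ①) & none) h u∈𝒰

    trace⇒twisted : ∀ δ → β * conj δ + conj γ * δ ≡ 0# → ∃[ m ] Twisted u v m × δ ≡ η * conj (α * m)
    trace⇒twisted δ h = go (inverse α (α≢0 α∈ℐ))
      where
      go : ∃[ i ] α * i ≡ 1# → ∃[ m ] Twisted u v m × δ ≡ η * conj (α * m)
      -- The solution of δ = η (α m)^q for m, as η^q = 1 / η.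
      go (i , αi≡1) = i * (η * conj δ)
        , *-cancelˡ-≡ (α≢0 α∈ℐ) (*-cancelˡ-≡ (conj-≢0 (α≢0 α∈ℐ)) (deduce (η ∷ α ∷ u ∷ v ∷ δ ∷ i ∷ []) (λ η α u v δ i →
            let β = η ⊗ (α ⊗ u) ‾; γ = η ⊗ (α ⊗ v) ‾; m = i ⊗ (η ⊗ δ ‾) in
            α ‾ ⊗ (α ⊗ (m ⊕ u ⊗ v ⊗ m ‾)) ≋ α ‾ ⊗ (α ⊗ ⓪) ⇐
              α ‾ ⊗ η ⊗ δ ‾ ∙ (α ⊗ i ≋ ①) & α ⊗ u ⊗ v ⊗ η ‾ ⊗ δ ∙ ((α ⊗ i) ‾ ≋ ① ‾)
            & ⊝ (α ‾ ⊗ η ⊗ δ ‾) ∙ (u ⊗ u ‾ ≋ ①)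
            & u ∙ (β ⊗ δ ‾ ⊕ γ ‾ ⊗ δ ≋ ⓪) & none) αi≡1 (cong conj αi≡1) u∈𝒰 h))
        , deduce (η ∷ α ∷ δ ∷ i ∷ []) (λ η α δ i → δ ≋ η ⊗ (α ⊗ (i ⊗ (η ⊗ δ ‾))) ‾ ⇐
            ⊝ (η ⊗ η ‾ ⊗ δ) ∙ ((α ⊗ i) ‾ ≋ ① ‾) & ⊝ δ ∙ (η ⊗ η ‾ ≋ ①) & none) (cong conj αi≡1) η∈𝒰

  -- The spreads of all q + 1 pencils together.

  module _ (α u v : Fin (suc q) → F) (in-range : ∀ i → α i ∈ ℐ × u i ∈ 𝒰 × v i ∈ 𝒰) where

    private
      α∈ℐ : ∀ i → α i ∈ ℐ
      α∈ℐ i = proj₁ (in-range i)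
      u∈𝒰 : ∀ i → u i ∈ 𝒰
      u∈𝒰 i = proj₁ (proj₂ (in-range i))
      v∈𝒰 : ∀ i → v i ∈ 𝒰
      v∈𝒰 i = proj₂ (proj₂ (in-range i))

      βᵢ γᵢ : Fin (suc q) → F
      βᵢ i = η * conj (α i * u i)
      γᵢ i = η * conj (α i * v i)

      Trace : Fin (suc q) → F → Set
      Trace i δ = βᵢ i * conj δ + conj (γᵢ i) * δ ≡ 0#

      Kᵢ : Fin (suc q) → F → Code → Set
      Kᵢ i δ = SwitchedCode (βᵢ i) (γᵢ i) δ

      admissibleᵢ : ∀ i {δ} → Trace i δ → Admissible (βᵢ i) (γᵢ i) δ (norm (α i))
      admissibleᵢ i = admissible (α∈ℐ i) (u∈𝒰 i) (v∈𝒰 i)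

    -- Trades the line ℓ for the parameters `i` and `δ`, which can be compared by equality while
    -- lines and spreads are compared only by `_≐_`.
    data Described (S : Pred PointSet (lsuc 0ℓ)) : Set₁ where
      desarguesian : S ≐ Lines DesarguesianCode → Described S
      switched     : ∀ i δ → Trace i δ → S ≐ Lines (Kᵢ i δ) → Described S

    described : ∀ S → S ∈ Π α u v → Described S
    described S (inj₂ S≐𝒟) = desarguesian (≐-trans S≐𝒟 𝒟η≐lines)
    described S (inj₁ (ℓ , ((i , ℓ∈p) , ℓ≢r) , S≐)) = go (pencil⇒twisted (α∈ℐ i) (u∈𝒰 i) (v∈𝒰 i) ℓ ℓ∈p ℓ≢r)
      where
      go : TwistedLine (α∈ℐ i) (u∈𝒰 i) (v∈𝒰 i) ℓ → Described S
      go (m , m-twisted , ℓ≐I) = switched i (η * conj (α i * m)) trace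
          (≐-trans S≐ (switch≐lines (α∈ℐ i) (u∈𝒰 i) (v∈𝒰 i) {ℓ} {m} ℓ≐I trace))
        where
        trace = twisted⇒trace (α∈ℐ i) (u∈𝒰 i) (v∈𝒰 i) m-twisted

    desarguesian∈Π : ∃[ S ] S ∈ Π α u v × S ≐ Lines DesarguesianCode
    -- Members of `Π` live at the universe level of `Opposite`, one above that of `𝒟η`.
    desarguesian∈Π = (λ L → Lift (lsuc 0ℓ) (L ∈ 𝒟η)) , inj₂ S≐𝒟 , ≐-trans S≐𝒟 𝒟η≐lines
      where
      S≐𝒟 : (λ L → Lift (lsuc 0ℓ) (L ∈ 𝒟η)) ≐ 𝒟η
      S≐𝒟 = lower , lift

    switched∈Π : ∀ i δ → Trace i δ → ∃[ S ] S ∈ Π α u v × S ≐ Lines (Kᵢ i δ)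
    switched∈Π i δ trace = go (trace⇒twisted (α∈ℐ i) (u∈𝒰 i) (v∈𝒰 i) δ trace)
      where
      go : ∃[ m ] Twisted (u i) (v i) m × δ ≡ η * conj (α i * m) → ∃[ S ] S ∈ Π α u v × S ≐ Lines (Kᵢ i δ)
      go (m , m-twisted , refl) = switch (α∈ℐ i) (u∈𝒰 i) (v∈𝒰 i) ℓ
          , inj₁ (ℓ , ((i , twisted⇒pencil (α∈ℐ i) (u∈𝒰 i) (v∈𝒰 i) m-twisted) , twisted≢r (α∈ℐ i) (u∈𝒰 i) (v∈𝒰 i) m-twisted) , ≐-refl)
          , switch≐lines (α∈ℐ i) (u∈𝒰 i) (v∈𝒰 i) {ℓ} {m} ≐-refl trace
        where
        ℓ = Incident (α i * u i) (α i * m) (α i * v i)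

    private
      inverses : ∀ i → ∃[ b ] conj (α i * v i) * b ≡ 1#
      inverses i = inverse (conj (α i * v i)) (conj-≢0 (*-nonzero (α≢0 (α∈ℐ i)) (𝒰-≢0 (v∈𝒰 i))))
      b : Fin (suc q) → F
      b i = proj₁ (inverses i)
      B̄b≡1 : ∀ i → conj (α i * v i) * b i ≡ 1#
      B̄b≡1 i = proj₂ (inverses i)

    -- A line of type H ν a μ occurs in a spread of pencil i iff ν = ratio i · μ, and one of
    -- type G e g with g ≠ 0 iff g^q = twist i · g.
    ratio twist : Fin (suc q) → F
    ratio i = u i * conj (v i)
    twist i = - (conj η * conj η * (α i * u i) * b i)

    ratio-of : ∀ {i ν μ} → ν * βᵢ i ≡ μ * γᵢ i → ν ≡ ratio i * μ
    ratio-of {i} {ν} {μ} h = *-cancelˡ-≡ (*-nonzero η≢0 (conj-≢0 (α≢0 (α∈ℐ i)))) (deduce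
      (η ∷ α i ∷ u i ∷ v i ∷ ν ∷ μ ∷ []) (λ η α u v ν μ →
      η ⊗ α ‾ ⊗ ν ≋ η ⊗ α ‾ ⊗ (u ⊗ v ‾ ⊗ μ) ⇐ u ∙ (ν ⊗ (η ⊗ (α ⊗ u) ‾) ≋ μ ⊗ (η ⊗ (α ⊗ v) ‾))
      & ⊝ (η ⊗ α ‾ ⊗ ν) ∙ (u ⊗ u ‾ ≋ ①) & none) h (u∈𝒰 i))

    of-ratio : ∀ {i ν μ} → ν ≡ ratio i * μ → ν * βᵢ i ≡ μ * γᵢ i
    of-ratio {i} {ν} {μ} h = deduce (η ∷ α i ∷ u i ∷ v i ∷ ν ∷ μ ∷ []) (λ η α u v ν μ →
      ν ⊗ (η ⊗ (α ⊗ u) ‾) ≋ μ ⊗ (η ⊗ (α ⊗ v) ‾) ⇐ η ⊗ (α ⊗ u) ‾ ∙ (ν ≋ u ⊗ v ‾ ⊗ μ)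
      & v ‾ ⊗ μ ⊗ η ⊗ α ‾ ∙ (u ⊗ u ‾ ≋ ①) & none) h (u∈𝒰 i)

    twist-of : ∀ {i g} → βᵢ i * conj g ≡ - (conj (γᵢ i) * g) → conj g ≡ twist i * g
    twist-of {i} {g} h = deduce (η ∷ (α i * u i) ∷ (α i * v i) ∷ b i ∷ g ∷ []) (λ η A B b g →
      g ‾ ≋ ⊝ (η ‾ ⊗ η ‾ ⊗ A ⊗ b) ⊗ g ⇐
        η ‾ ⊗ b ∙ ((η ⊗ A ‾ ⊗ g ‾) ‾ ≋ (⊝ ((η ⊗ B ‾) ‾ ⊗ g)) ‾)
      & ⊝ (g ‾ ⊗ b ⊗ B ‾) ∙ (η ⊗ η ‾ ≋ ①) & ⊝ (g ‾) ∙ (B ‾ ⊗ b ≋ ①) & none)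
      (cong conj h) η∈𝒰 (B̄b≡1 i)

    of-twist : ∀ {i g} → conj g ≡ twist i * g → βᵢ i * conj g ≡ - (conj (γᵢ i) * g)
    of-twist {i} {g} h = deduce (η ∷ (α i * u i) ∷ (α i * v i) ∷ b i ∷ g ∷ []) (λ η A B b g →
      η ⊗ A ‾ ⊗ g ‾ ≋ ⊝ ((η ⊗ B ‾) ‾ ⊗ g) ⇐
        η ‾ ⊗ B ∙ (g ‾ ‾ ≋ (⊝ (η ‾ ⊗ η ‾ ⊗ A ⊗ b) ⊗ g) ‾)
      & ⊝ (η ⊗ A ‾ ⊗ g ‾ ⊗ B ⊗ b ‾) ∙ (η ⊗ η ‾ ≋ ①) & ⊝ (η ⊗ A ‾ ⊗ g ‾) ∙ ((B ‾ ⊗ b) ‾ ≋ ① ‾) & none)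
      (cong conj h) η∈𝒰 (cong conj (B̄b≡1 i))

    ratio∈𝒰 : ∀ i → ratio i ∈ 𝒰
    ratio∈𝒰 i = deduce (u i ∷ v i ∷ []) (λ u v → u ⊗ v ‾ ⊗ (u ⊗ v ‾) ‾ ≋ ① ⇐
      v ⊗ v ‾ ∙ (u ⊗ u ‾ ≋ ①) & ① ∙ (v ⊗ v ‾ ≋ ①) & none) (u∈𝒰 i) (v∈𝒰 i)

    twist∈𝒰 : ∀ i → twist i ∈ 𝒰
    twist∈𝒰 i = deduce (η ∷ (α i * u i) ∷ (α i * v i) ∷ b i ∷ norm (α i) ∷ []) (λ η A B b N →
      let t = ⊝ (η ‾ ⊗ η ‾ ⊗ A ⊗ b) in
      t ⊗ t ‾ ≋ ① ⇐
        (① ⊕ η ⊗ η ‾) ⊗ A ⊗ A ‾ ⊗ b ⊗ b ‾ ∙ (η ⊗ η ‾ ≋ ①)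
      & b ⊗ b ‾ ∙ (A ⊗ A ‾ ≋ N) & ⊝ (b ⊗ b ‾) ∙ (B ⊗ B ‾ ≋ N)
      & B ⊗ b ‾ ∙ (B ‾ ⊗ b ≋ ①) & ① ∙ ((B ‾ ⊗ b) ‾ ≋ ① ‾) & none)
      η∈𝒰 (unit-norm (α∈ℐ i) (u∈𝒰 i) (v∈𝒰 i) (u∈𝒰 i)) (unit-norm (α∈ℐ i) (u∈𝒰 i) (v∈𝒰 i) (v∈𝒰 i)) (B̄b≡1 i) (cong conj (B̄b≡1 i))

    -- On `𝒰` conjugation is inversion, so the first condition on a good set compares the quotients
    -- u / v.
    ratio-≡ : ∀ {i j} → u i * v j - v i * u j ≡ 0# → ratio i ≡ ratio j
    ratio-≡ {i} {j} h = deduce (u i ∷ v i ∷ u j ∷ v j ∷ []) (λ u v u′ v′ → u ⊗ v ‾ ≋ u′ ⊗ v′ ‾ ⇐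
      v ‾ ⊗ v′ ‾ ∙ (u ⊗ v′ ⊖ v ⊗ u′ ≋ ⓪) & ⊝ (u ⊗ v ‾) ∙ (v′ ⊗ v′ ‾ ≋ ①) & u′ ⊗ v′ ‾ ∙ (v ⊗ v ‾ ≋ ①) & none)
      h (v∈𝒰 j) (v∈𝒰 i)

    ≡-ratio : ∀ {i j} → ratio i ≡ ratio j → u i * v j - v i * u j ≡ 0#
    ≡-ratio {i} {j} h = deduce (u i ∷ v i ∷ u j ∷ v j ∷ []) (λ u v u′ v′ → u ⊗ v′ ⊖ v ⊗ u′ ≋ ⓪ ⇐
      v ⊗ v′ ∙ (u ⊗ v ‾ ≋ u′ ⊗ v′ ‾) & ⊝ (u ⊗ v′) ∙ (v ⊗ v ‾ ≋ ①) & v ⊗ u′ ∙ (v′ ⊗ v′ ‾ ≋ ①) & none)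
      h (v∈𝒰 i) (v∈𝒰 j)

    -- Division by both factors (αv)^q turns the second condition on a good set into one on αu /
    -- (αv)^q, which is `twist` up to a constant factor.
    twist-≡ : ∀ {i j} → α i * u i * conj (α j * v j) - conj (α i * v i) * (α j * u j) ≡ 0# → twist i ≡ twist j
    twist-≡ {i} {j} h = deduce
      (η ∷ (α i * u i) ∷ (α i * v i) ∷ b i ∷ (α j * u j) ∷ (α j * v j) ∷ b j ∷ []) (λ η A B b A′ B′ b′ →
      ⊝ (η ‾ ⊗ η ‾ ⊗ A ⊗ b) ≋ ⊝ (η ‾ ⊗ η ‾ ⊗ A′ ⊗ b′) ⇐
        ⊝ (η ‾ ⊗ η ‾ ⊗ b ⊗ b′) ∙ (A ⊗ B′ ‾ ⊖ B ‾ ⊗ A′ ≋ ⓪)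
      & η ‾ ⊗ η ‾ ⊗ A ⊗ b ∙ (B′ ‾ ⊗ b′ ≋ ①) & ⊝ (η ‾ ⊗ η ‾ ⊗ A′ ⊗ b′) ∙ (B ‾ ⊗ b ≋ ①) & none)
      h (B̄b≡1 j) (B̄b≡1 i)

    ≡-twist : ∀ {i j} → twist i ≡ twist j → α i * u i * conj (α j * v j) - conj (α i * v i) * (α j * u j) ≡ 0#
    ≡-twist {i} {j} h = *-cancelˡ-≡ (*-nonzero (conj-≢0 η≢0) (conj-≢0 η≢0)) (deduce
      (η ∷ (α i * u i) ∷ (α i * v i) ∷ b i ∷ (α j * u j) ∷ (α j * v j) ∷ b j ∷ []) (λ η A B b A′ B′ b′ →
      η ‾ ⊗ η ‾ ⊗ (A ⊗ B′ ‾ ⊖ B ‾ ⊗ A′) ≋ η ‾ ⊗ η ‾ ⊗ ⓪ ⇐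
        ⊝ (B ‾ ⊗ B′ ‾) ∙ (⊝ (η ‾ ⊗ η ‾ ⊗ A ⊗ b) ≋ ⊝ (η ‾ ⊗ η ‾ ⊗ A′ ⊗ b′))
      & ⊝ (η ‾ ⊗ η ‾ ⊗ A ⊗ B′ ‾) ∙ (B ‾ ⊗ b ≋ ①) & η ‾ ⊗ η ‾ ⊗ A′ ⊗ B ‾ ∙ (B′ ‾ ⊗ b′ ≋ ①) & none)
      h (B̄b≡1 i) (B̄b≡1 j))

    -- A good set speaks of distinct triples, injectivity of distinct indices; equal triples would
    -- give equal pairs, against `PairwiseDistinct`.
    good⇒injective : PairwiseDistinct α u v → IsGood α u v → Injective _≡_ _≡_ ratio × Injective _≡_ _≡_ twist
    good⇒injective distinct good =
        (λ {i} {j} e → decidable-stable (i Fin.≟ j) λ i≢j → proj₁ (good i j (triples i≢j)) (≡-ratio {i} {j} e))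
      , (λ {i} {j} e → decidable-stable (i Fin.≟ j) λ i≢j → proj₂ (good i j (triples i≢j)) (≡-twist {i} {j} e))
      where
      same : ∀ {w w′ z z′} → w ≡ w′ → z ≡ z′ → P⟨ w ⟩ ≈ P⟨ w′ ⟩ × π⟨ z ⟩ ≐ π⟨ z′ ⟩
      same refl refl = (1# , 1≢0 , 1· _) , ≐-refl
      triples : ∀ {i j} → i ≢ j → (α i , u i , v i) ≢ (α j , u j , v j)
      triples i≢j e = distinct i≢j
        (same (cong (λ (a , b , _) → a * b) e) (cong (λ (a , _ , c) → a * c) e))

    injective⇒good : Injective _≡_ _≡_ ratio → Injective _≡_ _≡_ twist → IsGood α u v
    injective⇒good ratio-inj twist-inj i j triple≢ =
        (λ e → triple≢ (cong (λ k → α k , u k , v k) (ratio-inj (ratio-≡ {i} {j} e))))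
      , (λ e → triple≢ (cong (λ k → α k , u k , v k) (twist-inj (twist-≡ {i} {j} e))))

    -- From a parallelism to a good set.

    parallelism⇒covered : IsLineParallelism Ση (Π α u v) → ∀ c → IsLineCode c →
      Locus c ∈ Lines DesarguesianCode ⊎ ∃₂ λ i δ → Trace i δ × Locus c ∈ Lines (Kᵢ i δ)
    parallelism⇒covered (_ , _ , cover) c c-line =
      let S , S∈Π , c∈S , _ = cover (Locus c) (locus-isLine c c-line) in go (described S S∈Π) c∈S
      where
      go : ∀ {S} → Described S → Locus c ∈ S →
        Locus c ∈ Lines DesarguesianCode ⊎ ∃₂ λ i δ → Trace i δ × Locus c ∈ Lines (Kᵢ i δ)
      go (desarguesian (S⊆ , _))         c∈S = inj₁ (S⊆ {Locus c} c∈S)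
      go (switched i δ trace (S⊆ , _)) c∈S = inj₂ (i , δ , trace , S⊆ {Locus c} c∈S)

    -- The test line `H ν 0# 1#` with ν = x^q / x has μ = 1, so any pencil with a spread containing
    -- it has ratio ν.
    parallelism⇒ratio-covers : IsLineParallelism Ση (Π α u v) → ∀ x → x ≢ 0# → ∃[ i ] conj x ≡ ratio i * x
    parallelism⇒ratio-covers par x x≢0 = build (inverse x x≢0)
      where
      build : ∃[ i ] x * i ≡ 1# → ∃[ i ] conj x ≡ ratio i * x
      build (x⁻¹ , xx⁻¹≡1) = go (parallelism⇒covered par (H ν 0# 1#) (ν∈𝒰 , 1∈𝒰))
        where
        ν : F
        ν = conj x * x⁻¹
        ν∈𝒰 : ν ∈ 𝒰
        ν∈𝒰 = quotient∈𝒰 xx⁻¹≡1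
        1∈𝒰 : 1# ∈ 𝒰
        1∈𝒰 = trans (*-identityˡ _) conj-1
        ratio-at : ∀ i {ν′ μ′} → ν ≡ ν′ → 1# ≡ μ′ → ν′ * βᵢ i ≡ μ′ * γᵢ i → conj x ≡ ratio i * x
        ratio-at i refl refl h = deduce (x ∷ x⁻¹ ∷ ratio i ∷ []) (λ x i r → x ‾ ≋ r ⊗ x ⇐
          x ∙ (x ‾ ⊗ i ≋ r ⊗ ①) & ⊝ (x ‾) ∙ (x ⊗ i ≋ ①) & none) (ratio-of {i} {ν} {1#} h) xx⁻¹≡1
        go : _ → ∃[ i ] conj x ≡ ratio i * x
        go (inj₁ (∞       , _   , c≐)) = ⊥-elim (H⋢∞ 1∈𝒰 (locus-≐⇒⊑ (H ν 0# 1#) ∞ c≐))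
        go (inj₁ (G e g   , _   , c≐)) = ⊥-elim (H⋢G ν∈𝒰 (locus-≐⇒⊑ (H ν 0# 1#) (G e g) c≐))
        go (inj₁ (H _ _ _ , 0≡1 , _))  = contradiction 0≡1 0≢1
        go (inj₂ (i , δ , _ , ∞ , 0≡1 , _)) = contradiction 0≡1 0≢1
        go (inj₂ (i , δ , _ , G e g , _ , c≐)) = ⊥-elim (H⋢G ν∈𝒰 (locus-≐⇒⊑ (H ν 0# 1#) (G e g) c≐))
        go (inj₂ (i , δ , _ , H ν′ a′ μ′ , (_ , h , _) , c≐)) =
          let ν≡ν′ , 1≡μ′ , _ = H-injective ν∈𝒰 1∈𝒰 (locus-≐⇒⊑ (H ν 0# 1#) (H ν′ a′ μ′) c≐)
          in i , ratio-at i ν≡ν′ 1≡μ′ h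

    -- The test line `G 0# x` has the given element as its `g`; it is not Desarguesian, and by
    -- `spread-trace` it reveals the twist of its pencil.
    parallelism⇒twist-covers : IsLineParallelism Ση (Π α u v) → ∀ x → x ≢ 0# → ∃[ i ] conj x ≡ twist i * x
    parallelism⇒twist-covers par x x≢0 = go (parallelism⇒covered par (G 0# x) refl)
      where
      twist-at : ∀ i {δ e g} → Trace i δ → 0# ≡ e × x ≡ g → Kᵢ i δ (G e g) → conj x ≡ twist i * x
      twist-at i {δ} {e} {g} trace (refl , refl) (_ , h) = twist-of {i} (spread-trace (admissibleᵢ i trace) {0#} {x} h)
      go : _ → ∃[ i ] conj x ≡ twist i * x
      go (inj₁ (∞       , _   , c≐)) = ⊥-elim (∞⋢G (locus-≐⇒⊑ ∞ (G 0# x) (≐-sym c≐)))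
      go (inj₁ (G e g   , g≡0 , c≐)) =
        contradiction (trans (proj₂ (G-injective (locus-≐⇒⊑ (G 0# x) (G e g) c≐))) g≡0) x≢0
      go (inj₁ (H _ _ _ , 0≡1 , _))  = contradiction 0≡1 0≢1
      go (inj₂ (i , δ , _ , ∞ , 0≡1 , _)) = contradiction 0≡1 0≢1
      go (inj₂ (i , δ , trace , G e g , K , c≐)) =
        i , twist-at i trace (G-injective (locus-≐⇒⊑ (G 0# x) (G e g) c≐)) K
      go (inj₂ (i , δ , _ , H ν a μ , ((ν∈𝒰 , _) , _) , c≐)) =
        ⊥-elim (H⋢G ν∈𝒰 (locus-≐⇒⊑ (H ν a μ) (G 0# x) (≐-sym c≐)))

    parallelism⇒good : IsLineParallelism Ση (Π α u v) → IsGood α u v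
    parallelism⇒good par = injective⇒good
      (conj-quotients-injective ratio (parallelism⇒ratio-covers par))
      (conj-quotients-injective twist (parallelism⇒twist-covers par))

    -- From injective invariants to a parallelism.

    module _ (ratio-inj : Injective _≡_ _≡_ ratio) (twist-inj : Injective _≡_ _≡_ twist) where

      -- The twist of a `G` line or the ratio of an `H` line determines the pencil, and the equation
      -- of the line then determines δ. For `H` the ambiguity of `a` does no harm, because it solves
      -- the homogeneous equation β k^q = γ k.
      shared-line : ∀ {i δ j ε L} c c′ → Trace i δ → Trace j ε → Kᵢ i δ c → Kᵢ j ε c′ →
        L ≐ Locus c → L ≐ Locus c′ → i ≡ j × δ ≡ ε
      shared-line ∞ _ _ _ 0≡1 _ _ _ = contradiction 0≡1 0≢1
      shared-line (G _ _)   ∞ _ _ _ 0≡1 _ _ = contradiction 0≡1 0≢1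
      shared-line (H _ _ _) ∞ _ _ _ 0≡1 _ _ = contradiction 0≡1 0≢1
      shared-line {L = L} (G e g) (H ν a μ) _ _ _ ((ν∈𝒰 , _) , _) L≐c L≐c′ =
        ⊥-elim (H⋢G ν∈𝒰 (≐⇒⊑ {L} (H ν a μ) (G e g) L≐c′ L≐c))
      shared-line {L = L} (H ν a μ) (G e g) _ _ ((ν∈𝒰 , _) , _) _ L≐c L≐c′ =
        ⊥-elim (H⋢G ν∈𝒰 (≐⇒⊑ {L} (H ν a μ) (G e g) L≐c L≐c′))
      shared-line {i} {δ} {j} {ε} {L} (G e g) (G e′ g′) tr tr′ K K′ L≐c L≐c′ =
        same (G-injective (≐⇒⊑ {L} (G e g) (G e′ g′) L≐c L≐c′)) K K′
        where
        same-δ : i ≡ j → Kᵢ i δ (G e g) → Kᵢ j ε (G e g) → δ ≡ ε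
        same-δ refl (_ , h) (_ , h′) = deduce (βᵢ i ∷ γᵢ i ∷ δ ∷ ε ∷ e ∷ g ∷ []) (λ β γ δ ε e g → δ ≋ ε ⇐
          ⊝ ① ∙ (g ⊕ γ ⊗ e ≋ β ⊗ e ‾ ⊕ β ⊗ γ ⊗ g ‾ ⊕ δ) & ① ∙ (g ⊕ γ ⊗ e ≋ β ⊗ e ‾ ⊕ β ⊗ γ ⊗ g ‾ ⊕ ε) & none) h h′
        same : ∀ {e′ g′} → e ≡ e′ × g ≡ g′ → Kᵢ i δ (G e g) → Kᵢ j ε (G e′ g′) → i ≡ j × δ ≡ ε
        same (refl , refl) K@(g≢0 , h) K′@(_ , h′) = i≡j , same-δ i≡j K K′
          where
          twist-g : ∀ i {δ} → Trace i δ → SpreadCode (βᵢ i) (γᵢ i) δ (G e g) → conj g ≡ twist i * g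
          twist-g i tr h = twist-of {i} (spread-trace (admissibleᵢ i tr) {e} {g} h)
          i≡j : i ≡ j
          i≡j = twist-inj (*-cancelˡ-≡ g≢0 (trans (*-comm g _) (trans (trans (sym (twist-g i tr h)) (twist-g j tr′ h′)) (*-comm _ g))))
      shared-line {i} {δ} {j} {ε} {L} (H ν a μ) (H ν′ a′ μ′) tr tr′ K@((ν∈𝒰 , μ∈𝒰) , h , ha) K′@(_ , h′ , ha′) L≐c L≐c′ =
        same (H-injective ν∈𝒰 μ∈𝒰 (≐⇒⊑ {L} (H ν a μ) (H ν′ a′ μ′) L≐c L≐c′)) h′
        where
        same-δ : i ≡ j → conj (a - a′) * μ ≡ ν * (a - a′) → γᵢ j * a′ ≡ βᵢ j * conj a′ + ε → δ ≡ ε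
        same-δ refl e ha′ = *-cancelˡ-≡ (𝒰-≢0 μ∈𝒰) (deduce
          (βᵢ i ∷ γᵢ i ∷ δ ∷ ε ∷ ν ∷ μ ∷ a ∷ a′ ∷ []) (λ β γ δ ε ν μ a a′ →
          μ ⊗ δ ≋ μ ⊗ ε ⇐ ⊝ μ ∙ (γ ⊗ a ≋ β ⊗ a ‾ ⊕ δ) & μ ∙ (γ ⊗ a′ ≋ β ⊗ a′ ‾ ⊕ ε)
          & ⊝ β ∙ ((a ⊖ a′) ‾ ⊗ μ ≋ ν ⊗ (a ⊖ a′)) & ⊝ (a ⊖ a′) ∙ (ν ⊗ β ≋ μ ⊗ γ) & none) ha ha′ e h)
        same : ∀ {ν′ μ′} → ν ≡ ν′ × μ ≡ μ′ × conj (a - a′) * μ ≡ ν * (a - a′) → ν′ * βᵢ j ≡ μ′ * γᵢ j → i ≡ j × δ ≡ ε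
        same (refl , refl , e) h′ = i≡j , same-δ i≡j e ha′
          where
          i≡j : i ≡ j
          i≡j = ratio-inj (*-cancelˡ-≡ (𝒰-≢0 μ∈𝒰) (trans (*-comm μ _)
            (trans (trans (sym (ratio-of {i} {ν} {μ} h)) (ratio-of {j} {ν} {μ} h′)) (*-comm _ μ))))

      switched≢desarguesian : ∀ {i δ L} → L ∈ Lines (Kᵢ i δ) → ¬ L ∈ Lines DesarguesianCode
      switched≢desarguesian (∞ , 0≡1 , _) _ = 0≢1 0≡1
      switched≢desarguesian _ (H _ _ _ , 0≡1 , _) = 0≢1 0≡1
      switched≢desarguesian {L = L} (G e g , _ , L≐c) (∞ , _ , L≐c′) = ∞⋢G (≐⇒⊑ {L} ∞ (G e g) L≐c′ L≐c)
      switched≢desarguesian {L = L} (G e g , (g≢0 , _) , L≐c) (G e′ g′ , g′≡0 , L≐c′) =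
        g≢0 (trans (proj₂ (G-injective (≐⇒⊑ {L} (G e g) (G e′ g′) L≐c L≐c′))) g′≡0)
      switched≢desarguesian {L = L} (H ν a μ , ((_ , μ∈𝒰) , _) , L≐c) (∞ , _ , L≐c′) =
        H⋢∞ μ∈𝒰 (≐⇒⊑ {L} (H ν a μ) ∞ L≐c L≐c′)
      switched≢desarguesian {L = L} (H ν a μ , ((ν∈𝒰 , _) , _) , L≐c) (G e g , _ , L≐c′) =
        H⋢G ν∈𝒰 (≐⇒⊑ {L} (H ν a μ) (G e g) L≐c L≐c′)

      spread-unique : ∀ S T L → S ∈ Π α u v → T ∈ Π α u v → L ∈ S → L ∈ T → T ≐ S
      spread-unique S T L S∈Π T∈Π L∈S L∈T = go (described S S∈Π) (described T T∈Π)
        where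
        go : Described S → Described T → T ≐ S
        go (desarguesian S≐) (desarguesian T≐) = ≐-trans T≐ (≐-sym S≐)
        go (desarguesian S≐) (switched i δ _ T≐) =
          ⊥-elim (switched≢desarguesian {i} {δ} {L} (proj₁ T≐ {L} L∈T) (proj₁ S≐ {L} L∈S))
        go (switched i δ _ S≐) (desarguesian T≐) =
          ⊥-elim (switched≢desarguesian {i} {δ} {L} (proj₁ S≐ {L} L∈S) (proj₁ T≐ {L} L∈T))
        go (switched i δ tr S≐) (switched j ε tr′ T≐) = common (proj₁ S≐ {L} L∈S) (proj₁ T≐ {L} L∈T)
          where
          equal : i ≡ j × δ ≡ ε → T ≐ S
          equal (refl , refl) = ≐-trans T≐ (≐-sym S≐)
          common : L ∈ Lines (Kᵢ i δ) → L ∈ Lines (Kᵢ j ε) → T ≐ S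
          common (c , K , L≐c) (c′ , K′ , L≐c′) = equal (shared-line {i} {δ} {j} {ε} {L} c c′ tr tr′ K K′ L≐c L≐c′)

      Covering : PointSet → Set₂
      Covering L = ∃[ S ] S ∈ Π α u v × L ∈ S

      in-desarguesian : ∀ L c → DesarguesianCode c → L ≐ Locus c → Covering L
      in-desarguesian L c K L≐c = let S , S∈Π , S≐ = desarguesian∈Π in S , S∈Π , proj₂ S≐ {L} (c , K , L≐c)

      in-switched : ∀ L c i δ → Trace i δ → Kᵢ i δ c → L ≐ Locus c → Covering L
      in-switched L c i δ tr K L≐c = let S , S∈Π , S≐ = switched∈Π i δ tr in S , S∈Π , proj₂ S≐ {L} (c , K , L≐c)

      private
        β-norm : ∀ i → βᵢ i * conj (βᵢ i) ≡ norm (α i)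
        β-norm i = Admissible.ββ̄≡N (admissibleᵢ i {0#} (deduce (βᵢ i ∷ γᵢ i ∷ []) (λ β γ → β ⊗ ⓪ ‾ ⊕ γ ‾ ⊗ ⓪ ≋ ⓪ ⇐ none)))
        γ-norm : ∀ i → γᵢ i * conj (γᵢ i) ≡ norm (α i)
        γ-norm i = Admissible.γγ̄≡N (admissibleᵢ i {0#} (deduce (βᵢ i ∷ γᵢ i ∷ []) (λ β γ → β ⊗ ⓪ ‾ ⊕ γ ‾ ⊗ ⓪ ≋ ⓪ ⇐ none)))

      covering : ∀ L → IsLineOf Ση L → Covering L
      covering L L-line = go (classification L L-line)
        where
        go : CodedLine L → Covering L
        go (∞ , _ , L≐c) = in-desarguesian L ∞ refl L≐c
        go (H ν a μ , (ν∈𝒰 , μ∈𝒰) , L≐c) =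
          -- The pencil required is one with ratio ν / μ, and 1 / μ is the conjugate of μ.
          found (norm-one-surjective ratio ratio-inj ratio∈𝒰 (ν * conj μ) (𝒰-* ν∈𝒰 μ̄∈𝒰))
          where
          μ̄∈𝒰 : conj μ ∈ 𝒰
          μ̄∈𝒰 = trans (*-comm _ _) (trans (cong (_* conj μ) (conj-conj μ)) μ∈𝒰)
          found : ∃[ i ] ratio i ≡ ν * conj μ → Covering L
          found (i , ratio≡) = in-switched L (H ν a μ) i δ trace
              ( (ν∈𝒰 , μ∈𝒰)
              , of-ratio {i} {ν} {μ} (deduce (ν ∷ μ ∷ ratio i ∷ []) (λ ν μ r → ν ≋ r ⊗ μ ⇐
                  ⊝ μ ∙ (r ≋ ν ⊗ μ ‾) & ⊝ ν ∙ (μ ⊗ μ ‾ ≋ ①) & none) ratio≡ μ∈𝒰)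
              , deduce (βᵢ i ∷ γᵢ i ∷ a ∷ []) (λ β γ a → γ ⊗ a ≋ β ⊗ a ‾ ⊕ (γ ⊗ a ⊖ β ⊗ a ‾) ⇐ none)) L≐c
            where
            -- Chosen so that `a` is a slope of the regulus; `trace` then holds because β and γ have
            -- equal norms.
            δ : F
            δ = γᵢ i * a - βᵢ i * conj a
            trace : Trace i δ
            trace = deduce (βᵢ i ∷ γᵢ i ∷ a ∷ norm (α i) ∷ []) (λ β γ a N → let δ = γ ⊗ a ⊖ β ⊗ a ‾ in
              β ⊗ δ ‾ ⊕ γ ‾ ⊗ δ ≋ ⓪ ⇐ ⊝ a ∙ (β ⊗ β ‾ ≋ N) & a ∙ (γ ⊗ γ ‾ ≋ N) & none) (β-norm i) (γ-norm i)
        go (G e g , _ , L≐c) = split (g ≟ 0#)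
          where
          skew : g ≢ 0# → ∃[ j ] g * j ≡ 1# → Covering L
          skew g≢0 (g⁻¹ , gg⁻¹≡1) = found (norm-one-surjective twist twist-inj twist∈𝒰 (conj g * g⁻¹) (quotient∈𝒰 gg⁻¹≡1))
            where
            found : ∃[ i ] twist i ≡ conj g * g⁻¹ → Covering L
            found (i , twist≡) = in-switched L (G e g) i δ trace
                (g≢0 , deduce (βᵢ i ∷ γᵢ i ∷ e ∷ g ∷ []) (λ β γ e g →
                  g ⊕ γ ⊗ e ≋ β ⊗ e ‾ ⊕ β ⊗ γ ⊗ g ‾ ⊕ (g ⊕ γ ⊗ e ⊖ β ⊗ e ‾ ⊖ β ⊗ γ ⊗ g ‾) ⇐ none)) L≐c
              where
              -- The value that the equation of the spread prescribes; its trace condition reduces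
              -- to the condition `βḡ` on g.
              δ : F
              δ = g + γᵢ i * e - βᵢ i * conj e - βᵢ i * γᵢ i * conj g
              βḡ : βᵢ i * conj g ≡ - (conj (γᵢ i) * g)
              βḡ = of-twist {i} (deduce (g ∷ g⁻¹ ∷ twist i ∷ []) (λ g i t → g ‾ ≋ t ⊗ g ⇐
                ⊝ g ∙ (t ≋ g ‾ ⊗ i) & ⊝ (g ‾) ∙ (g ⊗ i ≋ ①) & none) twist≡ gg⁻¹≡1)
              trace : Trace i δ
              trace = deduce (βᵢ i ∷ γᵢ i ∷ e ∷ g ∷ norm (α i) ∷ []) (λ β γ e g N →
                let δ = g ⊕ γ ⊗ e ⊖ β ⊗ e ‾ ⊖ β ⊗ γ ⊗ g ‾ in
                β ⊗ δ ‾ ⊕ γ ‾ ⊗ δ ≋ ⓪ ⇐ ① ⊖ γ ⊗ γ ‾ ∙ (β ⊗ g ‾ ≋ ⊝ (γ ‾ ⊗ g))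
                & ⊝ (e ⊕ γ ‾ ⊗ g) ∙ (β ⊗ β ‾ ≋ N) & e ⊕ γ ‾ ⊗ g ∙ (γ ⊗ γ ‾ ≋ N) & none) βḡ (β-norm i) (γ-norm i)
          split : Dec (g ≡ 0#) → Covering L
          split (yes g≡0) = in-desarguesian L (G e g) g≡0 L≐c
          split (no g≢0)  = skew g≢0 (inverse g g≢0)

      injective⇒parallelism : IsLineParallelism Ση (Π α u v)
      injective⇒parallelism =
          (λ S S∈Π → spread S (described S S∈Π))
        , (λ S T S∈Π T∈Π S≢T {L} (L∈S , L∈T) → S≢T (≐-sym (spread-unique S T L S∈Π T∈Π L∈S L∈T)))
        , λ L L-line → let S , S∈Π , L∈S = covering L L-line
                       in S , S∈Π , L∈S , λ T T∈Π L∈T → spread-unique S T L S∈Π T∈Π L∈S L∈T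
        where
        spread : ∀ S → Described S → IsLineSpread Ση S
        spread S (desarguesian S≐)      = desarguesian-isLineSpread S≐
        spread S (switched i δ tr S≐) = switched-isLineSpread (admissibleᵢ i tr) S≐

    parallelism⇔good : PairwiseDistinct α u v → IsLineParallelism Ση (Π α u v) ⇔ IsGood α u v
    parallelism⇔good distinct = mk⇔ parallelism⇒good
      (λ good → let ratio-inj , twist-inj = good⇒injective distinct good in injective⇒parallelism ratio-inj twist-inj)

open import Data.Nat using (_≤_; _^_)

theorem3p4 :
  (q : ℕ) → IsPrimePower q → 3 ≤ q →
  (𝔽 : FiniteField (q ^ 2)) →
  let open FiniteField 𝔽 using () renaming (Carrier to F)
      open BaerGeometry q 𝔽 in
  (s : Setting) →
  let open Construction s in
  (α u v : Fin (suc q) → F) →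
  (∀ i → α i ∈ ℐ × u i ∈ 𝒰 × v i ∈ 𝒰) →
  PairwiseDistinct α u v →
  IsLineParallelism Ση (Π α u v) ⇔ IsGood α u v
theorem3p4 q q-primePower 3≤q 𝔽 s = Switching.parallelism⇔good q q-primePower 3≤q 𝔽 s
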